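{- The randomized online algorithm $\mathrm{Rand}$ (defined in the context) is $8\ln n$-competitive for online MinLA when all revealed graphs are collections of lines. That is, for every node set $V$ with $|V|=n$ and every line instance $\sigma=(\pi_0;G_0,\dots,G_k)$ on $V$, $$\mathbb{E}[\mathrm{Rand}(\sigma)]\le 8\ln n\cdot \mathrm{Opt}(\sigma).$$
   Context: Let $V$ be a set of $n$ nodes. A permutation is a bijection $\pi:V\to\{1,\dots,n\}$ ($\pi(x)$ is the position of $x$; smaller positions are further left). A MinLA of a graph $G=(V,E)$ is a permutation $\pi$ minimizing $\sum_{\{x,y\}\in E}|\pi(x)-\pi(y)|$ among all permutations. $d(\pi,\pi')$ is the Kendall tau distance: the minimum number of swaps of adjacent elements transforming $\pi$ into $\pi'$. Line instance: an arbitrary initial permutation $\pi_0$ and a sequence $G_0,\dots,G_k$ of graphs on $V$, where $G_0$ has no edges, every $G_i$ is a disjoint union of paths (isolated nodes are paths with one node), and $G_{i+1}$ is obtained from $G_i$ by adding one edge $\{x_i,z_i\}$ between two distinct components. Let $X_i\ni x_i$ and $Z_i\ni z_i$ be the node sets of the components of $G_i$ containing $x_i$ and $z_i$. Feasible solution: permutations $\pi_1,\dots,\pi_k$ such that $\pi_i$ is a MinLA of $G_i$ for each $i$; its cost is $\sum_{i=0}^{k-1}d(\pi_i,\pi_{i+1})$. An online algorithm must choose $\pi_i$ knowing only $\pi_0,G_0,\dots,G_i$. $\mathrm{Opt}(\sigma)$ is the minimum cost of a feasible solution of the instance $\sigma$ (full knowledge of $\sigma$). A randomized algorithm is $c$-competitive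 (against the oblivious adversary) if on every fixed instance $\sigma$ its expected cost is at most $c\cdot\mathrm{Opt}(\sigma)$. Algorithm $\mathrm{Rand}$ (lines): when $G_{i+1}$ is revealed, it updates $\pi_i$ in two parts, using fresh independent coins. (1) Moving part: with probability $|Z_i|/(|X_i|+|Z_i|)$, move the block $X_i$ (keeping its internal order) towards $Z_i$ past all nodes lying between them until it is adjacent to $Z_i$; with the remaining probability $|X_i|/(|X_i|+|Z_i|)$, move the block $Z_i$ (keeping its internal order) towards $X_i$ until it is adjacent to $X_i$. (2) Rearranging part: the block $X_i\cup Z_i$ must now be put in one of the two orders (mutually reverse) in which its nodes appear along the path of $G_{i+1}$ on $X_i\cup Z_i$. Each of the two target orders is reached by some combination of: reversing $X_i$ (cost $\binom{|X_i|}{2}$), swapping the blocks $X_i$ and $Z_i$ (cost $|X_i||Z_i|$), reversing $Z_i$ (cost $\binom{|Z_i|}{2}$); the costs of the two targets sum to $\binom{|X_i|+|Z_i|}{2}$. $\mathrm{Rand}$ chooses each target with probability equal to the cost of the other target divided by $\binom{|X_i|+|Z_i|}{2}$. (For example, if $X_i$ is to the left of $Z_i$, and $x_i$, $z_i$ are the leftmost nodes of their blocks, it reverses $X_i$ with probability $(|X_i||Z_i|+\binom{|Z_i|}{2})/\binom{|X_i|+|Z_i|}{2}$, and otherwise swaps $X_i$ with $Z_i$ and reverses $Z_i$.) The result is $\pi_{i+1}$; the cost $\mathrm{Rand}(\sigma)$ is the total number of adjacent swaps performed in both parts over all updates. -}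

module Defs where

import Algebra.Properties.Group as GroupProperties
open import Data.Bool.Base using (Bool; true; false; if_then_else_)
open import Data.Empty using (⊥-elim)
open import Data.Fin.Base using (Fin)
import Data.Fin.Properties as Fin
open import Data.Integer.Base using (+_)
import Data.Integer.Base as ℤ
import Data.Integer.Properties as ℤ
open import Data.List.Base
  using (List; []; _∷_; _++_; allFin; concatMap; filter; find; length; map;
         reverse; takeWhile; dropWhile)
import Data.List.Properties as List
open import Data.List.Membership.Propositional using (_∈_)
open import Data.List.Membership.Propositional.Properties using (∈-∃++)
open import Data.List.Relation.Binary.Permutation.Propositional
  using (_↭_; prep; swap; ↭-refl; ↭-reflexive; ↭-sym; ↭-trans)
  renaming (refl to ↭refl; trans to ↭trans)
open import Data.List.Relation.Binary.Permutation.Propositional.Properties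
  using (∈-resp-↭; drop-∷; ↭-reverse; ++-comm; ++⁺; ++⁺ˡ; ++⁺ʳ; shift; shifts;
         ↭-length; ↭-empty-inv)
open import Data.List.Relation.Unary.Any using (here; there; any?)
open import Data.List.Relation.Unary.Unique.Propositional using (Unique)
open import Data.Maybe.Base using (fromMaybe)
open import Data.Nat.Base
  using (ℕ; zero; suc; pred; _+_; _*_; _∸_; _≤_; _<_; z≤n; s≤s; NonZero; ∣_-_∣)
open import Data.Nat.ListAction using (sum)
open import Data.Nat.Combinatorics using (_C_)
import Data.Nat.Properties as ℕ
open import Data.Product.Base using (Σ; ∃; ∃₂; _×_; _,_; proj₁; proj₂)
open import Data.Rational.Base as ℚ using (ℚ; 0ℚ; 1ℚ; _/_)
import Data.Rational.Properties as ℚ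
import Data.Rational.Unnormalised.Base as ℚᵘ
import Data.Rational.Unnormalised.Properties as ℚᵘ
open import Data.Sum.Base using (_⊎_; inj₁; inj₂)
open import Function.Base using (_∘_; case_of_)
open import Function.Bundles using (_⇔_)
open import Relation.Binary.Construct.Closure.ReflexiveTransitive
  using (Star; ε; _◅_; _◅◅_)
open import Relation.Binary.Construct.Closure.Symmetric using (SymClosure; fwd; bwd)
open import Relation.Binary.Definitions using (DecidableEquality)
open import Relation.Binary.PropositionalEquality
  using (_≡_; refl; sym; trans; cong; cong₂; subst; subst₂; module ≡-Reasoning)
open import Relation.Nullary using (Dec; yes; no; ¬_; does; ¬?)
open import Relation.Nullary.Decidable using (map′; _×-dec_; _⊎-dec_)
open import Relation.Unary using (Pred; Decidable)
import Relation.Binary.Reasoning.Setoid as SetoidReasoning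

private
  module ≃-Reasoning = SetoidReasoning ℚᵘ.≃-setoid

  variable
    n : ℕ
    A B : Set

IsLeast : (ℕ → Set) → ℕ → Set
IsLeast P m = P m × (∀ {k} → P k → m ≤ k)

least : {P : ℕ → Set} → Decidable P → ∃ P → ∃ (IsLeast P)
least P? (m , p) = upTo P? m p
  where
  upTo : {P : ℕ → Set} → Decidable P → ∀ m → P m → ∃ (IsLeast P)
  upTo P? zero p = zero , p , λ _ → z≤n
  upTo {P} P? (suc m) p with P? zero
  ... | yes p₀ = zero , p₀ , λ _ → z≤n
  ... | no ¬p₀ with k , pk , k-min ← upTo (P? ∘ suc) m p = suc k , pk , bound
    where
    bound : ∀ {j} → P j → suc k ≤ j
    bound {zero}  pj = ⊥-elim (¬p₀ pj)
    bound {suc j} pj = s≤s (k-min pj)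

IsLeast-unique : {P : ℕ → Set} {k m : ℕ} → IsLeast P k → IsLeast P m → k ≡ m
IsLeast-unique (pk , k-min) (pm , m-min) = ℕ.≤-antisym (k-min pm) (m-min pk)

-- A graph on the node set Fin n is the list of its edges.  Edges are
-- unordered: {x , z} may be listed as (x , z) or as (z , x).  The graphs of an
-- instance (see Reveals) are simple, since every new edge joins two distinct
-- components.

Graph : ℕ → Set
Graph n = List (Fin n × Fin n)

Adjacent : Graph n → Fin n → Fin n → Set
Adjacent G = SymClosure (λ x z → (x , z) ∈ G)

Connected : Graph n → Fin n → Fin n → Set
Connected G = Star (Adjacent G)

weaken : ∀ {G : Graph n} {e x y} → Connected G x y → Connected (e ∷ G) x y
weaken ε           = ε
weaken (fwd i ◅ s) = fwd (there i) ◅ weaken s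
weaken (bwd i ◅ s) = bwd (there i) ◅ weaken s

ThroughEdge : Graph n → Fin n → Fin n → Fin n → Fin n → Set
ThroughEdge G a b x y = Connected G x y
                      ⊎ (Connected G x a × Connected G b y)
                      ⊎ (Connected G x b × Connected G a y)

throughEdge⇒ : ∀ {G : Graph n} {a b x y} →
               ThroughEdge G a b x y → Connected ((a , b) ∷ G) x y
throughEdge⇒ (inj₁ s)              = weaken s
throughEdge⇒ (inj₂ (inj₁ (s , t))) = weaken s ◅◅ fwd (here refl) ◅ weaken t
throughEdge⇒ (inj₂ (inj₂ (s , t))) = weaken s ◅◅ bwd (here refl) ◅ weaken t

prepend : ∀ {G : Graph n} {a b w x y} → Adjacent G w x →
          ThroughEdge G a b x y → ThroughEdge G a b w y
prepend e (inj₁ s)              = inj₁ (e ◅ s)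
prepend e (inj₂ (inj₁ (s , t))) = inj₂ (inj₁ (e ◅ s , t))
prepend e (inj₂ (inj₂ (s , t))) = inj₂ (inj₂ (e ◅ s , t))

throughEdge⇐ : ∀ {G : Graph n} {a b x y} →
               Connected ((a , b) ∷ G) x y → ThroughEdge G a b x y
throughEdge⇐ ε = inj₁ ε
throughEdge⇐ (fwd (there i) ◅ s) = prepend (fwd i) (throughEdge⇐ s)
throughEdge⇐ (bwd (there i) ◅ s) = prepend (bwd i) (throughEdge⇐ s)
throughEdge⇐ (fwd (here refl) ◅ s) with throughEdge⇐ s
... | inj₁ t              = inj₂ (inj₁ (ε , t))
... | inj₂ (inj₁ (_ , t)) = inj₂ (inj₁ (ε , t))
... | inj₂ (inj₂ (_ , t)) = inj₁ t
throughEdge⇐ (bwd (here refl) ◅ s) with throughEdge⇐ s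
... | inj₁ t              = inj₂ (inj₂ (ε , t))
... | inj₂ (inj₁ (_ , t)) = inj₁ t
... | inj₂ (inj₂ (_ , t)) = inj₂ (inj₂ (ε , t))

connected? : (G : Graph n) (x y : Fin n) → Dec (Connected G x y)
connected? [] x y = map′ (λ { refl → ε })
  (λ { ε → refl ; (fwd () ◅ _) ; (bwd () ◅ _) }) (x Fin.≟ y)
connected? ((a , b) ∷ G) x y = map′ throughEdge⇒ throughEdge⇐
  (connected? G x y
    ⊎-dec (connected? G x a ×-dec connected? G b y)
    ⊎-dec (connected? G x b ×-dec connected? G a y))

Consecutive : List A → A → A → Set
Consecutive xs y z = ∃₂ λ as bs → xs ≡ as ++ y ∷ z ∷ bs

record IsPath (G : Graph n) (x : Fin n) : Set where
  field
    nodes     : List (Fin n)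
    distinct  : Unique nodes
    component : ∀ y → (y ∈ nodes) ⇔ Connected G x y
    edges     : ∀ y z → y ∈ nodes → z ∈ nodes →
                Adjacent G y z ⇔ SymClosure (Consecutive nodes) y z

-- Disjoint unions of paths: the component of every node is a path.
Lines : Graph n → Set
Lines {n} G = (x : Fin n) → IsPath G x

-- A permutation is given by the word of its nodes from left to right.
record Arrangement (n : ℕ) : Set where
  constructor arrangement
  field
    word     : List (Fin n)
    complete : word ↭ allFin n

open Arrangement public

-- π(x), as one plus the number of nodes to the left of x.
position : Arrangement n → Fin n → ℕ
position π x = suc (length (takeWhile (λ y → ¬? (y Fin.≟ x)) (word π)))

linearCost : Graph n → Arrangement n → ℕ
linearCost G π = sum (map (λ (x , z) → ∣ position π x - position π z ∣) G)

IsMinLA : Graph n → Arrangement n → Set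
IsMinLA G π = ∀ π′ → linearCost G π ≤ linearCost G π′

data AdjacentSwap {A : Set} : List A → List A → Set where
  here  : ∀ {x y xs} → AdjacentSwap (x ∷ y ∷ xs) (y ∷ x ∷ xs)
  there : ∀ {x xs ys} → AdjacentSwap xs ys → AdjacentSwap (x ∷ xs) (x ∷ ys)

data Swaps {A : Set} : ℕ → List A → List A → Set where
  []  : ∀ {xs} → Swaps zero xs xs
  _∷_ : ∀ {m xs ys zs} → AdjacentSwap xs ys → Swaps m ys zs → Swaps (suc m) xs zs

anySwap? : {P : List A → Set} → Decidable P → (xs : List A) →
           Dec (∃ λ ys → AdjacentSwap xs ys × P ys)
anySwap? P? []           = no λ { (_ , () , _) }
anySwap? P? (x ∷ [])     = no λ { (_ , there () , _) }
anySwap? P? (x ∷ y ∷ xs) = map′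
  (λ { (inj₁ p) → _ , here , p ; (inj₂ (_ , s , p)) → _ , there s , p })
  (λ { (_ , here , p) → inj₁ p ; (_ , there s , p) → inj₂ (_ , s , p) })
  (P? (y ∷ x ∷ xs) ⊎-dec anySwap? (P? ∘ (x ∷_)) (y ∷ xs))

swaps? : DecidableEquality A → ∀ m (xs ys : List A) → Dec (Swaps m xs ys)
swaps? _≟_ zero    xs ys =
  map′ (λ { refl → [] }) (λ { [] → refl }) (List.≡-dec _≟_ xs ys)
swaps? _≟_ (suc m) xs ys = map′
  (λ (_ , s , ss) → s ∷ ss) (λ { (s ∷ ss) → _ , s , ss })
  (anySwap? (λ zs → swaps? _≟_ m zs ys) xs)

prep-swaps : ∀ {m} {x : A} {xs ys} → Swaps m xs ys → Swaps m (x ∷ xs) (x ∷ ys)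
prep-swaps []       = []
prep-swaps (s ∷ ss) = there s ∷ prep-swaps ss

_++ˢ_ : ∀ {k m} {xs ys zs : List A} →
        Swaps k xs ys → Swaps m ys zs → Swaps (k + m) xs zs
[]       ++ˢ ts = ts
(s ∷ ss) ++ˢ ts = s ∷ (ss ++ˢ ts)

↭⇒swaps : {xs ys : List A} → xs ↭ ys → ∃ λ m → Swaps m xs ys
↭⇒swaps ↭refl        = _ , []
↭⇒swaps (prep x p)   = _ , prep-swaps (proj₂ (↭⇒swaps p))
↭⇒swaps (swap x y p) = _ , here ∷ prep-swaps (prep-swaps (proj₂ (↭⇒swaps p)))
↭⇒swaps (↭trans p q) = _ , (proj₂ (↭⇒swaps p) ++ˢ proj₂ (↭⇒swaps q))

kendallTau : (π π′ : Arrangement n) →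
             ∃ (IsLeast (λ m → Swaps m (word π) (word π′)))
kendallTau π π′ = least (λ m → swaps? Fin._≟_ m (word π) (word π′))
  (↭⇒swaps (↭-trans (complete π) (↭-sym (complete π′))))

d : Arrangement n → Arrangement n → ℕ
d π π′ = proj₁ (kendallTau π π′)

-- The sequences of graphs that may be revealed after G, one edge at a time.
data Reveals {n : ℕ} (G : Graph n) : Set where
  []     : Reveals G
  reveal : (x z : Fin n) → ¬ Connected G x z → Lines ((x , z) ∷ G) →
           Reveals ((x , z) ∷ G) → Reveals G

record LineInstance (n : ℕ) : Set where
  field
    π₀      : Arrangement n
    reveals : Reveals {n} []

data Solution {n : ℕ} : {G : Graph n} → Reveals G → Set where
  []     : ∀ {G} → Solution {G = G} []
  choose : ∀ {G x z x≁z lines} {rs : Reveals ((x , z) ∷ G)} →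
           (π : Arrangement n) → IsMinLA ((x , z) ∷ G) π → Solution rs →
           Solution (reveal x z x≁z lines rs)

solutionCost : {G : Graph n} {rs : Reveals G} → Arrangement n → Solution rs → ℕ
solutionCost π []              = 0
solutionCost π (choose π′ _ s) = d π π′ + solutionCost π′ s

infix 4 _≋_
_≋_ : Arrangement n → Arrangement n → Set
π ≋ π′ = word π ≡ word π′

d-congˡ : (π π′ ρ : Arrangement n) → π ≋ π′ → d π ρ ≡ d π′ ρ
d-congˡ π π′ ρ eq = IsLeast-unique
  (subst (λ w → IsLeast (λ m → Swaps m w (word ρ)) (d π ρ)) eq
         (proj₂ (kendallTau π ρ)))
  (proj₂ (kendallTau π′ ρ))

d-congʳ : (ρ π π′ : Arrangement n) → π ≋ π′ → d ρ π ≡ d ρ π′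
d-congʳ ρ π π′ eq = IsLeast-unique
  (subst (λ w → IsLeast (λ m → Swaps m (word ρ) w) (d ρ π)) eq
         (proj₂ (kendallTau ρ π)))
  (proj₂ (kendallTau ρ π′))

linearCost-cong : (G : Graph n) (π π′ : Arrangement n) → π ≋ π′ →
                  linearCost G π ≡ linearCost G π′
linearCost-cong G (arrangement w _) (arrangement .w _) refl = refl

solutionCost-cong : {G : Graph n} {rs : Reveals G} (π π′ : Arrangement n) →
                    π ≋ π′ → (s : Solution rs) →
                    solutionCost π s ≡ solutionCost π′ s
solutionCost-cong π π′ eq []             = refl
solutionCost-cong π π′ eq (choose ρ _ s) =
  cong (λ t → t + solutionCost ρ s) (d-congˡ π π′ ρ eq)

_∈?_ : (x : Fin n) (xs : List (Fin n)) → Dec (x ∈ xs)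
x ∈? xs = any? (x Fin.≟_) xs

_↭?_ : (xs ys : List (Fin n)) → Dec (xs ↭ ys)
[]       ↭? []       = yes ↭-refl
[]       ↭? (y ∷ ys) = no λ p → case ↭-empty-inv (↭-sym p) of λ ()
(x ∷ xs) ↭? ys with x ∈? ys
... | no x∉ys = no λ p → x∉ys (∈-resp-↭ p (here refl))
... | yes x∈ys with as , bs , refl ← ∈-∃++ x∈ys = map′
  (λ p → ↭-trans (prep x p) (↭-sym (shift x as bs)))
  (λ p → drop-∷ (↭-trans p (shift x as bs)))
  (xs ↭? (as ++ bs))

anyWord? : {P : List (Fin n) → Set} → Decidable P →
           ∀ m → Dec (∃ λ w → length w ≡ m × P w)
anyWord? P? zero = map′ (λ p → [] , refl , p) (λ { ([] , refl , p) → p }) (P? [])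
anyWord? P? (suc m) = map′
  (λ { (x , w , refl , p) → x ∷ w , refl , p })
  (λ { (x ∷ w , refl , p) → x , w , refl , p })
  (Fin.any? λ x → anyWord? (P? ∘ (x ∷_)) m)

anyArrangement? : {P : Arrangement n → Set} → Decidable P →
                  (∀ {π π′} → π ≋ π′ → P π → P π′) → Dec (∃ P)
anyArrangement? {n} {P} P? resp = map′
  (λ (w , _ , c , p) → arrangement w c , p)
  (λ (π , p) → word π , ↭-length (complete π) , complete π , p)
  (anyWord? word? (length (allFin n)))
  where
  word? : Decidable (λ w → Σ (w ↭ allFin n) λ c → P (arrangement w c))
  word? w with w ↭? allFin n
  ... | no ¬c = no (¬c ∘ proj₁)
  ... | yes c = map′ (c ,_) (λ (_ , p) → resp refl p) (P? (arrangement w c))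

isMinLA? : (G : Graph n) → Decidable (IsMinLA G)
isMinLA? G π = map′
  (λ ∄better π′ → ℕ.≮⇒≥ (λ lt → ∄better (π′ , lt)))
  (λ min (π′ , lt) → ℕ.<⇒≱ lt (min π′))
  (¬? (anyArrangement? (λ π′ → linearCost G π′ ℕ.<? linearCost G π)
        (λ {ρ} {ρ′} eq → subst (_< _) (linearCost-cong G ρ ρ′ eq))))

minLA : (G : Graph n) → Arrangement n → ∃ (IsMinLA G)
minLA G π₀ with least
    (λ c → anyArrangement? (λ π → linearCost G π ℕ.≟ c)
             (λ {ρ} {ρ′} eq → trans (sym (linearCost-cong G ρ ρ′ eq))))
    (_ , π₀ , refl)
... | _ , (π , refl) , π-min = π , λ π′ → π-min (π′ , refl)

someSolution : {G : Graph n} → Arrangement n → (rs : Reveals G) → Solution rs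
someSolution π []                  = []
someSolution {G = G} π (reveal x z _ _ rs) with minLA ((x , z) ∷ G) π
... | π′ , min = choose π′ min (someSolution π′ rs)

solution? : {G : Graph n} (rs : Reveals G) (π : Arrangement n) →
            Decidable (λ c → ∃ λ (s : Solution rs) → solutionCost π s ≡ c)
solution? []                      π c = map′ ([] ,_) (λ { ([] , eq) → eq }) (0 ℕ.≟ c)
solution? {G = G} (reveal x z _ _ rs) π c = map′
  (λ { (π′ , m , (s , eq) , le) →
       choose π′ m s , trans (cong (λ t → d π π′ + t) eq) (ℕ.m+[n∸m]≡n le) })
  (λ { (choose π′ m s , refl) →
       π′ , m , (s , sym (ℕ.m+n∸m≡n (d π π′) (solutionCost π′ s))) , ℕ.m≤m+n _ _ })
  (anyArrangement?
    (λ π′ → isMinLA? G′ π′ ×-dec solution? rs π′ (c ∸ d π π′)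
            ×-dec (d π π′ ℕ.≤? c))
    (λ {ρ} {ρ′} eq (m , (s , e) , le) →
      (λ π″ → subst (_≤ linearCost G′ π″) (linearCost-cong G′ ρ ρ′ eq) (m π″)) ,
      (s , trans (trans (sym (solutionCost-cong ρ ρ′ eq s)) e)
                 (cong (c ∸_) (d-congʳ π ρ ρ′ eq))) ,
      subst (_≤ c) (d-congʳ π ρ ρ′ eq) le))
  where
  G′ : Graph _
  G′ = (x , z) ∷ G

FeasibleCost : LineInstance n → ℕ → Set
FeasibleCost σ c = ∃ λ (s : Solution reveals) → solutionCost π₀ s ≡ c
  where open LineInstance σ

optimum : (σ : LineInstance n) → ∃ (IsLeast (FeasibleCost σ))
optimum σ = least (solution? reveals π₀) (_ , someSolution π₀ reveals , refl)
  where open LineInstance σ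

Opt : LineInstance n → ℕ
Opt σ = proj₁ (optimum σ)

-- The divisors below are block sizes and binomial coefficients that are
-- positive in every reachable state.
infixl 7 _÷_
_÷_ : ℕ → ℕ → ℚ
m ÷ zero  = 0ℚ
m ÷ suc k = + m / suc k

Dist : Set → Set
Dist A = List (ℚ × A)

return : A → Dist A
return a = (1ℚ , a) ∷ []

infixl 1 _>>=_
_>>=_ : Dist A → (A → Dist B) → Dist B
μ >>= f = concatMap (λ (p , a) → map (λ (q , b) → p ℚ.* q , b) (f a)) μ

𝔼 : Dist ℕ → ℚ
𝔼 []            = 0ℚ
𝔼 ((p , k) ∷ μ) = p ℚ.* (k ÷ 1) ℚ.+ 𝔼 μ

-- The combinations of block operations in the rearranging part, for a block
-- placed immediately to the left of another block.
record Combination : Set where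
  constructor combination
  field
    reverseLeft swapBlocks reverseRight : Bool

perform : Combination → List A → List A → List A
perform (combination rl sw rr) left right =
  if sw then right′ ++ left′ else left′ ++ right′
  where
  left′  = if rl then reverse left else left
  right′ = if rr then reverse right else right

combinationCost : Combination → ℕ → ℕ → ℕ
combinationCost (combination rl sw rr) p q =
  (if rl then p C 2 else 0) + (if sw then p * q else 0) + (if rr then q C 2 else 0)

combinations : List Combination
combinations =
  concatMap (λ rl → concatMap (λ sw → map (combination rl sw) bools) bools) bools
  where
  bools : List Bool
  bools = false ∷ true ∷ []

-- A combination turning left ++ right into target.  Two of them can do so only
-- if they differ in reversing a one-node block, at cost 0.  There is always one
-- when the current permutation is a MinLA of the current graph and target is an
-- order along the new path, so that the default is never used by Rand.
reaching : (target left right : List (Fin n)) → Combination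
reaching target left right = fromMaybe (combination false false false)
  (find (λ c → List.≡-dec Fin._≟_ (perform c left right) target) combinations)

data Moved : Set where
  leftBlock rightBlock : Moved

-- The word of the current permutation is split as
--   before ++ left ++ between ++ right ++ after
-- where left and right are the blocks of the components of l and r.
module Update (π : Arrangement n) (G : Graph n) (l r : Fin n) where

  inLeft?  = connected? G l
  inRight? = connected? G r

  w₁ w₂ w₃ : List (Fin n)
  w₁ = dropWhile (¬? ∘ inLeft?) (word π)
  w₂ = dropWhile inLeft? w₁
  w₃ = dropWhile (¬? ∘ inRight?) w₂

  before left between right after : List (Fin n)
  before  = takeWhile (¬? ∘ inLeft?) (word π)
  left    = takeWhile inLeft? w₁
  between = takeWhile (¬? ∘ inRight?) w₂
  right   = takeWhile inRight? w₃
  after   = dropWhile inRight? w₃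

  moving : Dist Moved
  moving = (length right ÷ (length left + length right) , leftBlock)
         ∷ (length left  ÷ (length left + length right) , rightBlock)
         ∷ []

  movingCost : Moved → ℕ
  movingCost leftBlock  = length left  * length between
  movingCost rightBlock = length right * length between

  cost : Combination → ℕ
  cost c = combinationCost c (length left) (length right)

  -- The argument is one of the two orders along the path of the new graph.
  rearranging : List (Fin n) → Dist Combination
  rearranging order = (cost c₂ ÷ total , c₁) ∷ (cost c₁ ÷ total , c₂) ∷ []
    where
    total = (length left + length right) C 2
    c₁ c₂ : Combination
    c₁ = reaching order           left right
    c₂ = reaching (reverse order) left right

  resultWord : Moved → Combination → List (Fin n)
  resultWord leftBlock  c = before ++ between ++ perform c left right ++ after
  resultWord rightBlock c = before ++ perform c left right ++ between ++ after

  split : word π ≡ before ++ left ++ between ++ right ++ after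
  split = begin
    word π
      ≡⟨ List.takeWhile++dropWhile (¬? ∘ inLeft?) (word π) ⟨
    before ++ w₁
      ≡⟨ cong (before ++_) (List.takeWhile++dropWhile inLeft? w₁) ⟨
    before ++ left ++ w₂
      ≡⟨ cong (λ w → before ++ left ++ w)
           (List.takeWhile++dropWhile (¬? ∘ inRight?) w₂) ⟨
    before ++ left ++ between ++ w₃
      ≡⟨ cong (λ w → before ++ left ++ between ++ w)
           (List.takeWhile++dropWhile inRight? w₃) ⟨
    before ++ left ++ between ++ right ++ after ∎
    where open ≡-Reasoning

  reverseIf : ∀ b (xs : List (Fin n)) → (if b then reverse xs else xs) ↭ xs
  reverseIf false xs = ↭-refl
  reverseIf true  xs = ↭-reverse xs

  perform-↭ : ∀ c (xs ys : List (Fin n)) → perform c xs ys ↭ xs ++ ys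
  perform-↭ (combination rl false rr) xs ys = ++⁺ (reverseIf rl xs) (reverseIf rr ys)
  perform-↭ (combination rl true  rr) xs ys = ↭-trans
    (++⁺ (reverseIf rr ys) (reverseIf rl xs)) (++-comm ys xs)

  block-↭ : ∀ c zs → perform c left right ++ zs ↭ left ++ right ++ zs
  block-↭ c zs = ↭-trans (++⁺ʳ zs (perform-↭ c left right))
                         (↭-reflexive (List.++-assoc left right zs))

  result-↭ : ∀ m c → resultWord m c ↭ word π
  result-↭ leftBlock c = ↭-trans
    (++⁺ˡ before (↭-trans (++⁺ˡ between (block-↭ c after)) (shifts between left)))
    (↭-reflexive (sym split))
  result-↭ rightBlock c = ↭-trans
    (++⁺ˡ before (↭-trans (block-↭ c (between ++ after))
                          (++⁺ˡ left (shifts right between))))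
    (↭-reflexive (sym split))

  result : Moved → Combination → Arrangement n
  result m c = arrangement (resultWord m c) (↭-trans (result-↭ m c) (complete π))

  update : List (Fin n) → Dist (Arrangement n × ℕ)
  update order =
    moving >>= λ m →
    rearranging order >>= λ c →
    return (result m c , movingCost m + cost c)

-- Rand treats the two endpoints of the new edge alike, so that they can be
-- named according to which of their blocks is further left.
randUpdate : (π : Arrangement n) (G : Graph n) (x z : Fin n) →
             IsPath ((x , z) ∷ G) x → Dist (Arrangement n × ℕ)
randUpdate π G x z path = if does (position π x ℕ.<? position π z)
  then Update.update π G x z (IsPath.nodes path)
  else Update.update π G z x (IsPath.nodes path)

randFrom : {G : Graph n} → Arrangement n → Reveals G → Dist ℕ
randFrom         π []                      = return 0
randFrom {G = G} π (reveal x z _ lines rs) =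
  randUpdate π G x z (lines x) >>= λ (π′ , c) →
  randFrom π′ rs >>= λ c′ →
  return (c + c′)

-- The distribution of the cost.
Rand : LineInstance n → Dist ℕ
Rand σ = randFrom π₀ reveals
  where open LineInstance σ

1/suc : ℕ → ℚ
1/suc k = + 1 / suc k

-- Real numbers in the sense of Bishop: seq m is within 1/(m+1) of the limit.
record ℝ : Set where
  field
    seq     : ℕ → ℚ
    regular : ∀ k m → ℚ.∣ seq k ℚ.- seq m ∣ ℚ.≤ 1/suc k ℚ.+ 1/suc m

open ℝ public

-- The error bound 2/(m+1) accounts for the distances of seq x m and seq y m
-- from their limits.
infix 4 _≤ℝ_
_≤ℝ_ : ℝ → ℝ → Set
x ≤ℝ y = ∀ m → seq x m ℚ.≤ seq y m ℚ.+ (1/suc m ℚ.+ 1/suc m)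

recip-nonNeg : ∀ k → 0ℚ ℚ.≤ 1/suc k
recip-nonNeg k = ℚ.nonNegative⁻¹ (1/suc k) {{ℚ.normalize-nonNeg 1 (suc k)}}

/-mono : ∀ {a b k m} → a * suc m ≤ b * suc k → + a / suc k ℚ.≤ + b / suc m
/-mono {a} {b} {k} {m} le = ℚ.toℚᵘ-cancel-≤ (begin
  ℚ.toℚᵘ (ℚ.fromℚᵘ (ℚᵘ.mkℚᵘ (+ a) k))  ≃⟨ ℚ.toℚᵘ-fromℚᵘ (ℚᵘ.mkℚᵘ (+ a) k) ⟩
  ℚᵘ.mkℚᵘ (+ a) k  ≤⟨ ℚᵘ.*≤* (subst₂ ℤ._≤_ (ℤ.pos-* a (suc m)) (ℤ.pos-* b (suc k))
                               (ℤ.+≤+ le)) ⟩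
  ℚᵘ.mkℚᵘ (+ b) m  ≃⟨ ℚ.toℚᵘ-fromℚᵘ (ℚᵘ.mkℚᵘ (+ b) m) ⟨
  ℚ.toℚᵘ (ℚ.fromℚᵘ (ℚᵘ.mkℚᵘ (+ b) m))  ∎)
  where open ℚᵘ.≤-Reasoning

recip-anti : ∀ {k m} → k ≤ m → 1/suc m ℚ.≤ 1/suc k
recip-anti {k} {m} le = /-mono {1} {1} {m} {k} (ℕ.*-monoʳ-≤ 1 (s≤s le))

scale-recip : ∀ c m → c ÷ 1 ℚ.* 1/suc (c * suc m) ℚ.≤ 1/suc m
scale-recip c m = ℚ.≤-trans (ℚ.≤-reflexive eq) (/-mono {c} {1} {c * suc m} {m} le)
  where
  eq : c ÷ 1 ℚ.* 1/suc (c * suc m) ≡ + c / suc (c * suc m)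
  eq = ℚ.toℚᵘ-injective (begin
    ℚ.toℚᵘ (+ c / 1 ℚ.* 1/suc (c * suc m))
      ≈⟨ ℚ.toℚᵘ-homo-* (+ c / 1) (1/suc (c * suc m)) ⟩
    ℚ.toℚᵘ (+ c / 1) ℚᵘ.* ℚ.toℚᵘ (1/suc (c * suc m))
      ≈⟨ ℚᵘ.*-cong (ℚ.toℚᵘ-fromℚᵘ (ℚᵘ.mkℚᵘ (+ c) 0))
                   (ℚ.toℚᵘ-fromℚᵘ (ℚᵘ.mkℚᵘ (+ 1) (c * suc m))) ⟩
    ℚᵘ.mkℚᵘ (+ c) 0 ℚᵘ.* ℚᵘ.mkℚᵘ (+ 1) (c * suc m)
      ≈⟨ ℚᵘ.*≡* (cong₂ ℤ._*_ (ℤ.*-identityʳ (+ c))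
                  (cong (λ t → + suc t) (sym (ℕ.+-identityʳ (c * suc m))))) ⟩
    ℚᵘ.mkℚᵘ (+ c) (c * suc m)
      ≈⟨ ℚ.toℚᵘ-fromℚᵘ (ℚᵘ.mkℚᵘ (+ c) (c * suc m)) ⟨
    ℚ.toℚᵘ (+ c / suc (c * suc m)) ∎)
    where open ≃-Reasoning
  le : c * suc m ≤ 1 * suc (c * suc m)
  le = ℕ.≤-trans (ℕ.n≤1+n _) (ℕ.≤-reflexive (sym (ℕ.*-identityˡ _)))

fromℚ : ℚ → ℝ
fromℚ q = record
  { seq     = λ _ → q
  ; regular = λ k m → ℚ.≤-trans
      (ℚ.≤-reflexive (cong ℚ.∣_∣ (ℚ.+-inverseʳ q)))
      (ℚ.+-mono-≤ (recip-nonNeg k) (recip-nonNeg m))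
  }

infixr 7 _·_
_·_ : ℕ → ℝ → ℝ
c · x = record
  { seq     = λ m → c ÷ 1 ℚ.* seq x (c * suc m)
  ; regular = λ k m → let i = c * suc k ; j = c * suc m in begin
      ℚ.∣ q ℚ.* seq x i ℚ.- q ℚ.* seq x j ∣
        ≡⟨ cong (λ t → ℚ.∣ q ℚ.* seq x i ℚ.+ t ∣) (ℚ.neg-distribʳ-* q (seq x j)) ⟩
      ℚ.∣ q ℚ.* seq x i ℚ.+ q ℚ.* (ℚ.- seq x j) ∣
        ≡⟨ cong ℚ.∣_∣ (ℚ.*-distribˡ-+ q (seq x i) (ℚ.- seq x j)) ⟨
      ℚ.∣ q ℚ.* (seq x i ℚ.- seq x j) ∣
        ≡⟨ ℚ.∣p*q∣≡∣p∣*∣q∣ q (seq x i ℚ.- seq x j) ⟩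
      ℚ.∣ q ∣ ℚ.* ℚ.∣ seq x i ℚ.- seq x j ∣
        ≡⟨ cong (ℚ._* ℚ.∣ seq x i ℚ.- seq x j ∣)
             (ℚ.0≤p⇒∣p∣≡p (ℚ.nonNegative⁻¹ q)) ⟩
      q ℚ.* ℚ.∣ seq x i ℚ.- seq x j ∣
        ≤⟨ ℚ.*-monoˡ-≤-nonNeg q (regular x i j) ⟩
      q ℚ.* (1/suc i ℚ.+ 1/suc j)
        ≡⟨ ℚ.*-distribˡ-+ q (1/suc i) (1/suc j) ⟩
      q ℚ.* 1/suc i ℚ.+ q ℚ.* 1/suc j
        ≤⟨ ℚ.+-mono-≤ (scale-recip c k) (scale-recip c m) ⟩
      1/suc k ℚ.+ 1/suc m ∎
  }
  where
  open ℚ.≤-Reasoning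
  q : ℚ
  q = c ÷ 1
  instance
    q≥0 : ℚ.NonNegative q
    q≥0 = ℚ.normalize-nonNeg c 1

-- 1/(a+1) + ... + 1/(a+len)
recipSum : ℕ → ℕ → ℚ
recipSum a zero      = 0ℚ
recipSum a (suc len) = recipSum a len ℚ.+ 1/suc (a + len)

sum-+ : ∀ a k m → recipSum a (k + m) ≡ recipSum a k ℚ.+ recipSum (a + k) m
sum-+ a k zero = trans (cong (recipSum a) (ℕ.+-identityʳ k)) (sym (ℚ.+-identityʳ _))
sum-+ a k (suc m) = begin
  recipSum a (k + suc m)
    ≡⟨ cong (recipSum a) (ℕ.+-suc k m) ⟩
  recipSum a (k + m) ℚ.+ 1/suc (a + (k + m))
    ≡⟨ cong₂ ℚ._+_ (sum-+ a k m) (cong 1/suc (sym (ℕ.+-assoc a k m))) ⟩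
  recipSum a k ℚ.+ recipSum (a + k) m ℚ.+ 1/suc (a + k + m)
    ≡⟨ ℚ.+-assoc (recipSum a k) _ _ ⟩
  recipSum a k ℚ.+ recipSum (a + k) (suc m) ∎
  where open ≡-Reasoning

_times_ : ℕ → ℚ → ℚ
zero  times q = 0ℚ
suc k times q = k times q ℚ.+ q

times-recip : ∀ k b → k times 1/suc b ≡ + k / suc b
times-recip zero    b = sym (ℚ.0/n≡0 (suc b))
times-recip (suc k) b = trans (cong (ℚ._+ 1/suc b) (times-recip k b))
  (ℚ.toℚᵘ-injective (begin
    ℚ.toℚᵘ (+ k / suc b ℚ.+ 1/suc b)
      ≈⟨ ℚ.toℚᵘ-homo-+ (+ k / suc b) (1/suc b) ⟩
    ℚ.toℚᵘ (+ k / suc b) ℚᵘ.+ ℚ.toℚᵘ (1/suc b)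
      ≈⟨ ℚᵘ.+-cong (ℚ.toℚᵘ-fromℚᵘ (ℚᵘ.mkℚᵘ (+ k) b))
                   (ℚ.toℚᵘ-fromℚᵘ (ℚᵘ.mkℚᵘ (+ 1) b)) ⟩
    ℚᵘ.mkℚᵘ (+ k) b ℚᵘ.+ ℚᵘ.mkℚᵘ (+ 1) b
      ≈⟨ ℚᵘ.*≡* eq ⟩
    ℚᵘ.mkℚᵘ (+ suc k) b
      ≈⟨ ℚ.toℚᵘ-fromℚᵘ (ℚᵘ.mkℚᵘ (+ suc k) b) ⟨
    ℚ.toℚᵘ (+ suc k / suc b) ∎))
  where
  open ≃-Reasoning
  eq : ((+ k) ℤ.* + suc b ℤ.+ (+ 1) ℤ.* + suc b) ℤ.* + suc b
       ≡ + suc k ℤ.* + (suc b * suc b)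
  eq = trans (cong (ℤ._* + suc b) (sym (ℤ.*-distribʳ-+ (+ suc b) (+ k) (+ 1))))
      (trans (ℤ.*-assoc (+ k ℤ.+ + 1) (+ suc b) (+ suc b))
             (cong₂ ℤ._*_ (cong ℤ.+_ (ℕ.+-comm k 1)) (sym (ℤ.pos-* (suc b) (suc b)))))

sum-≥ : ∀ b k len → len ≤ suc k → len times 1/suc (b + k) ℚ.≤ recipSum b len
sum-≥ b k zero      _  = ℚ.≤-refl
sum-≥ b k (suc len) le = ℚ.+-mono-≤ (sum-≥ b k len (ℕ.<⇒≤ le))
  (recip-anti (ℕ.+-monoʳ-≤ b (ℕ.≤-pred le)))

sum-≤ : ∀ b len → recipSum b len ℚ.≤ len times 1/suc b
sum-≤ b zero      = ℚ.≤-refl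
sum-≤ b (suc len) = ℚ.+-mono-≤ (sum-≤ b len) (recip-anti (ℕ.m≤m+n b len))

-- Refining the partition increases lower Riemann sums ...
refine-lower : ∀ k a len →
               recipSum a len ℚ.≤ recipSum (suc k * a) (suc k * len)
refine-lower k a zero = ℚ.≤-reflexive
  (cong (recipSum (suc k * a)) (sym (ℕ.*-zeroʳ (suc k))))
refine-lower k a (suc len) = begin
  recipSum a len ℚ.+ 1/suc (a + len)
    ≤⟨ ℚ.+-mono-≤ (refine-lower k a len) block ⟩
  recipSum (K * a) (K * len) ℚ.+ recipSum (K * a + K * len) K
    ≡⟨ sum-+ (K * a) (K * len) K ⟨
  recipSum (K * a) (K * len + K)
    ≡⟨ cong (recipSum (K * a)) (trans (ℕ.+-comm (K * len) K) (sym (ℕ.*-suc K len))) ⟩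
  recipSum (K * a) (K * suc len) ∎
  where
  open ℚ.≤-Reasoning
  K b : ℕ
  K = suc k
  b = K * a + K * len
  eq : suc (b + k) ≡ K * suc (a + len)
  eq = trans (sym (ℕ.+-suc b k))
      (trans (ℕ.+-comm b K)
      (trans (cong (λ t → K + t) (sym (ℕ.*-distribˡ-+ K a len))) (sym (ℕ.*-suc K (a + len)))))
  block : 1/suc (a + len) ℚ.≤ recipSum b K
  block = begin
    1/suc (a + len)
      ≤⟨ /-mono {1} {K} {a + len} {b + k}
           (ℕ.≤-reflexive (trans (ℕ.*-identityˡ _) eq)) ⟩
    + K / suc (b + k)
      ≡⟨ times-recip K (b + k) ⟨
    K times 1/suc (b + k)
      ≤⟨ sum-≥ b k K ℕ.≤-refl ⟩
    recipSum b K ∎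

-- ... and decreases upper ones.
refine-upper : ∀ k a len →
               recipSum (suc k * suc a) (suc k * len) ℚ.≤ recipSum a len
refine-upper k a zero = ℚ.≤-reflexive
  (cong (recipSum (suc k * suc a)) (ℕ.*-zeroʳ (suc k)))
refine-upper k a (suc len) = begin
  recipSum (K * suc a) (K * suc len)
    ≡⟨ cong (recipSum (K * suc a)) (trans (ℕ.*-suc K len) (ℕ.+-comm K (K * len))) ⟩
  recipSum (K * suc a) (K * len + K)
    ≡⟨ sum-+ (K * suc a) (K * len) K ⟩
  recipSum (K * suc a) (K * len) ℚ.+ recipSum b K
    ≤⟨ ℚ.+-mono-≤ (refine-upper k a len) block ⟩
  recipSum a len ℚ.+ 1/suc (a + len) ∎
  where
  open ℚ.≤-Reasoning
  K b : ℕ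
  K = suc k
  b = K * suc a + K * len
  le : K * suc (a + len) ≤ 1 * suc b
  le = ℕ.≤-trans (ℕ.≤-reflexive (ℕ.*-distribˡ-+ K (suc a) len))
      (ℕ.≤-trans (ℕ.n≤1+n b) (ℕ.≤-reflexive (sym (ℕ.*-identityˡ (suc b)))))
  block : recipSum b K ℚ.≤ 1/suc (a + len)
  block = begin
    recipSum b K       ≤⟨ sum-≤ b K ⟩
    K times 1/suc b    ≡⟨ times-recip K b ⟩
    + K / suc b        ≤⟨ /-mono {K} {1} {b} {a + len} le ⟩
    1/suc (a + len)    ∎

sum-head : ∀ a len → recipSum a (suc len) ≡ 1/suc a ℚ.+ recipSum (suc a) len
sum-head a len = trans (sum-+ a 1 len) (cong₂ ℚ._+_
  (trans (ℚ.+-identityˡ _) (cong 1/suc (ℕ.+-identityʳ a)))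
  (cong (λ b → recipSum b len) (ℕ.+-comm a 1)))

upper-lower : ∀ a len → recipSum a len ℚ.≤ 1/suc a ℚ.+ recipSum (suc a) len
upper-lower a len = begin
  recipSum a len                          ≡⟨ ℚ.+-identityʳ _ ⟨
  recipSum a len ℚ.+ 0ℚ                   ≤⟨ ℚ.+-monoʳ-≤ (recipSum a len) (recip-nonNeg (a + len)) ⟩
  recipSum a (suc len)                    ≡⟨ sum-head a len ⟩
  1/suc a ℚ.+ recipSum (suc a) len        ∎
  where open ℚ.≤-Reasoning

lower : ℕ → ℕ → ℚ
lower len m = recipSum (suc m) (suc m * len)

lower-close : ∀ len k m → lower len k ℚ.≤ 1/suc m ℚ.+ lower len m
lower-close len k m = begin
  recipSum K (K * len)
    ≤⟨ refine-lower m K (K * len) ⟩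
  recipSum (M * K) (M * (K * len))
    ≡⟨ cong₂ recipSum (ℕ.*-comm M K) comm ⟩
  recipSum (K * M) (K * (M * len))
    ≤⟨ refine-upper k m (M * len) ⟩
  recipSum m (M * len)
    ≤⟨ upper-lower m (M * len) ⟩
  1/suc m ℚ.+ recipSum M (M * len) ∎
  where
  open ℚ.≤-Reasoning
  K M : ℕ
  K = suc k
  M = suc m
  comm : M * (K * len) ≡ K * (M * len)
  comm = trans (sym (ℕ.*-assoc M K len))
        (trans (cong (_* len) (ℕ.*-comm M K)) (ℕ.*-assoc K M len))

open GroupProperties ℚ.+-0-group using () renaming (⁻¹-involutive to neg-involutive)

difference-≤ : ∀ {p q r} → p ℚ.≤ r ℚ.+ q → p ℚ.- q ℚ.≤ r
difference-≤ {p} {q} {r} le = begin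
  p ℚ.- q            ≤⟨ ℚ.+-monoˡ-≤ (ℚ.- q) le ⟩
  r ℚ.+ q ℚ.- q      ≡⟨ ℚ.+-assoc r q (ℚ.- q) ⟩
  r ℚ.+ (q ℚ.- q)    ≡⟨ cong (r ℚ.+_) (ℚ.+-inverseʳ q) ⟩
  r ℚ.+ 0ℚ           ≡⟨ ℚ.+-identityʳ r ⟩
  r                  ∎
  where open ℚ.≤-Reasoning

lower-regular : ∀ len k m →
                ℚ.∣ lower len k ℚ.- lower len m ∣ ℚ.≤ 1/suc k ℚ.+ 1/suc m
lower-regular len k m with ℚ.∣p∣≡p∨∣p∣≡-p (lower len k ℚ.- lower len m)
... | inj₁ eq = begin
  ℚ.∣ lower len k ℚ.- lower len m ∣  ≡⟨ eq ⟩
  lower len k ℚ.- lower len m        ≤⟨ difference-≤ (lower-close len k m) ⟩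
  1/suc m                            ≡⟨ ℚ.+-identityˡ _ ⟨
  0ℚ ℚ.+ 1/suc m                     ≤⟨ ℚ.+-monoˡ-≤ (1/suc m) (recip-nonNeg k) ⟩
  1/suc k ℚ.+ 1/suc m                ∎
  where open ℚ.≤-Reasoning
... | inj₂ eq = begin
  ℚ.∣ lower len k ℚ.- lower len m ∣  ≡⟨ eq ⟩
  ℚ.- (lower len k ℚ.- lower len m)  ≡⟨ flip ⟩
  lower len m ℚ.- lower len k        ≤⟨ difference-≤ (lower-close len m k) ⟩
  1/suc k                            ≡⟨ ℚ.+-identityʳ _ ⟨
  1/suc k ℚ.+ 0ℚ                     ≤⟨ ℚ.+-monoʳ-≤ (1/suc k) (recip-nonNeg m) ⟩
  1/suc k ℚ.+ 1/suc m                ∎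
  where
  open ℚ.≤-Reasoning
  flip : ℚ.- (lower len k ℚ.- lower len m) ≡ lower len m ℚ.- lower len k
  flip = trans (ℚ.neg-distrib-+ (lower len k) (ℚ.- lower len m))
        (trans (ℚ.+-comm (ℚ.- lower len k) (ℚ.- (ℚ.- lower len m)))
               (cong (λ t → t ℚ.- lower len k) (neg-involutive (lower len m))))

-- ln n is the integral of 1/t from 1 to n.  With M = m + 1, its m-th rational
-- approximation is the lower Riemann sum for the partition of [1 , n] into
-- intervals of length 1/M, namely 1/(M+1) + ... + 1/(Mn).  The corresponding
-- upper sum exceeds it by less than 1/M.
ln : (n : ℕ) .{{_ : NonZero n}} → ℝ
ln n = record
  { seq     = λ m → recipSum (suc m) (suc m * pred n)
  ; regular = lower-regular (pred n)
  }

{-# OPTIONS --safe #-}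

-- Fix the last arrangement ω of an optimal solution, and give every node u of a
-- component of size a the credit f(u) = 2 (Hₙ − Hₐ).  Let the potential of the
-- current arrangement be the sum of f(u) + f(v) over the pairs {u , v} that it
-- inverts relative to ω.  In every update, the expected cost plus the expected
-- new potential is at most the old potential, for every current arrangement.
-- Indeed, let blocks of sizes s and t merge, so that the credits drop by at least
-- 2t/(s+t) and 2s/(s+t).
-- (1) ω has all of both blocks on the same side of a node m between them, so only
--     the pairs of m with one block, say the one of size s, are inverted.  They
--     become all s+t pairs with probability s/(s+t), and none otherwise, while m
--     contributes 2st/(s+t) to the expected cost of moving.
-- (2) Let c be the cost of the target that agrees with ω; it is the number of
--     inverted pairs inside the merged block.  The other target costs T − c with
--     T = C(s+t, 2), so rearranging costs 2c(T−c)/T in expectation.  After it, all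
--     T pairs are inverted with probability c/T, and none otherwise.  Each of the c
--     inverted pairs has to pay 2(T−c)/T from its drop in credit: that is at most 2
--     for a pair across the blocks, and at most 4t/(s+t) for a pair in the block of
--     size s, because c counts either all C(s, 2) of these pairs or none.
-- Initially f = 2 (Hₙ − 1) ≤ 2 ln n, and at most Opt pairs are inverted, so that the
-- expected cost is at most 4 (Hₙ − 1) Opt.

module Submission where

open import Defs
open import Data.Bool.Base using (true; false; if_then_else_)
open import Data.Empty using (⊥-elim)
open import Data.Fin.Base using (Fin)
import Data.Fin.Properties as Fin
open import Data.Integer.Base using (+_)
import Data.Integer.Base as ℤ
import Data.Integer.Properties as ℤ
import Data.Integer.Tactic.RingSolver as ℤ
open import Data.List.Base
  using (List; []; _∷_; _++_; _∷ʳ_; allFin; filter; find; length; map; reverse;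
         takeWhile; dropWhile)
import Data.List.Properties as List
open import Data.List.Membership.Propositional using (_∈_; _∉_)
open import Data.List.Membership.Propositional.Properties
  using (∈-∃++; ∈-++⁺ˡ; ∈-++⁺ʳ; ∈-++⁻; ∈-filter⁺; ∈-filter⁻; ∈-allFin)
open import Data.List.Membership.Propositional.Properties.WithK using (unique∧set⇒bag)
open import Data.List.Relation.Binary.BagAndSetEquality using (∼bag⇒↭)
open import Data.List.Relation.Binary.Permutation.Propositional
  using (_↭_; prep; swap; ↭-sym; ↭-trans; ↭-reflexive; ↭⇒↭ₛ)
  renaming (refl to ↭refl; trans to ↭trans)
open import Data.List.Relation.Binary.Permutation.Propositional.Properties
  using (∈-resp-↭; ↭-length; ↭-reverse; ++-comm; ++⁺ˡ; shifts)
import Data.List.Relation.Binary.Permutation.Setoid.Properties as ↭ₛ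
open import Data.List.Relation.Unary.All as All using (All; []; _∷_)
import Data.List.Relation.Unary.All.Properties as All
open import Data.List.Relation.Unary.AllPairs using (AllPairs; []; _∷_)
import Data.List.Relation.Unary.AllPairs.Properties as AllPairs
open import Data.List.Relation.Unary.Any using (here; there)
open import Data.List.Relation.Unary.Unique.Propositional using (Unique)
import Data.List.Relation.Unary.Unique.Propositional.Properties as Unique
open import Data.Maybe.Base using (fromMaybe)
open import Data.Nat.Base
  using (ℕ; zero; suc; _+_; _*_; _∸_; _≤_; _<_; z≤n; s≤s; NonZero; ∣_-_∣)
open import Data.Nat.Combinatorics using (_C_; nC1≡n; nCk+nC[k+1]≡[n+1]C[k+1])
import Data.Nat.Properties as ℕ
open import Data.Nat.Tactic.RingSolver using (solve-∀)
open import Data.Product.Base using (∃; ∃₂; _×_; _,_; proj₁; proj₂)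
open import Data.Rational.Base as ℚ using (ℚ; 0ℚ; 1ℚ; _/_)
import Data.Rational.Properties as ℚ
import Data.Rational.Solver as ℚ
import Data.Rational.Unnormalised.Base as ℚᵘ
import Data.Rational.Unnormalised.Properties as ℚᵘ
open import Data.Sum.Base as Sum using (_⊎_; inj₁; inj₂; [_,_]′)
open import Function.Base using (_∘_; flip)
open import Function.Bundles using (Equivalence; mk⇔)
open import Relation.Binary.Construct.Closure.ReflexiveTransitive
  using (ε; _◅_; _◅◅_) renaming (reverse to star-reverse)
open import Relation.Binary.Construct.Closure.Symmetric using (SymClosure; fwd; bwd)
import Relation.Binary.Construct.Closure.Symmetric as Sym
open import Relation.Binary.PropositionalEquality
import Relation.Binary.Reasoning.Setoid as SetoidReasoning
open import Relation.Nullary using (Dec; yes; no; does; ¬_; ¬?)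
open import Relation.Unary using (Decidable)
open ℚ.+-*-Solver using (solve; con; _:=_; _:+_; _:*_)

private
  module ≃-Reasoning = SetoidReasoning ℚᵘ.≃-setoid

  variable
    n : ℕ
    A B : Set

-- Lists

module _ {R : A → A → Set} where

  allPairs-++⁻ˡ : ∀ xs {ys} → AllPairs R (xs ++ ys) → AllPairs R xs
  allPairs-++⁻ˡ []       _        = []
  allPairs-++⁻ˡ (x ∷ xs) (px ∷ u) = All.++⁻ˡ xs px ∷ allPairs-++⁻ˡ xs u

  allPairs-++⁻ʳ : ∀ xs {ys} → AllPairs R (xs ++ ys) → AllPairs R ys
  allPairs-++⁻ʳ []       u       = u
  allPairs-++⁻ʳ (x ∷ xs) (_ ∷ u) = allPairs-++⁻ʳ xs u

  allPairs-across : ∀ xs {ys x y} → AllPairs R (xs ++ ys) → x ∈ xs → y ∈ ys → R x y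
  allPairs-across (x ∷ xs) (px ∷ u) (here refl)  y∈ys = All.lookup (All.++⁻ʳ xs px) y∈ys
  allPairs-across (x ∷ xs) (px ∷ u) (there x∈xs) y∈ys = allPairs-across xs u x∈xs y∈ys

  allPairs-reverse : ∀ {xs} → AllPairs R xs → AllPairs (flip R) (reverse xs)
  allPairs-reverse {[]}     []       = []
  allPairs-reverse {x ∷ xs} (px ∷ u) = subst (AllPairs (flip R)) (sym (List.unfold-reverse x xs))
    (AllPairs.++⁺ (allPairs-reverse u) ([] ∷ [])
      (All.tabulate (λ y∈ → All.lookup px (∈-resp-↭ (↭-reverse xs) y∈) ∷ [])))

unique-disjoint : ∀ (xs : List A) {ys x} → Unique (xs ++ ys) → x ∈ xs → x ∉ ys
unique-disjoint xs u x∈xs x∈ys = allPairs-across xs u x∈xs x∈ys refl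

unique-∉ : ∀ (xs : List A) {ys x} → Unique (xs ++ x ∷ ys) → x ∉ xs
unique-∉ xs u x∈xs = unique-disjoint xs u x∈xs (here refl)

unique-∉ʳ : ∀ (xs : List A) {ys x} → Unique (xs ++ x ∷ ys) → x ∉ ys
unique-∉ʳ xs u = Unique.Unique[x∷xs]⇒x∉xs (allPairs-++⁻ʳ xs u)

∈⇒0<length : ∀ {xs : List A} {x} → x ∈ xs → 0 < length xs
∈⇒0<length {xs = _ ∷ _} _ = s≤s z≤n

Neighbours : List A → A → A → Set
Neighbours xs = SymClosure (Consecutive xs)

Infix : List A → List A → Set
Infix xs ws = ∃₂ λ as bs → ws ≡ as ++ xs ++ bs

consecutive-∈ˡ : ∀ {xs : List A} {y z} → Consecutive xs y z → y ∈ xs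
consecutive-∈ˡ (as , bs , refl) = ∈-++⁺ʳ as (here refl)

consecutive-∈ʳ : ∀ {xs : List A} {y z} → Consecutive xs y z → z ∈ xs
consecutive-∈ʳ (as , bs , refl) = ∈-++⁺ʳ as (there (here refl))

consecutive-++ˡ : ∀ {xs ys : List A} {y z} → Consecutive xs y z → Consecutive (xs ++ ys) y z
consecutive-++ˡ {ys = ys} (as , bs , refl) = as , bs ++ ys , List.++-assoc as _ ys

consecutive-++ʳ : ∀ (xs : List A) {ys} {y z} → Consecutive ys y z → Consecutive (xs ++ ys) y z
consecutive-++ʳ xs (as , bs , refl) = xs ++ as , bs , sym (List.++-assoc xs as _)

consecutive-infix : ∀ {xs ws : List A} {y z} → Infix xs ws → Consecutive xs y z →
    Consecutive ws y z
consecutive-infix (as , bs , refl) c = consecutive-++ʳ as (consecutive-++ˡ c)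

consecutive-reverse : ∀ {xs : List A} {y z} → Consecutive xs y z → Consecutive (reverse xs) z y
consecutive-reverse {y = y} {z} (as , bs , refl) = reverse bs , reverse as , (begin
  reverse (as ++ (y ∷ z ∷ []) ++ bs)
    ≡⟨ List.reverse-++ as _ ⟩
  reverse ((y ∷ z ∷ []) ++ bs) ++ reverse as
    ≡⟨ cong (_++ reverse as) (List.reverse-++ (y ∷ z ∷ []) bs) ⟩
  (reverse bs ++ z ∷ y ∷ []) ++ reverse as
    ≡⟨ List.++-assoc (reverse bs) _ _ ⟩
  reverse bs ++ z ∷ y ∷ reverse as ∎)
  where open ≡-Reasoning

infix-reverse : ∀ {xs ws : List A} → Infix xs ws → Infix (reverse xs) (reverse ws)
infix-reverse {xs = xs} (as , bs , refl) = reverse bs , reverse as , (begin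
  reverse (as ++ xs ++ bs)                  ≡⟨ List.reverse-++ as _ ⟩
  reverse (xs ++ bs) ++ reverse as          ≡⟨ cong (_++ reverse as) (List.reverse-++ xs bs) ⟩
  (reverse bs ++ reverse xs) ++ reverse as  ≡⟨ List.++-assoc (reverse bs) _ _ ⟩
  reverse bs ++ reverse xs ++ reverse as    ∎)
  where open ≡-Reasoning

infix-∈ : ∀ {xs ws : List A} {x} → Infix xs ws → x ∈ xs → x ∈ ws
infix-∈ (as , _ , refl) = ∈-++⁺ʳ as ∘ ∈-++⁺ˡ

neighbours-infix : ∀ {xs ws : List A} {y z} → Infix xs ws → Neighbours xs y z → Neighbours ws y z
neighbours-infix i (fwd c) = fwd (consecutive-infix i c)
neighbours-infix i (bwd c) = bwd (consecutive-infix i c)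

neighbours-reverse : ∀ {xs : List A} {y z} → Neighbours xs y z → Neighbours (reverse xs) y z
neighbours-reverse (fwd c) = bwd (consecutive-reverse c)
neighbours-reverse (bwd c) = fwd (consecutive-reverse c)

neighbours-sym : ∀ {xs : List A} {y z} → Neighbours xs y z → Neighbours xs z y
neighbours-sym (fwd c) = bwd c
neighbours-sym (bwd c) = fwd c

-- In a word without repetitions `v` occurs only once, so the `v` of the consecutive pair is the one
-- displayed between `as` and `bs`.
predecessor : ∀ (as : List A) {bs u v} → Unique (as ++ v ∷ bs) →
              Consecutive (as ++ v ∷ bs) u v → ∃ λ as′ → as ≡ as′ ∷ʳ u
predecessor []       uq ([] , _ , refl)     = ⊥-elim (unique-∉ʳ [] uq (here refl))
predecessor []       uq (_ ∷ cs , _ , refl) =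
    ⊥-elim (unique-∉ʳ [] uq (∈-++⁺ʳ cs (there (here refl))))
predecessor (a ∷ []) uq ([] , _ , refl)     = [] , refl
predecessor (a ∷ _ ∷ as) (_ ∷ uq) ([] , _ , refl) =
  ⊥-elim (unique-∉ʳ [] uq (∈-++⁺ʳ as (here refl)))
predecessor (a ∷ as) (_ ∷ uq) (_ ∷ cs , ds , eq)
  with as′ , refl ← predecessor as uq (cs , ds , List.∷-injectiveʳ eq) = a ∷ as′ , refl

successor : ∀ (as : List A) {bs u v} → Unique (as ++ v ∷ bs) →
            Consecutive (as ++ v ∷ bs) v u → ∃ λ bs′ → bs ≡ u ∷ bs′
successor []       uq ([] , ds , refl)    = ds , refl
successor []       uq (_ ∷ cs , _ , refl) = ⊥-elim (unique-∉ʳ [] uq (∈-++⁺ʳ cs (here refl)))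
successor (a ∷ as) uq ([] , _ , eq) with refl ← List.∷-injectiveˡ eq =
  ⊥-elim (unique-∉ʳ [] uq (∈-++⁺ʳ as (here refl)))
successor (a ∷ as) (_ ∷ uq) (_ ∷ cs , ds , eq) = successor as uq (cs , ds , List.∷-injectiveʳ eq)

unique-↭ : ∀ {xs ys : List A} → xs ↭ ys → Unique xs → Unique ys
unique-↭ p = ↭ₛ.Unique-resp-↭ (setoid _) (↭⇒↭ₛ p)

unique-reverse : ∀ {ws : List A} → Unique ws → Unique (reverse ws)
unique-reverse {ws = ws} = unique-↭ (↭-sym (↭-reverse ws))

-- If `x` stands left of `y`, the infix grows to the left. If it stands right of `y`, its place is
-- taken by the head of `p`; only an empty `p` leaves room, and then the two-node path is read
-- backwards.
extend : ∀ {ws p : List A} {x y} → Unique ws → Unique (x ∷ y ∷ p) → Neighbours ws x y →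
         Infix (y ∷ p) ws → Infix (x ∷ y ∷ p) ws ⊎ Infix (x ∷ y ∷ p) (reverse ws)
extend uw _ (fwd c) (as , bs , refl) with as′ , refl ← predecessor as uw c =
  inj₁ (as′ , bs , List.++-assoc as′ _ _)
extend {p = []} {x} {y} uw _ (bwd c) (as , bs , refl) with bs′ , refl ← successor as uw c =
  inj₂ (infix-reverse {xs = y ∷ x ∷ []} (as , bs′ , refl))
extend {p = q ∷ p} uw ux (bwd c) (as , bs , refl) with _ , refl ← successor as uw c =
  ⊥-elim (unique-∉ʳ [] ux (there (here refl)))

-- Induction from the far end of the path. A path found so far only in reverse is extended inside
-- `reverse ws`, where it reads forwards.
contiguous′ : ∀ {ws : List A} x p → Unique ws → Unique (x ∷ p) → (∀ y → y ∈ ws) →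
              (∀ {y z} → Consecutive (x ∷ p) y z → Neighbours ws y z) →
              Infix (x ∷ p) ws ⊎ Infix (x ∷ p) (reverse ws)
contiguous′ x []      uw ux all nb = inj₁ (∈-∃++ (all x))
contiguous′ {ws = ws} x (y ∷ p) uw ux@(_ ∷ uy) all nb
  with contiguous′ y p uw uy all (nb ∘ consecutive-++ʳ (x ∷ []))
... | inj₁ i = extend uw ux (nb ([] , p , refl)) i
... | inj₂ i with extend (unique-reverse uw) ux (neighbours-reverse (nb ([] , p , refl))) i
...   | inj₁ j = inj₂ j
...   | inj₂ j = inj₁ (subst (Infix _) (List.reverse-involutive ws) j)

-- The form used later, which turns the path instead of the word. It serves both for the blocks in
-- the current word and for the merged block in `ω`.
contiguous : ∀ {ws p : List A} {x} → Unique ws → Unique p → x ∈ p → (∀ y → y ∈ ws) →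
             (∀ {y z} → Consecutive p y z → Neighbours ws y z) →
             Infix p ws ⊎ Infix (reverse p) ws
contiguous {ws = ws} {p = y ∷ p} uw up x∈p all nb with contiguous′ y p uw up all nb
... | inj₁ i = inj₁ i
... | inj₂ i = inj₂ (subst (Infix _) (List.reverse-involutive ws) (infix-reverse i))

-- The common prefix is peeled off until one of the two infixes begins; sharing no node with it, the
-- other can only begin after its end. The list `ms` is what lies between them.
disjoint-infixes : ∀ (as p : List A) {bs} (cs q : List A) {ds} → as ++ p ++ bs ≡ cs ++ q ++ ds →
        (∃ (_∈ p)) → (∃ (_∈ q)) → (∀ {y} → y ∈ p → y ∉ q) →
        (∃ λ ms → bs ≡ ms ++ q ++ ds) ⊎ (∃ λ ms → as ≡ cs ++ q ++ ms × ds ≡ ms ++ p ++ bs)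
disjoint-infixes (a ∷ as) p (c ∷ cs) q eq p∃ q∃ dis
  with refl ← List.∷-injectiveˡ eq | disjoint-infixes as p cs q (List.∷-injectiveʳ eq) p∃ q∃ dis
... | inj₁ r              = inj₁ r
... | inj₂ (ms , eq₁ , eq₂) = inj₂ (ms , cong (a ∷_) eq₁ , eq₂)
disjoint-infixes [] p cs q eq _ q∃ dis = inj₁ (inside p cs q q∃ eq dis)
  where
  inside : ∀ p {bs} cs q {ds} → ∃ (_∈ q) → p ++ bs ≡ cs ++ q ++ ds → (∀ {y} → y ∈ p → y ∉ q) →
           ∃ λ ms → bs ≡ ms ++ q ++ ds
  inside []      cs       _       _ eq dis = cs , eq
  inside (x ∷ p) []       (y ∷ _) _ eq dis =
      ⊥-elim (dis (here refl) (here (List.∷-injectiveˡ eq)))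
  inside (x ∷ p) (c ∷ cs) q       e eq dis = inside p cs q e (List.∷-injectiveʳ eq) (dis ∘ there)
disjoint-infixes (a ∷ as) p [] q eq p∃ _ dis = inj₂ (inside q (a ∷ as) p p∃ eq dis)
  where
  inside : ∀ q {ds} as p {bs} → ∃ (_∈ p) → as ++ p ++ bs ≡ q ++ ds → (∀ {y} → y ∈ p → y ∉ q) →
           ∃ λ ms → as ≡ q ++ ms × ds ≡ ms ++ p ++ bs
  inside []      as       p       _ eq dis = as , refl , sym eq
  inside (x ∷ q) []       (y ∷ _) _ eq dis =
      ⊥-elim (dis (here refl) (here (List.∷-injectiveˡ eq)))
  inside (x ∷ q) (a ∷ as) p       e eq dis
    with refl ← List.∷-injectiveˡ eq
    with ms , refl , eq₂ ← inside q as p e (List.∷-injectiveʳ eq) (λ i → dis i ∘ there) =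
        ms , refl , eq₂

consecutive-skip : ∀ (p : List A) {ys y z} → Consecutive (p ++ ys) y z → y ∉ p →
    Consecutive ys y z
consecutive-skip []      c                  _  = c
consecutive-skip (x ∷ p) ([] , _ , eq)      y∉ = ⊥-elim (y∉ (here (sym (List.∷-injectiveˡ eq))))
consecutive-skip (x ∷ p) (_ ∷ as , bs , eq) y∉ =
  consecutive-skip p (as , bs , List.∷-injectiveʳ eq) (y∉ ∘ there)

-- The member `x` makes `p` nonempty: across an empty `p`, the last node of `xs` and the first of
-- `ys` would be consecutive in the whole but in neither part.
consecutive-around : ∀ (xs p : List A) {ys x y z} → x ∈ p → Consecutive (xs ++ p ++ ys) y z →
                     y ∉ p → z ∉ p → Consecutive xs y z ⊎ Consecutive ys y z
consecutive-around []           p       x∈p c y∉ z∉ = inj₂ (consecutive-skip p c y∉)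
consecutive-around (x ∷ [])     (_ ∷ p) x∈p ([] , bs , eq) y∉ z∉ =
  ⊥-elim (z∉ (here (sym (List.∷-injectiveˡ (List.∷-injectiveʳ eq)))))
consecutive-around (x ∷ x′ ∷ xs) p x∈p ([] , bs , refl) y∉ z∉ = inj₁ ([] , xs , refl)
consecutive-around (x ∷ xs@[]) p x∈p (_ ∷ as , bs , eq) y∉ z∉
  = inj₂ (consecutive-skip p (as , bs , List.∷-injectiveʳ eq) y∉)
consecutive-around (x ∷ xs@(_ ∷ _)) p x∈p (_ ∷ as , bs , eq) y∉ z∉
  with consecutive-around xs p x∈p (as , bs , List.∷-injectiveʳ eq) y∉ z∉
... | inj₁ c = inj₁ (consecutive-++ʳ (x ∷ []) c)
... | inj₂ c = inj₂ c

-- Positions in a word, counted from zero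

index : List (Fin n) → Fin n → ℕ
index ws x = length (takeWhile (λ y → ¬? (y Fin.≟ x)) ws)

index-<-length : ∀ {x : Fin n} us vs → x ∈ us → index (us ++ vs) x < length us
index-<-length {x = x} (u ∷ us) vs x∈us with u Fin.≟ x | x∈us
... | yes _  | _          = s≤s z≤n
... | no u≢x | here x≡u   = ⊥-elim (u≢x (sym x≡u))
... | no _   | there x∈us = s≤s (index-<-length us vs x∈us)

length-≤-index : ∀ {x : Fin n} us vs → x ∉ us → length us ≤ index (us ++ vs) x
length-≤-index         []       vs x∉ = z≤n
length-≤-index {x = x} (u ∷ us) vs x∉ with u Fin.≟ x
... | yes u≡x = ⊥-elim (x∉ (here (sym u≡x)))
... | no _    = s≤s (length-≤-index us vs (x∉ ∘ there))

index-here : ∀ {x : Fin n} us vs → x ∉ us → index (us ++ x ∷ vs) x ≡ length us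
index-here {x = x} []       vs x∉ with x Fin.≟ x
... | yes _  = refl
... | no x≢x = ⊥-elim (x≢x refl)
index-here {x = x} (u ∷ us) vs x∉ with u Fin.≟ x
... | yes u≡x = ⊥-elim (x∉ (here (sym u≡x)))
... | no _    = cong suc (index-here us vs (x∉ ∘ there))

index-split : ∀ {x y : Fin n} us vs → Unique (us ++ vs) → x ∈ us → y ∈ vs →
              index (us ++ vs) x < index (us ++ vs) y
index-split us vs uq x∈us y∈vs = ℕ.<-≤-trans (index-<-length us vs x∈us)
  (length-≤-index us vs (λ y∈us → unique-disjoint us uq y∈us y∈vs))

consecutive⇒index : ∀ {ws : List (Fin n)} {x z} → Unique ws → Consecutive ws x z →
                    index ws z ≡ suc (index ws x)
consecutive⇒index {x = x} {z} uq (as , bs , refl) = begin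
  index (as ++ x ∷ z ∷ bs) z    ≡⟨ cong (λ w → index w z) shape ⟩
  index ((as ∷ʳ x) ++ z ∷ bs) z
    ≡⟨ index-here (as ∷ʳ x) bs (unique-∉ (as ∷ʳ x) (subst Unique shape uq)) ⟩
  length (as ∷ʳ x)              ≡⟨ List.length-++ as ⟩
  length as + 1                 ≡⟨ ℕ.+-comm (length as) 1 ⟩
  suc (length as)               ≡⟨ cong suc (index-here as (z ∷ bs) (unique-∉ as uq)) ⟨
  suc (index (as ++ x ∷ z ∷ bs) x) ∎
  where
  open ≡-Reasoning
  shape = sym (List.++-assoc as (x ∷ []) (z ∷ bs))

index⇒consecutive : ∀ {ws : List (Fin n)} {x z} → Unique ws → x ∈ ws → z ∈ ws →
                    index ws z ≡ suc (index ws x) → Consecutive ws x z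
index⇒consecutive {x = x} {z} uq x∈ws z∈ws eq with ∈-∃++ x∈ws
... | as , bs , refl with ∈-++⁻ as z∈ws
...   | inj₁ z∈as = ⊥-elim (ℕ.<⇒≱ (ℕ.≤-trans (ℕ.≤-reflexive (sym eq))
                     (ℕ.<⇒≤ (index-split as _ uq z∈as (here refl)))) (ℕ.≤-refl))
...   | inj₂ (here refl) = ⊥-elim (ℕ.1+n≢n (sym eq))
index⇒consecutive {x = x} {z} uq x∈ws z∈ws eq | as , b ∷ bs , refl | inj₂ (there (here refl)) =
    as , bs , refl
-- The node `b` after `x` already has the index that `z` is assumed to have, and `z` lies strictly
-- further right.
index⇒consecutive {x = x} {z} uq x∈ws z∈ws eq | as , b ∷ bs , refl | inj₂ (there (there z∈bs)) =
  ⊥-elim (ℕ.<-irrefl refl (begin-strict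
    index (as ++ x ∷ b ∷ bs) z       ≡⟨ eq ⟩
    suc (index (as ++ x ∷ b ∷ bs) x) ≡⟨ consecutive⇒index uq (as , bs , refl) ⟨
    index (as ++ x ∷ b ∷ bs) b       ≡⟨ cong (λ w → index w b) shape ⟩
    index ((as ++ x ∷ b ∷ []) ++ bs) b
      <⟨ index-split (as ++ x ∷ b ∷ []) bs (subst Unique shape uq) (∈-++⁺ʳ as (there (here refl)))
          z∈bs ⟩
    index ((as ++ x ∷ b ∷ []) ++ bs) z ≡⟨ cong (λ w → index w z) shape ⟨
    index (as ++ x ∷ b ∷ bs) z       ∎))
  where
  open ℕ.≤-Reasoning
  shape = sym (List.++-assoc as (x ∷ b ∷ []) bs)

-- Arrangements and blocks

word-unique : (π : Arrangement n) → Unique (word π)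
word-unique {n} π = unique-↭ (↭-sym (complete π)) (Unique.allFin⁺ n)

∈-word : (π : Arrangement n) (x : Fin n) → x ∈ word π
∈-word π x = ∈-resp-↭ (↭-sym (complete π)) (∈-allFin x)

-- For disjoint unions of paths, the tight arrangements are exactly the MinLAs.  The
-- nontrivial direction needs one tight arrangement to compare with, and Rand itself
-- provides it (some-tight).
Tight : Graph n → Arrangement n → Set
Tight G π = ∀ {y z} → (y , z) ∈ G → Neighbours (word π) y z

tight-adjacent : ∀ {G : Graph n} {π y z} → Tight G π → Adjacent G y z → Neighbours (word π) y z
tight-adjacent tight (fwd e) = tight e
tight-adjacent tight (bwd e) = neighbours-sym (tight e)

Loopless : Graph n → Set
Loopless = All (λ (x , z) → x ≢ z)

∣n-1+n∣≡1 : ∀ k → ∣ k - suc k ∣ ≡ 1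
∣n-1+n∣≡1 zero    = refl
∣n-1+n∣≡1 (suc k) = ∣n-1+n∣≡1 k

∣m-n∣≡1⇒ : ∀ k m → ∣ k - m ∣ ≡ 1 → m ≡ suc k ⊎ k ≡ suc m
∣m-n∣≡1⇒ zero    m       eq = inj₁ eq
∣m-n∣≡1⇒ (suc k) zero    eq = inj₂ eq
∣m-n∣≡1⇒ (suc k) (suc m) eq with ∣m-n∣≡1⇒ k m eq
... | inj₁ refl = inj₁ refl
... | inj₂ refl = inj₂ refl

distance : Arrangement n → Fin n → Fin n → ℕ
distance π y z = ∣ position π y - position π z ∣

neighbours⇒distance : (π : Arrangement n) → ∀ {y z} → Neighbours (word π) y z → distance π y z ≡ 1
neighbours⇒distance π {y} {z} (fwd c) rewrite consecutive⇒index (word-unique π) c =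
  ∣n-1+n∣≡1 (index (word π) y)
neighbours⇒distance π {y} {z} (bwd c) rewrite consecutive⇒index (word-unique π) c =
  trans (ℕ.∣-∣-comm (suc (index (word π) z)) (index (word π) z)) (∣n-1+n∣≡1 (index (word π) z))

distance⇒neighbours : (π : Arrangement n) → ∀ {y z} → distance π y z ≡ 1 → Neighbours (word π) y z
distance⇒neighbours π {y} {z} eq with ∣m-n∣≡1⇒ (index (word π) y) (index (word π) z) eq
... | inj₁ eq′ = fwd (index⇒consecutive (word-unique π) (∈-word π y) (∈-word π z) eq′)
... | inj₂ eq′ = bwd (index⇒consecutive (word-unique π) (∈-word π z) (∈-word π y) eq′)

index-injective : ∀ {ws : List (Fin n)} {x z} → Unique ws → x ∈ ws → z ∈ ws →
                  index ws x ≡ index ws z → x ≡ z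
index-injective uq x∈ws z∈ws eq with as , bs , refl ← ∈-∃++ x∈ws with ∈-++⁻ as z∈ws
... | inj₁ z∈as         = ⊥-elim (ℕ.<⇒≢ (index-split as _ uq z∈as (here refl)) (sym eq))
... | inj₂ (here refl)  = refl
... | inj₂ (there z∈bs) =
    ⊥-elim (ℕ.<⇒≢ (subst (λ w → index w _ < index w _) (List.++-assoc as _ bs)
    (index-split (as ∷ʳ _) bs (subst Unique (sym (List.++-assoc as _ bs)) uq)
      (∈-++⁺ʳ as (here refl)) z∈bs)) eq)

distance-positive : (π : Arrangement n) → ∀ {y z} → y ≢ z → 1 ≤ distance π y z
distance-positive π y≢z = ℕ.n≢0⇒n>0 λ eq → y≢z
  (index-injective (word-unique π) (∈-word π _) (∈-word π _) (ℕ.∣m-n∣≡0⇒m≡n eq))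

tight⇒linearCost : ∀ G (π : Arrangement n) → Tight G π → linearCost G π ≡ length G
tight⇒linearCost []      π tight = refl
tight⇒linearCost (_ ∷ G) π tight =
  cong₂ _+_ (neighbours⇒distance π (tight (here refl))) (tight⇒linearCost G π (tight ∘ there))

linearCost-≥ : ∀ {G} (π : Arrangement n) → Loopless G → length G ≤ linearCost G π
linearCost-≥ π []       = z≤n
linearCost-≥ π (e ∷ ll) = ℕ.+-mono-≤ (distance-positive π e) (linearCost-≥ π ll)

-- Each edge has length at least 1, so a total of at most one per edge leaves length exactly 1 for
-- every edge.
linearCost⇒tight : ∀ {G} (π : Arrangement n) → Loopless G → linearCost G π ≤ length G → Tight G π
linearCost⇒tight {G = (y , z) ∷ G} π (e ∷ ll) le = λ where
  (here refl) → distance⇒neighbours π (ℕ.≤-antisym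
    (ℕ.+-cancelʳ-≤ (length G) _ _
      (ℕ.≤-trans (ℕ.+-monoʳ-≤ (distance π y z) (linearCost-≥ π ll)) le))
    (distance-positive π e))
  (there i) → linearCost⇒tight π ll
    (ℕ.+-cancelˡ-≤ 1 _ _ (ℕ.≤-trans (ℕ.+-monoˡ-≤ _ (distance-positive π e)) le)) i

-- The tight `ρ` shows that the minimum is at most one per edge.
minLA⇒tight : ∀ {G} (ρ π : Arrangement n) → Loopless G → Tight G ρ → IsMinLA G π → Tight G π
minLA⇒tight {G = G} ρ π ll tight min =
  linearCost⇒tight π ll (ℕ.≤-trans (min ρ) (ℕ.≤-reflexive (tight⇒linearCost G ρ tight)))

-- Components as blocks

connected-sym : ∀ {G : Graph n} {y z} → Connected G y z → Connected G z y
connected-sym = star-reverse (Sym.symmetric _)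

-- The component of `u`, listed along its path. The two blocks of an update are obtained by cutting
-- the path of the new graph at the new edge (`blocks`).
record Block (G : Graph n) (u : Fin n) (p : List (Fin n)) : Set where
  field
    unique    : Unique p
    connected : ∀ {y} → y ∈ p → Connected G u y
    member    : ∀ {y} → Connected G u y → y ∈ p
    adjacent  : ∀ {y z} → Consecutive p y z → Adjacent G y z

open Block

adjacent⇒connected : ∀ {G : Graph n} y p → (∀ {u v} → Consecutive (y ∷ p) u v → Adjacent G u v) →
                     ∀ {z} → z ∈ y ∷ p → Connected G y z
adjacent⇒connected y p       adj (here refl) = ε
adjacent⇒connected y (x ∷ p) adj (there z∈p) =
  adj ([] , p , refl) ◅ adjacent⇒connected x p (adj ∘ consecutive-++ʳ (y ∷ [])) z∈p

adjacent⇒connected₂ : ∀ {G : Graph n} p → (∀ {u v} → Consecutive p u v → Adjacent G u v) →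
                      ∀ {y z} → y ∈ p → z ∈ p → Connected G y z
adjacent⇒connected₂ (x ∷ p) adj y∈p z∈p =
  connected-sym (adjacent⇒connected x p adj y∈p) ◅◅ adjacent⇒connected x p adj z∈p

-- The new path may run through the new edge in either direction, so the cut is described for both
-- namings of its ends.
Endpoints : Fin n × Fin n → Fin n → Fin n → Set
Endpoints e a b = e ≡ (a , b) ⊎ e ≡ (b , a)

-- The new edge ends in `b`, so it cannot be the one that joins two nodes other than `b`.
old-adjacent : ∀ {G : Graph n} {e a b y z} → Endpoints e a b → y ≢ b → z ≢ b →
               Adjacent (e ∷ G) y z → Adjacent G y z
old-adjacent ends        y≢b z≢b (fwd (there i))    = fwd i
old-adjacent ends        y≢b z≢b (bwd (there i))    = bwd i
old-adjacent (inj₁ refl) y≢b z≢b (fwd (here refl)) = ⊥-elim (z≢b refl)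
old-adjacent (inj₂ refl) y≢b z≢b (fwd (here refl)) = ⊥-elim (y≢b refl)
old-adjacent (inj₁ refl) y≢b z≢b (bwd (here refl)) = ⊥-elim (y≢b refl)
old-adjacent (inj₂ refl) y≢b z≢b (bwd (here refl)) = ⊥-elim (z≢b refl)

endpoints-sym : ∀ {e : Fin n × Fin n} {a b} → Endpoints e a b → Endpoints e b a
endpoints-sym (inj₁ eq) = inj₂ eq
endpoints-sym (inj₂ eq) = inj₁ eq

module _ {G : Graph n} {e : Fin n × Fin n} {a b : Fin n} (ends : Endpoints e a b)
         (a≁b : ¬ Connected G a b) (path : IsPath (e ∷ G) (proj₁ e)) where
  open IsPath path

  -- Each half misses one end of the new edge, so it is connected by old edges alone. Conversely, a
  -- node connected to `a` in `G` is on the new path, and if it were in `q`, then `a` and `b` would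
  -- have been connected in `G` already.
  split-blocks : ∀ p q → nodes ≡ p ++ q → a ∈ p → b ∈ q → Block G a p × Block G b q
  split-blocks p q eq a∈p b∈q = blockˡ , blockʳ
    where
    infixˡ : Infix p nodes
    infixˡ = [] , q , eq
    infixʳ : Infix q nodes
    infixʳ = p , [] , trans eq (cong (p ++_) (sym (List.++-identityʳ q)))
    uq : Unique (p ++ q)
    uq = subst Unique eq distinct
    adj : ∀ {y z} → Consecutive nodes y z → Adjacent (e ∷ G) y z
    adj c = Equivalence.from (edges _ _ (consecutive-∈ˡ c) (consecutive-∈ʳ c)) (fwd c)
    adjˡ : ∀ {y z} → Consecutive p y z → Adjacent G y z
    adjˡ c = old-adjacent ends
      (λ { refl → unique-disjoint p uq (consecutive-∈ˡ c) b∈q })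
      (λ { refl → unique-disjoint p uq (consecutive-∈ʳ c) b∈q })
      (adj (consecutive-infix infixˡ c))
    adjʳ : ∀ {y z} → Consecutive q y z → Adjacent G y z
    adjʳ c = old-adjacent (endpoints-sym ends)
      (λ { refl → unique-disjoint p uq a∈p (consecutive-∈ˡ c) })
      (λ { refl → unique-disjoint p uq a∈p (consecutive-∈ʳ c) })
      (adj (consecutive-infix infixʳ c))
    closed : ∀ {y z} → y ∈ nodes → Connected G y z → z ∈ p ⊎ z ∈ q
    closed {y} {z} y∈ s = ∈-++⁻ p (subst (z ∈_) eq
      (Equivalence.from (component z) (Equivalence.to (component y) y∈ ◅◅ weaken s)))
    blockˡ : Block G a p
    blockˡ .unique    = allPairs-++⁻ˡ p uq
    blockˡ .connected = adjacent⇒connected₂ p adjˡ a∈p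
    blockˡ .adjacent  = adjˡ
    blockˡ .member s with closed (infix-∈ infixˡ a∈p) s
    ... | inj₁ y∈p = y∈p
    ... | inj₂ y∈q = ⊥-elim (a≁b (s ◅◅ adjacent⇒connected₂ q adjʳ y∈q b∈q))
    blockʳ : Block G b q
    blockʳ .unique    = allPairs-++⁻ʳ p uq
    blockʳ .connected = adjacent⇒connected₂ q adjʳ b∈q
    blockʳ .adjacent  = adjʳ
    blockʳ .member s with closed (infix-∈ infixʳ b∈q) s
    ... | inj₂ y∈q = y∈q
    ... | inj₁ y∈p = ⊥-elim (a≁b (adjacent⇒connected₂ p adjˡ a∈p y∈p ◅◅ connected-sym s))

-- Being adjacent, the ends of the new edge are consecutive on the new path, which is cut between
-- them.
blocks : ∀ {G : Graph n} {x z} → ¬ Connected G x z → (path : IsPath ((x , z) ∷ G) x) →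
         ∃₂ λ p q → Block G x p × Block G z q ×
           (IsPath.nodes path ≡ p ++ q ⊎ IsPath.nodes path ≡ q ++ p)
blocks {x = x} {z} x≁z path with Equivalence.to (edges x z x∈ z∈) (fwd (here refl))
  where
  open IsPath path
  x∈ = Equivalence.from (component x) ε
  z∈ = Equivalence.from (component z) (fwd (here refl) ◅ ε)
... | fwd (as , bs , eq) =
  let eq′ = trans eq (sym (List.++-assoc as _ _))
      bp , bq = split-blocks (inj₁ refl) x≁z path (as ∷ʳ x) (z ∷ bs) eq′ (∈-++⁺ʳ as (here refl))
          (here refl)
  in _ , _ , bp , bq , inj₁ eq′
... | bwd (as , bs , eq) =
  let eq′ = trans eq (sym (List.++-assoc as _ _))
      bq , bp = split-blocks (inj₂ refl) (x≁z ∘ connected-sym) path (as ∷ʳ z) (x ∷ bs) eq′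
          (∈-++⁺ʳ as (here refl)) (here refl)
  in _ , _ , bp , bq , inj₂ eq′

-- The split of the current word computed by an update

takeWhile-++ : ∀ {P : A → Set} (P? : Decidable P) {xs ys} → All P xs →
    (∀ {y zs} → ys ≡ y ∷ zs → ¬ P y) →
               takeWhile P? (xs ++ ys) ≡ xs
takeWhile-++ P? {[]} {[]}     [] stop = refl
takeWhile-++ P? {[]} {y ∷ ys} [] stop with P? y
... | yes py = ⊥-elim (stop refl py)
... | no _   = refl
takeWhile-++ P? {x ∷ xs} (px ∷ pxs) stop with P? x
... | yes _  = cong (x ∷_) (takeWhile-++ P? pxs stop)
... | no ¬px = ⊥-elim (¬px px)

dropWhile-++ : ∀ {P : A → Set} (P? : Decidable P) {xs ys} → All P xs →
    (∀ {y zs} → ys ≡ y ∷ zs → ¬ P y) →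
               dropWhile P? (xs ++ ys) ≡ ys
dropWhile-++ P? {[]} {[]}     [] stop = refl
dropWhile-++ P? {[]} {y ∷ ys} [] stop with P? y
... | yes py = ⊥-elim (stop refl py)
... | no _   = refl
dropWhile-++ P? {x ∷ xs} (px ∷ pxs) stop with P? x
... | yes _  = dropWhile-++ P? pxs stop
... | no ¬px = ⊥-elim (¬px px)

Oriented : List A → List A → Set
Oriented L p = L ≡ p ⊎ L ≡ reverse p

oriented-∈ : ∀ {L p : List A} {y} → Oriented L p → y ∈ p → y ∈ L
oriented-∈ (inj₁ refl) i = i
oriented-∈ (inj₂ refl) i = ∈-resp-↭ (↭-sym (↭-reverse _)) i

oriented-∈⁻ : ∀ {L p : List A} {y} → Oriented L p → y ∈ L → y ∈ p
oriented-∈⁻ (inj₁ refl) i = i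
oriented-∈⁻ (inj₂ refl) i = ∈-resp-↭ (↭-reverse _) i

oriented-infix : ∀ {w p : List A} → Infix p w ⊎ Infix (reverse p) w →
                 ∃ λ p′ → Oriented p′ p × Infix p′ w
oriented-infix (inj₁ i) = _ , inj₁ refl , i
oriented-infix (inj₂ i) = _ , inj₂ refl , i

block-infix : ∀ {G : Graph n} {u p} (π : Arrangement n) → Tight G π → Block G u p →
              ∃ λ p′ → Oriented p′ p × Infix p′ (word π)
block-infix π tight b = oriented-infix (contiguous (word-unique π) (unique b) (member b ε)
  (∈-word π) (tight-adjacent {π = π} tight ∘ adjacent b))

module _ {G : Graph n} {l r p q} (π : Arrangement n) (tight : Tight G π)
         (bₗ : Block G l p) (bᵣ : Block G r q) (l≁r : ¬ Connected G l r)
         (l<r : position π l < position π r) where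
  open Update π G l r

  -- By tightness each component occupies a contiguous infix in one of its two directions, and `l<r`
  -- puts the one of `l` first. Since these infixes contain all nodes of their components, the scans
  -- in `Update` stop exactly at their borders.
  update-blocks : Oriented left p × Oriented right q
  update-blocks
    with L , oL , as , bs , eqL ← block-infix π tight bₗ
    with R , oR , cs , ds , eqR ← block-infix π tight bᵣ
    = shape (disjoint-infixes as L cs R (trans (sym eqL) eqR) (l , l∈L) (r , r∈R) disjoint)
    where
    l∈L : l ∈ L
    l∈L = oriented-∈ oL (member bₗ ε)
    r∈R : r ∈ R
    r∈R = oriented-∈ oR (member bᵣ ε)
    disjoint : ∀ {y} → y ∈ L → y ∉ R
    disjoint y∈L y∈R = l≁r (connected bₗ (oriented-∈⁻ oL y∈L)
                            ◅◅ connected-sym (connected bᵣ (oriented-∈⁻ oR y∈R)))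
    shape : _ → Oriented left p × Oriented right q
    -- With `R` to the left of `L`, the node `r` would precede `l`.
    shape (inj₂ (ms , refl , refl)) = ⊥-elim (ℕ.<-asym l<r (s≤s
      (subst (λ w → index w r < index w l) (sym eqL)
        (index-split (cs ++ R ++ ms) (L ++ bs) (subst Unique eqL (word-unique π))
          (∈-++⁺ʳ cs (∈-++⁺ˡ r∈R)) (∈-++⁺ˡ l∈L)))))
    shape (inj₁ (ms , refl)) =
      subst (λ v → Oriented v p) (sym left≡) oL , subst (λ v → Oriented v q) (sym right≡) oR
      where
      uq : Unique (as ++ L ++ ms ++ R ++ ds)
      uq = subst Unique eqL (word-unique π)
      uqL = allPairs-++⁻ʳ as uq
      uqM = allPairs-++⁻ʳ L uqL
      uqR = allPairs-++⁻ʳ ms uqM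
      inL : ∀ {y} → y ∈ L → Connected G l y
      inL = connected bₗ ∘ oriented-∈⁻ oL
      inL⁻ : ∀ {y} → Connected G l y → y ∈ L
      inL⁻ = oriented-∈ oL ∘ member bₗ
      inR : ∀ {y} → y ∈ R → Connected G r y
      inR = connected bᵣ ∘ oriented-∈⁻ oR
      inR⁻ : ∀ {y} → Connected G r y → y ∈ R
      inR⁻ = oriented-∈ oR ∘ member bᵣ
      head∈ : ∀ {B : List (Fin n)} {rest x y zs} → x ∈ B → B ++ rest ≡ y ∷ zs → y ∈ B
      head∈ {_ ∷ _} _ refl = here refl
      head-∈ : ∀ {B : List (Fin n)} {y zs} → B ≡ y ∷ zs → y ∈ B
      head-∈ refl = here refl
      not-before : All (λ y → ¬ Connected G l y) as
      not-before = All.tabulate (λ y∈as s → unique-disjoint as uq y∈as (∈-++⁺ˡ (inL⁻ s)))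
      not-between : All (λ y → ¬ Connected G r y) ms
      not-between = All.tabulate (λ y∈ms s → unique-disjoint ms uqM y∈ms (∈-++⁺ˡ (inR⁻ s)))
      w₁≡ : w₁ ≡ L ++ ms ++ R ++ ds
      w₁≡ = trans (cong (dropWhile (¬? ∘ inLeft?)) eqL)
        (dropWhile-++ (¬? ∘ inLeft?) not-before (λ eq ¬s → ¬s (inL (head∈ l∈L eq))))
      stopL : ∀ {y zs} → ms ++ R ++ ds ≡ y ∷ zs → ¬ Connected G l y
      stopL eq s = unique-disjoint L uqL (inL⁻ s) (head-∈ eq)
      stopR : ∀ {y zs} → ds ≡ y ∷ zs → ¬ Connected G r y
      stopR eq s = unique-disjoint R uqR (inR⁻ s) (head-∈ eq)
      left≡ : left ≡ L
      left≡ = trans (cong (takeWhile inLeft?) w₁≡) (takeWhile-++ inLeft? (All.tabulate inL) stopL)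
      w₂≡ : w₂ ≡ ms ++ R ++ ds
      w₂≡ = trans (cong (dropWhile inLeft?) w₁≡) (dropWhile-++ inLeft? (All.tabulate inL) stopL)
      w₃≡ : w₃ ≡ R ++ ds
      w₃≡ = trans (cong (dropWhile (¬? ∘ inRight?)) w₂≡)
        (dropWhile-++ (¬? ∘ inRight?) not-between (λ eq ¬s → ¬s (inR (head∈ r∈R eq))))
      right≡ : right ≡ R
      right≡ = trans (cong (takeWhile inRight?) w₃≡)
          (takeWhile-++ inRight? (All.tabulate inR) stopR)

-- Combinations that reach the two targets

∈-combinations : ∀ c → c ∈ combinations
∈-combinations (combination false false false) = here refl
∈-combinations (combination false false true)  = there (here refl)
∈-combinations (combination false true  false) = there (there (here refl))
∈-combinations (combination false true  true)  = there (there (there (here refl)))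
∈-combinations (combination true  false false) = there (there (there (there (here refl))))
∈-combinations (combination true  false true)  = there (there (there (there (there (here refl)))))
∈-combinations (combination true  true  false) =
    there (there (there (there (there (there (here refl))))))
∈-combinations (combination true  true  true)  =
    there (there (there (there (there (there (there (here refl)))))))

find-correct : ∀ {P : A → Set} (P? : Decidable P) {x d} {xs} → x ∈ xs → P x →
    P (fromMaybe d (find P? xs))
find-correct P? {xs = y ∷ xs} x∈xs px with P? y | x∈xs
... | yes py | _          = py
... | no ¬py | here refl  = ⊥-elim (¬py px)
... | no _   | there x∈xs = find-correct P? x∈xs px

-- One suitable `c` suffices to keep `reaching` off its default. The search may find another
-- combination first, but with the same effect.
reaching-correct : ∀ {target left right : List (Fin n)} c → perform c left right ≡ target →
                   perform (reaching target left right) left right ≡ target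
reaching-correct {target = target} {left} {right} c eq =
  find-correct (λ c → List.≡-dec Fin._≟_ (perform c left right) target) (∈-combinations c) eq

orient : ∀ {L p : List A} → Oriented L p → ∃ λ b → (if b then reverse L else L) ≡ p
orient (inj₁ refl) = false , refl
orient (inj₂ refl) = true , List.reverse-involutive _

oriented-reverse : ∀ {L p : List A} → Oriented L p → Oriented L (reverse p)
oriented-reverse (inj₁ refl) = inj₂ (sym (List.reverse-involutive _))
oriented-reverse (inj₂ refl) = inj₁ refl

reachable-++ : ∀ {L R p q : List A} → Oriented L p → Oriented R q → ∃ λ c → perform c L R ≡ p ++ q
reachable-++ oL oR with bₗ , refl ← orient oL | bᵣ , refl ← orient oR =
    combination bₗ false bᵣ , refl

reachable-swap : ∀ {L R p q : List A} → Oriented L p → Oriented R q →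
                 ∃ λ c → perform c L R ≡ q ++ p
reachable-swap oL oR with bₗ , refl ← orient oL | bᵣ , refl ← orient oR =
    combination bₗ true bᵣ , refl

reachable : ∀ {L R p q order : List A} → Oriented L p → Oriented R q →
            order ≡ p ++ q ⊎ order ≡ q ++ p → ∃ λ c → perform c L R ≡ order
reachable oL oR (inj₁ refl) = reachable-++ oL oR
reachable oL oR (inj₂ refl) = reachable-swap oL oR

-- Reversing a concatenation reverses both parts and exchanges them, so each case becomes the other
-- one for the reversed blocks.
reachable-reverse : ∀ {L R p q order : List A} → Oriented L p → Oriented R q →
                    order ≡ p ++ q ⊎ order ≡ q ++ p → ∃ λ c → perform c L R ≡ reverse order
reachable-reverse {p = p} {q} oL oR (inj₁ refl) =
  reachable (oriented-reverse oL) (oriented-reverse oR) (inj₂ (List.reverse-++ p q))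
reachable-reverse {p = p} {q} oL oR (inj₂ refl) =
  reachable (oriented-reverse oL) (oriented-reverse oR) (inj₁ (List.reverse-++ q p))

-- The states of Rand

-- A state in which an update takes place, with the ends of the new edge named from left to right.
-- The lists `p` and `q` are the blocks in the direction of the new path, while `left` and `right`
-- are the same blocks as they stand in the word.
record Merge (G : Graph n) (e : Fin n × Fin n) (path : IsPath (e ∷ G) (proj₁ e))
             (π : Arrangement n) (l r : Fin n) : Set where
  field
    p q    : List (Fin n)
    blockˡ : Block G l p
    blockʳ : Block G r q
    order  : IsPath.nodes path ≡ p ++ q ⊎ IsPath.nodes path ≡ q ++ p
    l≁r    : ¬ Connected G l r
    l<r    : position π l < position π r
    tight   : Tight G π

  open Update π G l r public
  open IsPath path public using (nodes; distinct; component; edges)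

  orientedˡ : Oriented left p
  orientedˡ = proj₁ (update-blocks π tight blockˡ blockʳ l≁r l<r)

  orientedʳ : Oriented right q
  orientedʳ = proj₂ (update-blocks π tight blockˡ blockʳ l≁r l<r)

  c₁ c₂ : Combination
  c₁ = reaching nodes           left right
  c₂ = reaching (reverse nodes) left right

  perform-c₁ : perform c₁ left right ≡ nodes
  perform-c₁ with c , eq ← reachable orientedˡ orientedʳ order = reaching-correct c eq

  perform-c₂ : perform c₂ left right ≡ reverse nodes
  perform-c₂ with c , eq ← reachable-reverse orientedˡ orientedʳ order = reaching-correct c eq

  nodes⇔ : ∀ {y} → (y ∈ p ⊎ y ∈ q → y ∈ nodes) × (y ∈ nodes → y ∈ p ⊎ y ∈ q)
  nodes⇔ {y} with order
  ... | inj₁ eq = subst (y ∈_) (sym eq) ∘ [ ∈-++⁺ˡ , ∈-++⁺ʳ p ]′ , ∈-++⁻ p ∘ subst (y ∈_) eq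
  ... | inj₂ eq = subst (y ∈_) (sym eq) ∘ [ ∈-++⁺ʳ q , ∈-++⁺ˡ ]′ ,
                  Sum.swap ∘ ∈-++⁻ q ∘ subst (y ∈_) eq

  left⊆nodes : ∀ {y} → y ∈ left → y ∈ nodes
  left⊆nodes = proj₁ nodes⇔ ∘ inj₁ ∘ oriented-∈⁻ orientedˡ

  right⊆nodes : ∀ {y} → y ∈ right → y ∈ nodes
  right⊆nodes = proj₁ nodes⇔ ∘ inj₂ ∘ oriented-∈⁻ orientedʳ

  l∈left : l ∈ left
  l∈left = oriented-∈ orientedˡ (member blockˡ ε)

  r∈right : r ∈ right
  r∈right = oriented-∈ orientedʳ (member blockʳ ε)

  block-in-result : ∀ m c → Infix (perform c left right) (resultWord m c)
  block-in-result leftBlock  c = before ++ between , after , sym (List.++-assoc before between _)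
  block-in-result rightBlock c = before , between ++ after , refl

  before-in-result : ∀ m c → Infix before (resultWord m c)
  before-in-result leftBlock  c = [] , _ , refl
  before-in-result rightBlock c = [] , _ , refl

  between-in-result : ∀ m c → Infix between (resultWord m c)
  between-in-result leftBlock  c = before , _ , refl
  between-in-result rightBlock c = before ++ perform c left right , after ,
    sym (List.++-assoc before _ _)

  after-in-result : ∀ m c → Infix after (resultWord m c)
  after-in-result leftBlock  c = before ++ between ++ perform c left right , [] , (begin
      before ++ between ++ P ++ after     ≡⟨ cong (before ++_) (List.++-assoc between P after) ⟨
      before ++ (between ++ P) ++ after   ≡⟨ List.++-assoc before _ _ ⟨
      (before ++ between ++ P) ++ after
        ≡⟨ cong ((before ++ between ++ P) ++_) (List.++-identityʳ after) ⟨
      (before ++ between ++ P) ++ after ++ [] ∎)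
    where open ≡-Reasoning
          P = perform c left right
  after-in-result rightBlock  c = before ++ perform c left right ++ between , [] , (begin
      before ++ P ++ between ++ after     ≡⟨ cong (before ++_) (List.++-assoc P between after) ⟨
      before ++ (P ++ between) ++ after   ≡⟨ List.++-assoc before _ _ ⟨
      (before ++ P ++ between) ++ after
        ≡⟨ cong ((before ++ P ++ between) ++_) (List.++-identityʳ after) ⟨
      (before ++ P ++ between) ++ after ++ [] ∎)
    where open ≡-Reasoning
          P = perform c left right

  -- A consecutive pair that avoids both blocks lies within `before`, `between` or `after`, since
  -- the blocks are nonempty; each of these pieces survives the update unchanged.
  outside-consecutive : ∀ m c {y z} → Consecutive (word π) y z → y ∉ nodes → z ∉ nodes →
                        Consecutive (resultWord m c) y z
  outside-consecutive m c cons y∉ z∉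
    with consecutive-around before left l∈left (subst (λ w → Consecutive w _ _) split cons)
           (y∉ ∘ left⊆nodes) (z∉ ∘ left⊆nodes)
  ... | inj₁ cb = consecutive-infix (before-in-result m c) cb
  ... | inj₂ cr with consecutive-around between right r∈right cr (y∉ ∘ right⊆nodes)
      (z∉ ∘ right⊆nodes)
  ...   | inj₁ cm = consecutive-infix (between-in-result m c) cm
  ...   | inj₂ ca = consecutive-infix (after-in-result m c) ca

  nodes-closed : ∀ {y z} → Adjacent G y z → y ∈ nodes → z ∈ nodes
  nodes-closed {y} {z} a y∈ = Equivalence.from (component z)
    (Equivalence.to (component y) y∈ ◅◅ weaken (a ◅ ε))

  Reached : Combination → Set
  Reached c = perform c left right ≡ nodes ⊎ perform c left right ≡ reverse nodes

  -- By `nodes-closed`, an edge lies inside the merged block or avoids it. Inside, both targets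
  -- follow the new path; outside, neighbours stay neighbours.
  result-tight : ∀ m c → Reached c → Tight (e ∷ G) (result m c)
  result-tight m c reached {y} {z} i = edge i
    where
    inside : y ∈ nodes → z ∈ nodes → Neighbours (resultWord m c) y z
    inside y∈ z∈ = neighbours-infix (block-in-result m c)
      (turn reached (Equivalence.to (edges y z y∈ z∈) (fwd i)))
      where
      turn : ∀ {ws} → ws ≡ nodes ⊎ ws ≡ reverse nodes → Neighbours nodes y z → Neighbours ws y z
      turn (inj₁ refl) nb = nb
      turn (inj₂ refl) nb = neighbours-reverse nb
    outside : y ∉ nodes → z ∉ nodes → Neighbours (word π) y z → Neighbours (resultWord m c) y z
    outside y∉ z∉ (fwd c′) = fwd (outside-consecutive m c c′ y∉ z∉)
    outside y∉ z∉ (bwd c′) = bwd (outside-consecutive m c c′ z∉ y∉)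
    edge : (y , z) ∈ e ∷ G → Neighbours (resultWord m c) y z
    edge (here refl) = inside (Equivalence.from (component y) ε)
                              (Equivalence.from (component z) (fwd (here refl) ◅ ε))
    edge (there j) with y ∈? nodes
    ... | yes y∈ = inside y∈ (nodes-closed (fwd j) y∈)
    ... | no y∉  = outside y∉ (y∉ ∘ nodes-closed (bwd j)) (tight j)

  some-tight : ∃ (Tight (e ∷ G))
  some-tight = result leftBlock c₁ ,
    λ {y} {z} → result-tight leftBlock c₁ (inj₁ perform-c₁) {y} {z}

module _ {G : Graph n} {x z : Fin n} (π : Arrangement n) (tight : Tight G π)
         (x≁z : ¬ Connected G x z) (path : IsPath ((x , z) ∷ G) x) where

  mergeˡ : position π x < position π z → Merge G (x , z) path π x z
  mergeˡ x<z with p , q , bₓ , b_ , eq ← blocks x≁z path = record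
    { p = p ; q = q ; blockˡ = bₓ ; blockʳ = b_ ; order = eq ; l≁r = x≁z ; l<r = x<z
    ; tight = tight }

  mergeʳ : ¬ position π x < position π z → Merge G (x , z) path π z x
  mergeʳ x≮z with p , q , bₓ , b_ , eq ← blocks x≁z path = record
    { p = q ; q = p ; blockˡ = b_ ; blockʳ = bₓ ; order = Sum.swap eq ; l≁r = x≁z ∘ connected-sym
    ; l<r = ℕ.≤∧≢⇒< (ℕ.≮⇒≥ x≮z) (z≢x ∘ index-injective (word-unique π) (∈-word π z) (∈-word π x)
        ∘ ℕ.suc-injective)
    ; tight = tight }
    where
    z≢x : z ≢ x
    z≢x refl = x≁z ε

  exists-tight : ∃ (Tight ((x , z) ∷ G))
  exists-tight with position π x ℕ.<? position π z
  ... | yes x<z = Merge.some-tight (mergeˡ x<z)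
  ... | no  x≮z = Merge.some-tight (mergeʳ x≮z)

-- The final arrangement of a solution

finalGraph : {G : Graph n} → Reveals G → Graph n
finalGraph {G = G} []                  = G
finalGraph         (reveal _ _ _ _ rs) = finalGraph rs

-- Edges are never removed, so an arrangement that is tight for the final graph is tight for all
-- graphs revealed before. Hence one `ω` serves for all updates.
⊆-finalGraph : ∀ {G : Graph n} (rs : Reveals G) {e} → e ∈ G → e ∈ finalGraph rs
⊆-finalGraph []                  i = i
⊆-finalGraph (reveal _ _ _ _ rs) i = ⊆-finalGraph rs (there i)

final : ∀ {G : Graph n} {rs : Reveals G} → Arrangement n → Solution rs → Arrangement n
final π []             = π
final _ (choose π _ s) = final π s

-- An update of the previous tight arrangement provides the tight arrangement with which the next
-- MinLA is compared.
final-tight : ∀ {G : Graph n} {rs : Reveals G} (π : Arrangement n) → Loopless G → Tight G π →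
             (s : Solution rs) → Tight (finalGraph rs) (final π s)
final-tight π ll tight [] = tight
final-tight {rs = reveal x z x≁z lines rs} π ll tight (choose π′ min s) =
  final-tight π′ ll′ (minLA⇒tight (proj₁ better) π′ ll′ (proj₂ better) min) s
  where
  ll′ = (λ { refl → x≁z ε }) ∷ ll
  better = exists-tight π tight x≁z (lines x)

-- Rationals, expectations and sums

-- Opaque since ℚ.+ and ℚ.* unfold on all arguments, so that terms k ÷ 1 would be
-- normalised whenever two rational expressions are compared.
opaque
  ι : ℕ → ℚ
  ι k = k ÷ 1

  ι≡ : ∀ k → ι k ≡ k ÷ 1
  ι≡ k = refl

ι-0 : ι 0 ≡ 0ℚ
ι-0 = ι≡ 0

ι-1 : ι 1 ≡ 1ℚ
ι-1 = ι≡ 1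

ι-0-* : ∀ c → ι 0 ℚ.* c ≡ 0ℚ
ι-0-* c = trans (cong (ℚ._* c) ι-0) (ℚ.*-zeroˡ c)

toℚᵘ-/ : ∀ i k → ℚ.toℚᵘ (i / suc k) ℚᵘ.≃ ℚᵘ.mkℚᵘ i k
toℚᵘ-/ i k = ℚ.toℚᵘ-fromℚᵘ (ℚᵘ.mkℚᵘ i k)

opaque
  unfolding ι

  ι-+ : ∀ a b → ι (a + b) ≡ ι a ℚ.+ ι b
  ι-+ a b = ℚ.toℚᵘ-injective (begin
    ℚ.toℚᵘ (ι (a + b))                     ≈⟨ toℚᵘ-/ (+ (a + b)) 0 ⟩
    ℚᵘ.mkℚᵘ (+ (a + b)) 0                  ≈⟨ ℚᵘ.*≡* (eq (+ a) (+ b)) ⟩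
    ℚᵘ.mkℚᵘ (+ a) 0 ℚᵘ.+ ℚᵘ.mkℚᵘ (+ b) 0   ≈⟨ ℚᵘ.+-cong (toℚᵘ-/ (+ a) 0) (toℚᵘ-/ (+ b) 0) ⟨
    ℚ.toℚᵘ (ι a) ℚᵘ.+ ℚ.toℚᵘ (ι b)         ≈⟨ ℚ.toℚᵘ-homo-+ (ι a) (ι b) ⟨
    ℚ.toℚᵘ (ι a ℚ.+ ι b)                   ∎)
    where
    open ≃-Reasoning
    eq : ∀ a b → (a ℤ.+ b) ℤ.* (+ 1) ≡ (a ℤ.* (+ 1) ℤ.+ b ℤ.* (+ 1)) ℤ.* (+ 1)
    eq = ℤ.solve-∀

opaque
  unfolding ι

  ÷-* : ∀ a b c → (a ÷ suc b) ℚ.* ι c ≡ (a * c) ÷ suc b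
  ÷-* a b c = ℚ.toℚᵘ-injective (begin
    ℚ.toℚᵘ ((a ÷ suc b) ℚ.* ι c)           ≈⟨ ℚ.toℚᵘ-homo-* (a ÷ suc b) (ι c) ⟩
    ℚ.toℚᵘ (a ÷ suc b) ℚᵘ.* ℚ.toℚᵘ (ι c)   ≈⟨ ℚᵘ.*-cong (toℚᵘ-/ (+ a) b) (toℚᵘ-/ (+ c) 0) ⟩
    ℚᵘ.mkℚᵘ (+ a) b ℚᵘ.* ℚᵘ.mkℚᵘ (+ c) 0
      ≈⟨ ℚᵘ.*≡* (cong₂ ℤ._*_ (sym (ℤ.pos-* a c)) (cong (+_ ∘ suc) (sym (ℕ.*-identityʳ b)))) ⟩
    ℚᵘ.mkℚᵘ (+ (a * c)) b                  ≈⟨ toℚᵘ-/ (+ (a * c)) b ⟨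
    ℚ.toℚᵘ ((a * c) ÷ suc b)               ∎)
    where open ≃-Reasoning

opaque
  unfolding ι

  ι-* : ∀ a b → ι (a * b) ≡ ι a ℚ.* ι b
  ι-* a b = sym (÷-* a 0 b)

opaque
  unfolding ι

  ι-mono : ∀ {a b} → a ≤ b → ι a ℚ.≤ ι b
  ι-mono {a} {b} a≤b = /-mono {a} {b} {0} {0} (ℕ.*-monoˡ-≤ 1 a≤b)

opaque
  unfolding ι

  ι-nonNeg : ∀ a → 0ℚ ℚ.≤ ι a
  ι-nonNeg a = ι-mono {0} {a} z≤n

÷-nonNeg : ∀ a b → 0ℚ ℚ.≤ a ÷ b
÷-nonNeg a zero    = ℚ.≤-refl
÷-nonNeg a (suc b) = ℚ.≤-trans (ℚ.≤-reflexive (sym (ℚ.0/n≡0 (suc b))))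
    (/-mono {0} {a} {b} {b} z≤n)

opaque
  unfolding ι

  ÷-*-cancel : ∀ a {b} → 0 < b → (a ÷ b) ℚ.* ι b ≡ ι a
  ÷-*-cancel a {suc b} _ = trans (÷-* a b (suc b)) (ℚ.≤-antisym
    (/-mono {a * suc b} {a} {b} {0} (ℕ.≤-reflexive (ℕ.*-identityʳ _)))
    (/-mono {a} {a * suc b} {0} {b} (ℕ.≤-reflexive (sym (ℕ.*-identityʳ _)))))

opaque
  unfolding ι

  ÷-≤-÷ : ∀ a b c {k m} → 0 < k → 0 < m → a * m ≤ b * c * k → a ÷ k ℚ.≤ ι b ℚ.* (c ÷ m)
  ÷-≤-÷ a b c {suc k} {suc m} _ _ le =
    ℚ.≤-trans (/-mono {a} {c * b} {k} {m}
        (subst (λ e → a * suc m ≤ e * suc k) (ℕ.*-comm b c) le))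
    (ℚ.≤-reflexive (trans (sym (÷-* c m b)) (ℚ.*-comm (c ÷ suc m) (ι b))))

÷-+ : ∀ a b {k} → 0 < k → a + b ≡ k → (a ÷ k) ℚ.+ (b ÷ k) ≡ 1ℚ
÷-+ a b {suc k} k>0 eq = begin
  (a ÷ suc k) ℚ.+ (b ÷ suc k)                  ≡⟨ cong₂ ℚ._+_ (factor a) (factor b) ⟩
  (1 ÷ suc k) ℚ.* ι a ℚ.+ (1 ÷ suc k) ℚ.* ι b  ≡⟨ ℚ.*-distribˡ-+ (1 ÷ suc k) (ι a) (ι b) ⟨
  (1 ÷ suc k) ℚ.* (ι a ℚ.+ ι b)
    ≡⟨ cong ((1 ÷ suc k) ℚ.*_) (trans (sym (ι-+ a b)) (cong ι eq)) ⟩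
  (1 ÷ suc k) ℚ.* ι (suc k)                    ≡⟨ trans (÷-*-cancel 1 k>0) ι-1 ⟩
  1ℚ                                           ∎
  where
  open ≡-Reasoning
  factor : ∀ a → a ÷ suc k ≡ (1 ÷ suc k) ℚ.* ι a
  factor a = sym (trans (÷-* 1 k a) (cong (_÷ suc k) (ℕ.*-identityˡ a)))

*-mono : ∀ {p q r} → 0ℚ ℚ.≤ p → q ℚ.≤ r → p ℚ.* q ℚ.≤ p ℚ.* r
*-mono {p} 0≤p le = ℚ.*-monoˡ-≤-nonNeg p {{ℚ.nonNegative 0≤p}} le

*-nonNeg : ∀ {p q} → 0ℚ ℚ.≤ p → 0ℚ ℚ.≤ q → 0ℚ ℚ.≤ p ℚ.* q
*-nonNeg {p} 0≤p 0≤q = ℚ.≤-trans (ℚ.≤-reflexive (sym (ℚ.*-zeroʳ p))) (*-mono 0≤p 0≤q)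

-- Expectations

expect : (A → ℚ) → Dist A → ℚ
expect g []            = 0ℚ
expect g ((p , a) ∷ μ) = p ℚ.* g a ℚ.+ expect g μ

𝔼≡expect : ∀ μ → 𝔼 μ ≡ expect ι μ
𝔼≡expect []            = refl
𝔼≡expect ((p , k) ∷ μ) = cong₂ (λ s t → p ℚ.* s ℚ.+ t) (sym (ι≡ k)) (𝔼≡expect μ)

expect-++ : ∀ (g : A → ℚ) μ ν → expect g (μ ++ ν) ≡ expect g μ ℚ.+ expect g ν
expect-++ g []            ν = sym (ℚ.+-identityˡ (expect g ν))
expect-++ g ((p , a) ∷ μ) ν = trans (cong (p ℚ.* g a ℚ.+_) (expect-++ g μ ν))
    (sym (ℚ.+-assoc (p ℚ.* g a) (expect g μ) (expect g ν)))

expect-scale : ∀ (g : A → ℚ) p μ → expect g (map (λ (q , a) → p ℚ.* q , a) μ) ≡ p ℚ.* expect g μ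
expect-scale g p []            = sym (ℚ.*-zeroʳ p)
expect-scale g p ((q , a) ∷ μ) = begin
  p ℚ.* q ℚ.* g a ℚ.+ expect g (map _ μ)
    ≡⟨ cong₂ ℚ._+_ (ℚ.*-assoc p q (g a)) (expect-scale g p μ) ⟩
  p ℚ.* (q ℚ.* g a) ℚ.+ p ℚ.* expect g μ     ≡⟨ ℚ.*-distribˡ-+ p (q ℚ.* g a) (expect g μ) ⟨
  p ℚ.* (q ℚ.* g a ℚ.+ expect g μ)           ∎
  where open ≡-Reasoning

-- The law of total expectation. It rests on linearity alone, whatever the weights add up to.
expect->>= : ∀ (g : B → ℚ) (μ : Dist A) f → expect g (μ >>= f) ≡ expect (λ a → expect g (f a)) μ
expect->>= g []            f = refl
expect->>= g ((p , a) ∷ μ) f = trans (expect-++ g (map _ (f a)) (μ >>= f))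
  (cong₂ ℚ._+_ (expect-scale g p (f a)) (expect->>= g μ f))

expect-return : ∀ (g : A → ℚ) a → expect g (return a) ≡ g a
expect-return g a = trans (ℚ.+-identityʳ (1ℚ ℚ.* g a)) (ℚ.*-identityˡ (g a))

expect-cong : ∀ {g h : A → ℚ} μ → (∀ a → g a ≡ h a) → expect g μ ≡ expect h μ
expect-cong []            eq = refl
expect-cong ((p , a) ∷ μ) eq = cong₂ ℚ._+_ (cong (p ℚ.*_) (eq a)) (expect-cong μ eq)

suc-C-2 : ∀ m → suc m C 2 ≡ m + m C 2
suc-C-2 m = trans (sym (nCk+nC[k+1]≡[n+1]C[k+1] m 1)) (cong (_+ m C 2) (nC1≡n m))

-- Sums over the pairs of a list

∑ : (A → ℚ) → List A → ℚ
∑ f []       = 0ℚ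
∑ f (x ∷ xs) = f x ℚ.+ ∑ f xs

interchange : ∀ a b c d → (a ℚ.+ b) ℚ.+ (c ℚ.+ d) ≡ (a ℚ.+ c) ℚ.+ (b ℚ.+ d)
interchange = solve 4 (λ a b c d → (a :+ b) :+ (c :+ d) := (a :+ c) :+ (b :+ d)) refl

∑-++ : ∀ (f : A → ℚ) xs ys → ∑ f (xs ++ ys) ≡ ∑ f xs ℚ.+ ∑ f ys
∑-++ f []       ys = sym (ℚ.+-identityˡ (∑ f ys))
∑-++ f (x ∷ xs) ys = trans (cong (f x ℚ.+_) (∑-++ f xs ys))
    (sym (ℚ.+-assoc (f x) (∑ f xs) (∑ f ys)))

∑-cong : ∀ {f g : A → ℚ} xs → (∀ {x} → x ∈ xs → f x ≡ g x) → ∑ f xs ≡ ∑ g xs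
∑-cong []       eq = refl
∑-cong (x ∷ xs) eq = cong₂ ℚ._+_ (eq (here refl)) (∑-cong xs (eq ∘ there))

∑-mono : ∀ {f g : A → ℚ} xs → (∀ {x} → x ∈ xs → f x ℚ.≤ g x) → ∑ f xs ℚ.≤ ∑ g xs
∑-mono []       le = ℚ.≤-refl
∑-mono (x ∷ xs) le = ℚ.+-mono-≤ (le (here refl)) (∑-mono xs (le ∘ there))

∑-+ : ∀ (f g : A → ℚ) xs → ∑ (λ x → f x ℚ.+ g x) xs ≡ ∑ f xs ℚ.+ ∑ g xs
∑-+ f g []       = refl
∑-+ f g (x ∷ xs) = trans (cong ((f x ℚ.+ g x) ℚ.+_) (∑-+ f g xs))
    (interchange (f x) (g x) (∑ f xs) (∑ g xs))

∑-* : ∀ c (f : A → ℚ) xs → ∑ (λ x → c ℚ.* f x) xs ≡ c ℚ.* ∑ f xs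
∑-* c f []       = sym (ℚ.*-zeroʳ c)
∑-* c f (x ∷ xs) = trans (cong (c ℚ.* f x ℚ.+_) (∑-* c f xs))
    (sym (ℚ.*-distribˡ-+ c (f x) (∑ f xs)))

ι-suc-* : ∀ k c → ι (suc k) ℚ.* c ≡ c ℚ.+ ι k ℚ.* c
ι-suc-* k c = begin
  ι (1 + k) ℚ.* c           ≡⟨ cong (ℚ._* c) (ι-+ 1 k) ⟩
  (ι 1 ℚ.+ ι k) ℚ.* c       ≡⟨ cong (λ t → (t ℚ.+ ι k) ℚ.* c) ι-1 ⟩
  (1ℚ ℚ.+ ι k) ℚ.* c        ≡⟨ ℚ.*-distribʳ-+ c 1ℚ (ι k) ⟩
  1ℚ ℚ.* c ℚ.+ ι k ℚ.* c    ≡⟨ cong (ℚ._+ ι k ℚ.* c) (ℚ.*-identityˡ c) ⟩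
  c ℚ.+ ι k ℚ.* c           ∎
  where open ≡-Reasoning

∑-const : ∀ {f : A → ℚ} {c} xs → (∀ {x} → x ∈ xs → f x ≡ c) → ∑ f xs ≡ ι (length xs) ℚ.* c
∑-const         {c = c} []       eq = sym (ι-0-* c)
∑-const {f = f} {c = c} (x ∷ xs) eq =
  trans (cong₂ ℚ._+_ (eq (here refl)) (∑-const xs (eq ∘ there))) (sym (ι-suc-* (length xs) c))

∑-↭ : ∀ (f : A → ℚ) {xs ys} → xs ↭ ys → ∑ f xs ≡ ∑ f ys
∑-↭ f ↭refl        = refl
∑-↭ f (prep x p)   = cong (f x ℚ.+_) (∑-↭ f p)
∑-↭ f (swap {ys = ys} x y p) = trans (cong (λ t → f x ℚ.+ (f y ℚ.+ t)) (∑-↭ f p))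
  (solve 3 (λ a b c → a :+ (b :+ c) := b :+ (a :+ c)) refl (f x) (f y) (∑ f ys))
∑-↭ f (↭trans p q) = trans (∑-↭ f p) (∑-↭ f q)

cross : (A → A → ℚ) → List A → List A → ℚ
cross W xs ys = ∑ (λ x → ∑ (W x) ys) xs

-- Each pair is handed to `W` in list order, so that an asymmetric `W` can detect inversions.
pairs : (A → A → ℚ) → List A → ℚ
pairs W []       = 0ℚ
pairs W (x ∷ xs) = ∑ (W x) xs ℚ.+ pairs W xs

module _ (W : A → A → ℚ) where

  cross-++ʳ : ∀ xs ys zs → cross W xs (ys ++ zs) ≡ cross W xs ys ℚ.+ cross W xs zs
  cross-++ʳ xs ys zs = trans (∑-cong xs (λ {x} _ → ∑-++ (W x) ys zs))
      (∑-+ (λ x → ∑ (W x) ys) (λ x → ∑ (W x) zs) xs)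

  cross-↭ˡ : ∀ {xs xs′} ys → xs ↭ xs′ → cross W xs ys ≡ cross W xs′ ys
  cross-↭ˡ ys = ∑-↭ (λ x → ∑ (W x) ys)

  cross-↭ʳ : ∀ xs {ys ys′} → ys ↭ ys′ → cross W xs ys ≡ cross W xs ys′
  cross-↭ʳ xs p = ∑-cong xs (λ {x} _ → ∑-↭ (W x) p)

  cross-flip : ∀ xs ys → cross W xs ys ≡ cross (flip W) ys xs
  cross-flip []       ys = sym (trans (∑-const ys (λ _ → refl)) (ℚ.*-zeroʳ (ι (length ys))))
  cross-flip (x ∷ xs) ys = trans (cong (∑ (W x) ys ℚ.+_) (cross-flip xs ys))
      (sym (∑-+ (W x) (λ y → ∑ (λ x → W x y) xs) ys))

  pairs-++ : ∀ xs ys → pairs W (xs ++ ys) ≡ pairs W xs ℚ.+ cross W xs ys ℚ.+ pairs W ys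
  pairs-++ []       ys = trans (sym (ℚ.+-identityˡ (pairs W ys)))
      (cong (ℚ._+ pairs W ys) (sym (ℚ.+-identityˡ 0ℚ)))
  pairs-++ (x ∷ xs) ys = trans (cong₂ ℚ._+_ (∑-++ (W x) xs ys) (pairs-++ xs ys))
    (solve 5 (λ a b c d e → (a :+ b) :+ (c :+ d :+ e) := (a :+ c) :+ (b :+ d) :+ e) refl
      (∑ (W x) xs) (∑ (W x) ys) (pairs W xs) (cross W xs ys) (pairs W ys))

  -- The part of `pairs W (bs ++ qs ++ as)` that does not depend on the order within `qs`; it is
  -- separated because updates only permute such a middle piece.
  outer : List A → List A → List A → ℚ
  outer bs qs as = pairs W bs ℚ.+ (cross W bs qs ℚ.+ cross W bs as)
      ℚ.+ (cross W qs as ℚ.+ pairs W as)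

  pairs-outer : ∀ bs qs as → pairs W (bs ++ qs ++ as) ≡ outer bs qs as ℚ.+ pairs W qs
  pairs-outer bs qs as = begin
    pairs W (bs ++ qs ++ as)
      ≡⟨ pairs-++ bs (qs ++ as) ⟩
    pairs W bs ℚ.+ cross W bs (qs ++ as) ℚ.+ pairs W (qs ++ as)
      ≡⟨ cong₂ (λ s t → pairs W bs ℚ.+ s ℚ.+ t) (cross-++ʳ bs qs as) (pairs-++ qs as) ⟩
    pairs W bs ℚ.+ (cross W bs qs ℚ.+ cross W bs as)
        ℚ.+ (pairs W qs ℚ.+ cross W qs as ℚ.+ pairs W as)
      ≡⟨ solve 6 (λ a b c d e f →
             a :+ (b :+ c) :+ (d :+ e :+ f) := a :+ (b :+ c) :+ (e :+ f) :+ d) refl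
           (pairs W bs) (cross W bs qs) (cross W bs as)
           (pairs W qs) (cross W qs as) (pairs W as) ⟩
    outer bs qs as ℚ.+ pairs W qs ∎
    where open ≡-Reasoning

  outer-↭ : ∀ bs {qs qs′} as → qs ↭ qs′ → outer bs qs as ≡ outer bs qs′ as
  outer-↭ bs as p = cong₂ (λ s t → pairs W bs ℚ.+ (s ℚ.+ cross W bs as) ℚ.+ (t ℚ.+ pairs W as))
    (cross-↭ʳ bs p) (cross-↭ˡ as p)

  pairs-const : ∀ {R : A → A → Set} {w} xs → (∀ {x y} → x ∈ xs → y ∈ xs → R x y → W x y ≡ w) →
                AllPairs R xs → pairs W xs ≡ ι (length xs C 2) ℚ.* w
  pairs-const {w = w} []       eq []       = sym (ι-0-* w)
  pairs-const {w = w} (x ∷ xs) eq (px ∷ u) = begin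
    ∑ (W x) xs ℚ.+ pairs W xs
      ≡⟨ cong₂ ℚ._+_ (∑-const xs (λ y∈ → eq (here refl) (there y∈) (All.lookup px y∈)))
                     (pairs-const xs (λ i j → eq (there i) (there j)) u) ⟩
    ι m ℚ.* w ℚ.+ ι (m C 2) ℚ.* w
      ≡⟨ ℚ.*-distribʳ-+ w (ι m) (ι (m C 2)) ⟨
    (ι m ℚ.+ ι (m C 2)) ℚ.* w
      ≡⟨ cong (ℚ._* w) (ι-+ m (m C 2)) ⟨
    ι (m + m C 2) ℚ.* w
      ≡⟨ cong (λ t → ι t ℚ.* w) (suc-C-2 m) ⟨
    ι (suc m C 2) ℚ.* w ∎
    where
    open ≡-Reasoning
    m = length xs

pairs-+ : ∀ (V W : A → A → ℚ) xs → pairs (λ x y → V x y ℚ.+ W x y) xs ≡ pairs V xs ℚ.+ pairs W xs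
pairs-+ V W []       = refl
pairs-+ V W (x ∷ xs) = trans (cong₂ ℚ._+_ (∑-+ (V x) (W x) xs) (pairs-+ V W xs))
    (interchange (∑ (V x) xs) (∑ (W x) xs) (pairs V xs) (pairs W xs))

cross-mono : ∀ {V W : A → A → ℚ} → (∀ x y → V x y ℚ.≤ W x y) →
             ∀ xs ys → cross V xs ys ℚ.≤ cross W xs ys
cross-mono le xs ys = ∑-mono xs (λ {x} _ → ∑-mono ys (λ {y} _ → le x y))

pairs-mono : ∀ {V W : A → A → ℚ} → (∀ x y → V x y ℚ.≤ W x y) → ∀ xs → pairs V xs ℚ.≤ pairs W xs
pairs-mono le []       = ℚ.≤-refl
pairs-mono le (x ∷ xs) = ℚ.+-mono-≤ (∑-mono xs (λ {y} _ → le x y)) (pairs-mono le xs)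

outer-mono : ∀ {V W : A → A → ℚ} → (∀ x y → V x y ℚ.≤ W x y) →
             ∀ bs qs as → outer V bs qs as ℚ.≤ outer W bs qs as
outer-mono le bs qs as = ℚ.+-mono-≤
  (ℚ.+-mono-≤ (pairs-mono le bs) (ℚ.+-mono-≤ (cross-mono le bs qs) (cross-mono le bs as)))
  (ℚ.+-mono-≤ (cross-mono le qs as) (pairs-mono le as))

opaque
  unfolding ι

  -- Used to bring `costs-sum` back to the naturals after a computation with rational sums.
  ι-injective : ∀ {a b} → ι a ≡ ι b → a ≡ b
  ι-injective {a} {b} eq = ℤ.+-injective (trans (sym (ℤ.*-identityʳ (+ a)))
    (trans (ℚᵘ.drop-*≡* (ℚᵘ.≃-trans (ℚᵘ.≃-sym (toℚᵘ-/ (+ a) 0))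
             (ℚᵘ.≃-trans (ℚᵘ.≃-reflexive (cong ℚ.toℚᵘ eq)) (toℚᵘ-/ (+ b) 0))))
           (ℤ.*-identityʳ (+ b))))

ι-+₃ : ∀ a b c → ι (a + b + c) ≡ ι a ℚ.+ ι b ℚ.+ ι c
ι-+₃ a b c = trans (ι-+ (a + b) c) (cong (ℚ._+ ι c) (ι-+ a b))

-- Binomial coefficients

2*C-2 : ∀ m → 2 * (suc m C 2) ≡ suc m * m
2*C-2 zero    = refl
2*C-2 (suc m) = begin
  2 * (suc (suc m) C 2)         ≡⟨ cong (2 *_) (suc-C-2 (suc m)) ⟩
  2 * (suc m + suc m C 2)       ≡⟨ ℕ.*-distribˡ-+ 2 (suc m) (suc m C 2) ⟩
  2 * suc m + 2 * (suc m C 2)   ≡⟨ cong (λ t → 2 * suc m + t) (2*C-2 m) ⟩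
  2 * suc m + suc m * m         ≡⟨ identity m ⟩
  suc (suc m) * suc m           ∎
  where
  open ≡-Reasoning
  identity : ∀ m → 2 * suc m + suc m * m ≡ suc (suc m) * suc m
  identity = solve-∀

-- A pair among `s + t` objects lies among the first `s`, across, or among the last `t`.
+-C-2 : ∀ s t → (s + t) C 2 ≡ s C 2 + (s * t + t C 2)
+-C-2 zero    t = refl
+-C-2 (suc s) t = begin
  suc (s + t) C 2                      ≡⟨ suc-C-2 (s + t) ⟩
  s + t + (s + t) C 2                  ≡⟨ cong (λ x → s + t + x) (+-C-2 s t) ⟩
  s + t + (s C 2 + (s * t + t C 2))    ≡⟨ identity s t (s C 2) (t C 2) ⟩
  s + s C 2 + (suc s * t + t C 2)      ≡⟨ cong (_+ (suc s * t + t C 2)) (suc-C-2 s) ⟨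
  suc s C 2 + (suc s * t + t C 2)      ∎
  where
  open ≡-Reasoning
  identity : ∀ s t x y → s + t + (x + (s * t + y)) ≡ s + x + (suc s * t + y)
  identity = solve-∀

C-2-positive : ∀ {s t} → 0 < s → 0 < t → 0 < (s + t) C 2
C-2-positive {s@(suc _)} {t@(suc _)} _ _ = ℕ.<-≤-trans (s≤s z≤n)
  (ℕ.≤-trans (ℕ.m≤m+n (s * t) (t C 2))
    (ℕ.≤-trans (ℕ.m≤n+m _ (s C 2)) (ℕ.≤-reflexive (sym (+-C-2 s t)))))

-- If one target includes reversing the block of size s, then the other one
-- costs y ≤ T − C(s, 2), and the bound says that y/T ≤ 2t/(s+t).
complement-bound : ∀ s t y → 0 < t → y + s C 2 ≤ (s + t) C 2 →
                   y * (s + t) ≤ 2 * t * ((s + t) C 2)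
complement-bound s t@(suc t′) y _ le = ℕ.*-cancelˡ-≤ 2 (begin
  2 * (y * (s + t))              ≡⟨ ℕ.*-assoc 2 y (s + t) ⟨
  2 * y * (s + t)                ≤⟨ ℕ.*-monoˡ-≤ (s + t) (ℕ.*-monoʳ-≤ 2 y≤) ⟩
  2 * (s * t + t C 2) * (s + t)  ≡⟨ cong (_* (s + t)) (ℕ.*-distribˡ-+ 2 (s * t) (t C 2)) ⟩
  (2 * (s * t) + 2 * (t C 2)) * (s + t) ≡⟨ cong (λ z → (2 * (s * t) + z) * (s + t)) (2*C-2 t′) ⟩
  (2 * (s * t) + t * t′) * (s + t)
    -- The second copy of `t * t′` completes the sum to 2t(s + t - 1), which times s + t is a
    -- multiple of the binomial coefficient.
    ≤⟨ ℕ.*-monoˡ-≤ (s + t) (ℕ.+-monoʳ-≤ (2 * (s * t)) (ℕ.m≤m+n (t * t′) (t * t′))) ⟩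
  (2 * (s * t) + (t * t′ + t * t′)) * (s + t) ≡⟨ identity s t′ ⟩
  2 * t * (suc (s + t′) * (s + t′)) ≡⟨ cong (λ z → 2 * t * z) (2*C-2 (s + t′)) ⟨
  2 * t * (2 * (suc (s + t′) C 2)) ≡⟨ swap-2 (2 * t) (suc (s + t′) C 2) ⟩
  2 * (2 * t * (suc (s + t′) C 2)) ≡⟨ cong (λ z → 2 * (2 * t * (z C 2))) (ℕ.+-suc s t′) ⟨
  2 * (2 * t * ((s + t) C 2))    ∎)
  where
  open ℕ.≤-Reasoning
  y≤ : y ≤ s * t + t C 2
  y≤ = ℕ.+-cancelʳ-≤ (s C 2) y (s * t + t C 2)
    (ℕ.≤-trans le (ℕ.≤-reflexive (trans (+-C-2 s t) (ℕ.+-comm (s C 2) _))))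
  identity : ∀ s t → (2 * (s * suc t) + (suc t * t + suc t * t)) * (s + suc t)
                     ≡ 2 * suc t * (suc (s + t) * (s + t))
  identity = solve-∀
  swap-2 : ∀ x y → x * (2 * y) ≡ 2 * (x * y)
  swap-2 = solve-∀

-- Costs of combinations as counts of inverted pairs

index-ascending : ∀ (us vs : List (Fin n)) → Unique (us ++ vs) →
                  AllPairs (λ x y → index (us ++ vs) x < index (us ++ vs) y) vs
index-ascending us []       uq = []
index-ascending us (v ∷ vs) uq =
  All.tabulate (λ y∈vs → subst (λ w → index w v < index w _) shape
    (index-split (us ∷ʳ v) vs uq′ (∈-++⁺ʳ us (here refl)) y∈vs))
  ∷ subst (λ w → AllPairs (λ x y → index w x < index w y) vs) shape
      (index-ascending (us ∷ʳ v) vs uq′)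
  where
  shape = List.++-assoc us (v ∷ []) vs
  uq′ = subst Unique (sym shape) uq

reverseIf-∈ : ∀ b {xs : List A} {x} → x ∈ xs → x ∈ (if b then reverse xs else xs)
reverseIf-∈ false i = i
reverseIf-∈ true  i = ∈-resp-↭ (↭-sym (↭-reverse _)) i

reverseIf-∈⁻ : ∀ b {xs : List A} {x} → x ∈ (if b then reverse xs else xs) → x ∈ xs
reverseIf-∈⁻ false i = i
reverseIf-∈⁻ true  i = ∈-resp-↭ (↭-reverse _) i

length-reverseIf : ∀ b (xs : List A) → length (if b then reverse xs else xs) ≡ length xs
length-reverseIf false xs = refl
length-reverseIf true  xs = List.length-reverse xs

module _ {V : A → A → ℚ} {Asc : A → A → Set} (asc : ∀ {x y} → Asc x y → V x y ≡ 0ℚ) where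

  pairs-ascending : ∀ xs → AllPairs Asc xs → pairs V xs ≡ 0ℚ
  pairs-ascending xs ps = trans (pairs-const V xs (λ _ _ → asc) ps)
      (ℚ.*-zeroʳ (ι (length xs C 2)))

  pairs-descending : ∀ {w} xs → (∀ {x y} → x ∈ xs → y ∈ xs → Asc x y → V y x ≡ w) →
                     AllPairs Asc (reverse xs) → pairs V xs ≡ ι (length xs C 2) ℚ.* w
  pairs-descending xs desc ps = pairs-const V xs (λ i j → desc j i)
    (subst (AllPairs (flip Asc)) (List.reverse-involutive xs) (allPairs-reverse ps))

  pairs-reverseIf : ∀ b {w} xs → (∀ {x y} → x ∈ xs → y ∈ xs → Asc x y → V y x ≡ w) →
                    AllPairs Asc (if b then reverse xs else xs) →
                    pairs V xs ≡ ι (if b then length xs C 2 else 0) ℚ.* w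
  pairs-reverseIf false {w} xs desc ps = trans (pairs-ascending xs ps) (sym (ι-0-* w))
  pairs-reverseIf true      xs desc ps = pairs-descending xs desc ps

  cross-ascending : ∀ xs ys → (∀ {x y} → x ∈ xs → y ∈ ys → Asc x y) → cross V xs ys ≡ 0ℚ
  cross-ascending xs ys as = trans (∑-const xs (λ i → trans (∑-const ys (λ j → asc (as i j)))
    (ℚ.*-zeroʳ (ι (length ys))))) (ℚ.*-zeroʳ (ι (length xs)))

  -- If `c` sorts `L ++ R`, then the pairs out of order are all pairs of each block that `c`
  -- reverses and, if it swaps the blocks, all pairs across. The weights `wˡ`, `wˣ` and `wʳ` are
  -- separate because the two blocks carry different credits.
  pairs-perform : ∀ c {wˡ wˣ wʳ} L R →
                  (∀ {x y} → x ∈ L → y ∈ L → Asc x y → V y x ≡ wˡ) →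
                  (∀ {x y} → x ∈ L → y ∈ R → Asc y x → V x y ≡ wˣ) →
                  (∀ {x y} → x ∈ R → y ∈ R → Asc x y → V y x ≡ wʳ) →
                  AllPairs Asc (perform c L R) → let open Combination c in
                  pairs V (L ++ R) ≡ ι (if reverseLeft then length L C 2 else 0) ℚ.* wˡ
                    ℚ.+ ι (if swapBlocks then length L * length R else 0) ℚ.* wˣ
                    ℚ.+ ι (if reverseRight then length R C 2 else 0) ℚ.* wʳ
  pairs-perform (combination rl false rr) {wˣ = wˣ} L R hˡ hˣ hʳ ps =
    trans (pairs-++ V L R) (cong₂ ℚ._+_ (cong₂ ℚ._+_
      (pairs-reverseIf rl L hˡ (allPairs-++⁻ˡ _ ps))
      (trans (cross-ascending L R (λ i j → allPairs-across _ ps (reverseIf-∈ rl i)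
          (reverseIf-∈ rr j)))
             (sym (ι-0-* wˣ))))
      (pairs-reverseIf rr R hʳ (allPairs-++⁻ʳ (if rl then reverse L else L) ps)))
  pairs-perform (combination rl true rr) {wˣ = wˣ} L R hˡ hˣ hʳ ps =
    trans (pairs-++ V L R) (cong₂ ℚ._+_ (cong₂ ℚ._+_
      (pairs-reverseIf rl L hˡ (allPairs-++⁻ʳ (if rr then reverse R else R) ps))
      (trans (∑-const L (λ i → ∑-const R (λ j →
               hˣ i j (allPairs-across _ ps (reverseIf-∈ rr j) (reverseIf-∈ rl i)))))
             (trans (sym (ℚ.*-assoc (ι (length L)) (ι (length R)) wˣ))
                    (cong (ℚ._* wˣ) (sym (ι-* (length L) (length R)))))))
      (pairs-reverseIf rr R hʳ (allPairs-++⁻ˡ _ ps)))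

  -- Each operation costs as much as the number of pairs whose order it changes. This is applied
  -- with `Before` and with its converse as `Asc`, for the two targets.
  cost-pairs : (∀ {x y} → Asc x y → V y x ≡ 1ℚ) → ∀ c L R → AllPairs Asc (perform c L R) →
               ι (combinationCost c (length L) (length R)) ≡ pairs V (L ++ R)
  cost-pairs desc c@(combination rl sw rr) L R ps = sym (begin
    pairs V (L ++ R)
      ≡⟨ pairs-perform c L R (λ _ _ → desc) (λ _ _ → desc) (λ _ _ → desc) ps ⟩
    ι k ℚ.* 1ℚ ℚ.+ ι l ℚ.* 1ℚ ℚ.+ ι m ℚ.* 1ℚ
      ≡⟨ cong₂ ℚ._+_ (cong₂ ℚ._+_ (ℚ.*-identityʳ (ι k)) (ℚ.*-identityʳ (ι l)))
          (ℚ.*-identityʳ (ι m)) ⟩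
    ι k ℚ.+ ι l ℚ.+ ι m                        ≡⟨ ι-+₃ k l m ⟨
    ι (k + l + m)                              ∎)
    where
    open ≡-Reasoning
    k = if rl then length L C 2 else 0
    l = if sw then length L * length R else 0
    m = if rr then length R C 2 else 0

-- Inversions

module Kernel (ω : Arrangement n) where

  Before : Fin n → Fin n → Set
  Before u v = index (word ω) u < index (word ω) v

  before-word : AllPairs Before (word ω)
  before-word = index-ascending [] (word ω) (word-unique ω)

  before-infix : ∀ {xs} → Infix xs (word ω) → AllPairs Before xs
  before-infix {xs} (as , bs , eq) =
    allPairs-++⁻ˡ xs (allPairs-++⁻ʳ as (subst (AllPairs Before) eq before-word))

  -- The infix is contiguous in `ω`, so a foreign node belongs to the part before it or to the part
  -- after it.
  before-outside : ∀ {xs m} → Infix xs (word ω) → m ∉ xs →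
                   (∀ {u} → u ∈ xs → Before m u) ⊎ (∀ {u} → u ∈ xs → Before u m)
  before-outside {xs} {m} (as , bs , eq) m∉
    with ps ← subst (AllPairs Before) eq before-word
    with ∈-++⁻ as (subst (m ∈_) eq (∈-word ω m))
  ... | inj₁ m∈as = inj₁ (λ u∈ → allPairs-across as ps m∈as (∈-++⁺ˡ u∈))
  ... | inj₂ m∈   = inj₂ (λ u∈ → allPairs-across xs (allPairs-++⁻ʳ as ps) u∈
      ([ ⊥-elim ∘ m∉ , (λ i → i) ]′ (∈-++⁻ xs m∈)))

  -- 1 if u and v, in this order in some arrangement, are inverted relative to ω.
  K : Fin n → Fin n → ℚ
  K u v with index (word ω) v ℕ.<? index (word ω) u
  ... | yes _ = 1ℚ
  ... | no _  = 0ℚ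

  K-ascending : ∀ {u v} → Before u v → K u v ≡ 0ℚ
  K-ascending {u} {v} u<v with index (word ω) v ℕ.<? index (word ω) u
  ... | yes v<u = ⊥-elim (ℕ.<-asym u<v v<u)
  ... | no _    = refl

  K-descending : ∀ {u v} → Before v u → K u v ≡ 1ℚ
  K-descending {u} {v} v<u with index (word ω) v ℕ.<? index (word ω) u
  ... | yes _   = refl
  ... | no v≮u  = ⊥-elim (v≮u v<u)

  0≤1 : 0ℚ ℚ.≤ 1ℚ
  0≤1 = ℚ.nonNegative⁻¹ 1ℚ

  K-nonNeg : ∀ u v → 0ℚ ℚ.≤ K u v
  K-nonNeg u v with index (word ω) v ℕ.<? index (word ω) u
  ... | yes _ = 0≤1
  ... | no _  = ℚ.≤-refl

  K-≤1 : ∀ u v → K u v ℚ.≤ 1ℚ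
  K-≤1 u v with index (word ω) v ℕ.<? index (word ω) u
  ... | yes _ = ℚ.≤-refl
  ... | no _  = 0≤1

  compare : ∀ {u v} → u ≢ v → Before u v ⊎ Before v u
  compare {u} {v} u≢v with index (word ω) v ℕ.<? index (word ω) u
  ... | yes v<u = inj₂ v<u
  ... | no v≮u  = inj₁ (ℕ.≤∧≢⇒< (ℕ.≮⇒≥ v≮u) (u≢v ∘ index-injective (word-unique ω) (∈-word ω u)
      (∈-word ω v)))

  K-total : ∀ {u v} → u ≢ v → K u v ℚ.+ K v u ≡ 1ℚ
  K-total u≢v with compare u≢v
  ... | inj₁ u<v = cong₂ ℚ._+_ (K-ascending u<v) (K-descending u<v)
  ... | inj₂ v<u = cong₂ ℚ._+_ (K-descending v<u) (K-ascending v<u)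

  -- Every pair is inverted in exactly one of the two orders of the list; this is why the costs of
  -- the two targets are complementary.
  pairs-K-total : ∀ xs → Unique xs → pairs K xs ℚ.+ pairs (flip K) xs ≡ ι (length xs C 2)
  pairs-K-total xs uq = trans (sym (pairs-+ K (flip K) xs))
    (trans (pairs-const (λ x y → K x y ℚ.+ K y x) xs (λ _ _ → K-total) uq)
        (ℚ.*-identityʳ (ι (length xs C 2))))

  -- With credits `f`, the potential of `π` is `pairs K⟨ f ⟩ (word π)`.
  K⟨_⟩ : (Fin n → ℚ) → Fin n → Fin n → ℚ
  K⟨ f ⟩ u v = K u v ℚ.* (f u ℚ.+ f v)

  K⟨⟩-ascending : ∀ f {u v} → Before u v → K⟨ f ⟩ u v ≡ 0ℚ
  K⟨⟩-ascending f {u} {v} u<v = trans (cong (ℚ._* (f u ℚ.+ f v)) (K-ascending u<v))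
      (ℚ.*-zeroˡ (f u ℚ.+ f v))

  K⟨⟩-descending : ∀ f {u v} → Before v u → K⟨ f ⟩ u v ≡ f u ℚ.+ f v
  K⟨⟩-descending f {u} {v} v<u = trans (cong (ℚ._* (f u ℚ.+ f v)) (K-descending v<u))
      (ℚ.*-identityˡ (f u ℚ.+ f v))

  K⟨⟩-mono : ∀ {f g} → (∀ u → f u ℚ.≤ g u) → ∀ u v → K⟨ f ⟩ u v ℚ.≤ K⟨ g ⟩ u v
  K⟨⟩-mono le u v = *-mono (K-nonNeg u v) (ℚ.+-mono-≤ (le u) (le v))

-- One update

-- Both parts of an update for abstract credits: `f` before and `f′` after it. The credit is
-- constant on each block, `fˡ` and `fʳ`, and becomes `φ` on the merged one. Of its drop, only the
-- bounds `grow-left` and `grow-right` are assumed below.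
module Blocks (ω : Arrangement n) (f f′ : Fin n → ℚ) (L R : List (Fin n)) {φ fˡ fʳ : ℚ}
              (s>0 : 0 < length L) (t>0 : 0 < length R) (uq : Unique (L ++ R))
              (f-left : ∀ {u} → u ∈ L → f u ≡ fˡ) (f-right : ∀ {u} → u ∈ R → f u ≡ fʳ)
              (f′-block : ∀ {u} → u ∈ L ++ R → f′ u ≡ φ) where
  open Kernel ω

  s t T : ℕ
  s = length L
  t = length R
  T = (s + t) C 2

  -- The probabilities with which L and R move.
  α β : ℚ
  α = t ÷ (s + t)
  β = s ÷ (s + t)

  s+t>0 : 0 < s + t
  s+t>0 = ℕ.≤-trans s>0 (ℕ.m≤m+n s t)

  T>0 : 0 < T
  T>0 = C-2-positive s>0 t>0

  cost : Combination → ℕ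
  cost c = combinationCost c s t

  α+β : α ℚ.+ β ≡ 1ℚ
  α+β = ÷-+ t s s+t>0 (ℕ.+-comm t s)

  -- The combination `c` leads to the target that agrees with `ω`, and `c′` to the reverse one; `c`
  -- may be either `c₁` or `c₂` of the update.
  module _ (c c′ : Combination) (asc : AllPairs Before (perform c L R))
           (rev : perform c′ L R ≡ reverse (perform c L R)) where

    costs-sum : cost c + cost c′ ≡ T
    costs-sum = ι-injective (begin
      ι (cost c + cost c′)                           ≡⟨ ι-+ (cost c) (cost c′) ⟩
      ι (cost c) ℚ.+ ι (cost c′)                     ≡⟨ cong₂ ℚ._+_
        (cost-pairs K-ascending K-descending c L R asc)
        (cost-pairs K-ascending K-descending c′ L R
          (subst (AllPairs (flip Before)) (sym rev) (allPairs-reverse asc))) ⟩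
      pairs K (L ++ R) ℚ.+ pairs (flip K) (L ++ R)   ≡⟨ pairs-K-total (L ++ R) uq ⟩
      ι (length (L ++ R) C 2)
        ≡⟨ cong (λ k → ι (k C 2)) (List.length-++ L) ⟩
      ι T                                            ∎)
      where open ≡-Reasoning

    -- The probabilities of `c` and `c′`, each given by the cost of the other.
    γ δ : ℚ
    γ = cost c′ ÷ T
    δ = cost c ÷ T

    γ+δ : γ ℚ.+ δ ≡ 1ℚ
    γ+δ = ÷-+ (cost c′) (cost c) T>0 (trans (ℕ.+-comm (cost c′) (cost c)) costs-sum)

    γ≤1 : γ ℚ.≤ 1ℚ
    γ≤1 = begin
      γ          ≡⟨ ℚ.+-identityʳ γ ⟨
      γ ℚ.+ 0ℚ   ≤⟨ ℚ.+-monoʳ-≤ γ (÷-nonNeg (cost c) T) ⟩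
      γ ℚ.+ δ    ≡⟨ γ+δ ⟩
      1ℚ         ∎
      where open ℚ.≤-Reasoning

    -- The summands of `cost c`, which are also the numbers of inverted pairs inside `L`, across,
    -- and inside `R`.
    a b e : ℕ
    a = if Combination.reverseLeft  c then s C 2 else 0
    b = if Combination.swapBlocks   c then s * t else 0
    e = if Combination.reverseRight c then t C 2 else 0

    double : ∀ x → ι 2 ℚ.* x ≡ x ℚ.+ x
    double x = trans (ι-suc-* 1 x) (cong (x ℚ.+_)
      (trans (cong (ℚ._* x) ι-1) (ℚ.*-identityˡ x)))

    complement : ∀ x → x ≤ cost c → cost c′ + x ≤ T
    complement x le = begin
      cost c′ + x        ≤⟨ ℕ.+-monoʳ-≤ (cost c′) le ⟩
      cost c′ + cost c   ≡⟨ ℕ.+-comm (cost c′) (cost c) ⟩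
      cost c + cost c′   ≡⟨ costs-sum ⟩
      T                  ∎
      where open ℕ.≤-Reasoning

    γ≤2α : s C 2 ≤ cost c → γ ℚ.≤ α ℚ.+ α
    γ≤2α le = ℚ.≤-trans
      (÷-≤-÷ (cost c′) 2 t T>0 s+t>0 (complement-bound s t (cost c′) t>0 (complement (s C 2) le)))
      (ℚ.≤-reflexive (double α))

    γ≤2β : t C 2 ≤ cost c → γ ℚ.≤ β ℚ.+ β
    γ≤2β le = ℚ.≤-trans
      (÷-≤-÷ (cost c′) 2 s T>0 s+t>0 (subst (λ m → cost c′ * m ≤ 2 * s * (m C 2)) (ℕ.+-comm t s)
        (complement-bound t s (cost c′) s>0
          (subst (λ m → cost c′ + t C 2 ≤ m C 2) (ℕ.+-comm s t) (complement (t C 2) le)))))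
      (ℚ.≤-reflexive (double β))

    module _ (grow-left : φ ℚ.+ (α ℚ.+ α) ℚ.≤ fˡ) (grow-right : φ ℚ.+ (β ℚ.+ β) ℚ.≤ fʳ) where

      -- A block that `c` does not reverse has no inverted pairs and both sides vanish, so the bound
      -- on `γ` is required only for reversed blocks.
      when : ∀ x k {p q} → (x ≡ true → p ℚ.≤ q) →
             ι (if x then k else 0) ℚ.* p ℚ.≤ ι (if x then k else 0) ℚ.* q
      when true  k         le = *-mono (ι-nonNeg k) (le refl)
      when false k {p} {q} le = ℚ.≤-reflexive (trans (ι-0-* p) (sym (ι-0-* q)))

      -- Half of the account of a pair inside `L`: its old credit `fˡ + fˡ` has to cover the new
      -- credit `φ + φ` and a payment of `γ + γ`.
      left-bound : ι a ℚ.* (φ ℚ.+ γ) ℚ.≤ ι a ℚ.* fˡ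
      left-bound = when (Combination.reverseLeft c) (s C 2) λ eq → ℚ.≤-trans
        (ℚ.+-monoʳ-≤ φ (γ≤2α (subst (λ x → (if x then s C 2 else 0) ≤ cost c) eq
          (ℕ.≤-trans (ℕ.m≤m+n a b) (ℕ.m≤m+n (a + b) e))))) grow-left

      right-bound : ι e ℚ.* (φ ℚ.+ γ) ℚ.≤ ι e ℚ.* fʳ
      right-bound = when (Combination.reverseRight c) (t C 2) λ eq → ℚ.≤-trans
        (ℚ.+-monoʳ-≤ φ (γ≤2β (subst (λ x → (if x then t C 2 else 0) ≤ cost c) eq
          (ℕ.m≤n+m e (a + b))))) grow-right

      -- The guaranteed drops `α + α` and `β + β` of the two nodes add up to 2, so `γ ≤ 1` is
      -- enough.
      middle-bound : ι b ℚ.* ((φ ℚ.+ γ) ℚ.+ (φ ℚ.+ γ)) ℚ.≤ ι b ℚ.* (fˡ ℚ.+ fʳ)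
      middle-bound = *-mono (ι-nonNeg b) (begin
        (φ ℚ.+ γ) ℚ.+ (φ ℚ.+ γ)
          ≤⟨ ℚ.+-mono-≤ (ℚ.+-monoʳ-≤ φ γ≤1) (ℚ.+-monoʳ-≤ φ γ≤1) ⟩
        (φ ℚ.+ 1ℚ) ℚ.+ (φ ℚ.+ 1ℚ)
          ≡⟨ cong (λ x → (φ ℚ.+ x) ℚ.+ (φ ℚ.+ x)) α+β ⟨
        (φ ℚ.+ (α ℚ.+ β)) ℚ.+ (φ ℚ.+ (α ℚ.+ β))
          ≡⟨ solve 3 (λ p a b → (p :+ (a :+ b)) :+ (p :+ (a :+ b))
              := (p :+ (a :+ a)) :+ (p :+ (b :+ b))) refl φ α β ⟩
        (φ ℚ.+ (α ℚ.+ α)) ℚ.+ (φ ℚ.+ (β ℚ.+ β))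
          ≤⟨ ℚ.+-mono-≤ grow-left grow-right ⟩
        fˡ ℚ.+ fʳ ∎)
        where open ℚ.≤-Reasoning

      new-ascending : pairs K⟨ f′ ⟩ (perform c L R) ≡ 0ℚ
      new-ascending = pairs-ascending (K⟨⟩-ascending f′) (perform c L R) asc

      perform-∈ : ∀ c {u} → u ∈ perform c L R → u ∈ L ++ R
      perform-∈ (combination rl false rr) i with ∈-++⁻ (if rl then reverse L else L) i
      ... | inj₁ j = ∈-++⁺ˡ (reverseIf-∈⁻ rl j)
      ... | inj₂ j = ∈-++⁺ʳ L (reverseIf-∈⁻ rr j)
      perform-∈ (combination rl true rr) i with ∈-++⁻ (if rr then reverse R else R) i
      ... | inj₁ j = ∈-++⁺ʳ L (reverseIf-∈⁻ rr j)
      ... | inj₂ j = ∈-++⁺ˡ (reverseIf-∈⁻ rl j)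

      length-perform : ∀ c → length (perform c L R) ≡ s + t
      length-perform (combination rl false rr) =
        trans (List.length-++ (if rl then reverse L else L)) (cong₂ _+_ (length-reverseIf rl L)
            (length-reverseIf rr R))
      length-perform (combination rl true rr) =
        trans (List.length-++ (if rr then reverse R else R))
          (trans (cong₂ _+_ (length-reverseIf rr R) (length-reverseIf rl L)) (ℕ.+-comm t s))

      new-descending : pairs K⟨ f′ ⟩ (perform c′ L R) ≡ ι T ℚ.* (φ ℚ.+ φ)
      new-descending = trans
        (pairs-const K⟨ f′ ⟩ {R = flip Before} (perform c′ L R)
          (λ {x} {y} i j y<x → trans (K⟨⟩-descending f′ {x} {y} y<x)
            (cong₂ ℚ._+_ (f′-block (perform-∈ c′ i)) (f′-block (perform-∈ c′ j))))
          (subst (AllPairs (flip Before)) (sym rev) (allPairs-reverse asc)))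
        (cong (λ k → ι (k C 2) ℚ.* (φ ℚ.+ φ)) (length-perform c′))

      old : pairs K⟨ f ⟩ (L ++ R) ≡ ι a ℚ.* (fˡ ℚ.+ fˡ) ℚ.+ ι b ℚ.* (fˡ ℚ.+ fʳ)
          ℚ.+ ι e ℚ.* (fʳ ℚ.+ fʳ)
      old = pairs-perform (K⟨⟩-ascending f) c L R
        (λ {x} {y} i j x<y → trans (K⟨⟩-descending f x<y) (cong₂ ℚ._+_ (f-left j) (f-left i)))
        (λ {x} {y} i j y<x → trans (K⟨⟩-descending f y<x) (cong₂ ℚ._+_ (f-left i) (f-right j)))
        (λ {x} {y} i j x<y → trans (K⟨⟩-descending f x<y) (cong₂ ℚ._+_ (f-right j) (f-right i)))
        asc

      inner : γ ℚ.* (ι (cost c) ℚ.+ pairs K⟨ f′ ⟩ (perform c L R))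
              ℚ.+ δ ℚ.* (ι (cost c′) ℚ.+ pairs K⟨ f′ ⟩ (perform c′ L R))
              ℚ.≤ pairs K⟨ f ⟩ (L ++ R)
      inner = begin
        γ ℚ.* (ι (cost c) ℚ.+ pairs K⟨ f′ ⟩ (perform c L R))
            ℚ.+ δ ℚ.* (ι (cost c′) ℚ.+ pairs K⟨ f′ ⟩ (perform c′ L R))
          ≡⟨ cong₂ (λ x y → γ ℚ.* (ι (cost c) ℚ.+ x) ℚ.+ δ ℚ.* (ι (cost c′) ℚ.+ y)) new-ascending
              new-descending ⟩
        γ ℚ.* (ι (cost c) ℚ.+ 0ℚ) ℚ.+ δ ℚ.* (ι (cost c′) ℚ.+ ι T ℚ.* (φ ℚ.+ φ))
          ≡⟨ cong (λ x → γ ℚ.* x ℚ.+ δ ℚ.* (ι (cost c′) ℚ.+ ι T ℚ.* (φ ℚ.+ φ)))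
              (ℚ.+-identityʳ (ι (cost c))) ⟩
        γ ℚ.* ι (cost c) ℚ.+ δ ℚ.* (ι (cost c′) ℚ.+ ι T ℚ.* (φ ℚ.+ φ))
          -- With `cost c′` written as `γ * T` and `δ * T` as `cost c`, the contribution
          -- `δ * cost c′` becomes `γ * cost c`. The two targets thus contribute equally, which
          -- makes a payment of `γ + γ` per inverted pair.
          ≡⟨ cong (λ x → γ ℚ.* ι (cost c) ℚ.+ δ ℚ.* (x ℚ.+ ι T ℚ.* (φ ℚ.+ φ)))
              (÷-*-cancel (cost c′) T>0) ⟨
        γ ℚ.* ι (cost c) ℚ.+ δ ℚ.* (γ ℚ.* ι T ℚ.+ ι T ℚ.* (φ ℚ.+ φ))
          ≡⟨ solve 5 (λ g c d t p → g :* c :+ d :* (g :* t :+ t :* (p :+ p)) := g :* c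
              :+ (d :* t) :* (g :+ p :+ p)) refl γ (ι (cost c)) δ (ι T) φ ⟩
        γ ℚ.* ι (cost c) ℚ.+ (δ ℚ.* ι T) ℚ.* (γ ℚ.+ φ ℚ.+ φ)
          ≡⟨ cong (λ x → γ ℚ.* ι (cost c) ℚ.+ x ℚ.* (γ ℚ.+ φ ℚ.+ φ)) (÷-*-cancel (cost c) T>0) ⟩
        γ ℚ.* ι (cost c) ℚ.+ ι (cost c) ℚ.* (γ ℚ.+ φ ℚ.+ φ)
          ≡⟨ cong (λ x → γ ℚ.* x ℚ.+ x ℚ.* (γ ℚ.+ φ ℚ.+ φ)) (ι-+₃ a b e) ⟩
        γ ℚ.* (ι a ℚ.+ ι b ℚ.+ ι e) ℚ.+ (ι a ℚ.+ ι b ℚ.+ ι e) ℚ.* (γ ℚ.+ φ ℚ.+ φ)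
          ≡⟨ solve 5 (λ g p a b e → g :* (a :+ b :+ e) :+ (a :+ b :+ e) :* (g :+ p :+ p)
               := (a :* (p :+ g) :+ a :* (p :+ g)) :+ b :* ((p :+ g) :+ (p :+ g))
                   :+ (e :* (p :+ g) :+ e :* (p :+ g)))
               refl γ φ (ι a) (ι b) (ι e) ⟩
        (ι a ℚ.* (φ ℚ.+ γ) ℚ.+ ι a ℚ.* (φ ℚ.+ γ)) ℚ.+ ι b ℚ.* ((φ ℚ.+ γ) ℚ.+ (φ ℚ.+ γ))
          ℚ.+ (ι e ℚ.* (φ ℚ.+ γ) ℚ.+ ι e ℚ.* (φ ℚ.+ γ))
          ≤⟨ ℚ.+-mono-≤ (ℚ.+-mono-≤ (ℚ.+-mono-≤ left-bound left-bound) middle-bound)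
              (ℚ.+-mono-≤ right-bound right-bound) ⟩
        (ι a ℚ.* fˡ ℚ.+ ι a ℚ.* fˡ) ℚ.+ ι b ℚ.* (fˡ ℚ.+ fʳ) ℚ.+ (ι e ℚ.* fʳ ℚ.+ ι e ℚ.* fʳ)
          ≡⟨ cong₂ (λ x y → x ℚ.+ ι b ℚ.* (fˡ ℚ.+ fʳ) ℚ.+ y) (ℚ.*-distribˡ-+ (ι a) fˡ fˡ)
              (ℚ.*-distribˡ-+ (ι e) fʳ fʳ) ⟨
        ι a ℚ.* (fˡ ℚ.+ fˡ) ℚ.+ ι b ℚ.* (fˡ ℚ.+ fʳ) ℚ.+ ι e ℚ.* (fʳ ℚ.+ fʳ)
          ≡⟨ old ⟨
        pairs K⟨ f ⟩ (L ++ R) ∎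
        where open ℚ.≤-Reasoning

  module _ (M : List (Fin n)) (f′≤f : ∀ u → f′ u ℚ.≤ f u)
           (side : ∀ {m} → m ∈ M → (∀ {u} → u ∈ L ++ R → Before m u)
                                ⊎ (∀ {u} → u ∈ L ++ R → Before u m))
           (grow-left : φ ℚ.+ (α ℚ.+ α) ℚ.≤ fˡ) (grow-right : φ ℚ.+ (β ℚ.+ β) ℚ.≤ fʳ) where

    length-block : ι (length (L ++ R)) ≡ ι (s + t)
    length-block = cong ι (List.length-++ L)

    α-block : α ℚ.* ι (length (L ++ R)) ≡ ι t
    α-block = trans (cong (α ℚ.*_) length-block) (÷-*-cancel t s+t>0)

    β-block : β ℚ.* ι (length (L ++ R)) ≡ ι s
    β-block = trans (cong (β ℚ.*_) length-block) (÷-*-cancel s s+t>0)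

    ∑-zero : ∀ {h : Fin n → ℚ} xs → (∀ {x} → x ∈ xs → h x ≡ 0ℚ) → ∑ h xs ≡ 0ℚ
    ∑-zero xs eq = trans (∑-const xs eq) (ℚ.*-zeroʳ (ι (length xs)))

    -- Moving `L` leaves `m` to the left of both blocks, moving `R` to their right. If `ω` has `m`
    -- before the blocks, its pairs with `L` are inverted now and pay; otherwise those with `R` do.
    node-bound : ∀ {m} → m ∈ M →
      α ℚ.* (ι s ℚ.+ ∑ (K⟨ f′ ⟩ m) (L ++ R)) ℚ.+ β ℚ.* (ι t ℚ.+ ∑ (flip K⟨ f′ ⟩ m) (L ++ R))
      ℚ.≤ ∑ (flip K⟨ f ⟩ m) L ℚ.+ ∑ (K⟨ f ⟩ m) R
    node-bound {m} m∈M with side m∈M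
    ... | inj₁ m<u = begin
      α ℚ.* (ι s ℚ.+ ∑ (K⟨ f′ ⟩ m) (L ++ R)) ℚ.+ β ℚ.* (ι t ℚ.+ ∑ (flip K⟨ f′ ⟩ m) (L ++ R))
        ≡⟨ cong₂ (λ x y → α ℚ.* (ι s ℚ.+ x) ℚ.+ β ℚ.* (ι t ℚ.+ y))
             (∑-zero (L ++ R) (λ i → K⟨⟩-ascending f′ (m<u i)))
             (∑-const (L ++ R) (λ i → trans (K⟨⟩-descending f′ (m<u i))
                 (cong (ℚ._+ f′ m) (f′-block i)))) ⟩
      α ℚ.* (ι s ℚ.+ 0ℚ) ℚ.+ β ℚ.* (ι t ℚ.+ N ℚ.* (φ ℚ.+ f′ m))
        -- Substituting `t = α * N` and `β * N = s` turns the moving cost `α * s + β * t` into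
        -- `2 * α * s`, a payment of `α + α` for each of the `s` inverted pairs.
        ≡⟨ cong₂ (λ x y → α ℚ.* x ℚ.+ β ℚ.* (y ℚ.+ N ℚ.* (φ ℚ.+ f′ m))) (ℚ.+-identityʳ (ι s))
            (sym α-block) ⟩
      α ℚ.* ι s ℚ.+ β ℚ.* (α ℚ.* N ℚ.+ N ℚ.* (φ ℚ.+ f′ m))
        ≡⟨ solve 6 (λ a s b k p g → a :* s :+ b :* (a :* k :+ k :* (p :+ g)) := a :* s
            :+ (b :* k) :* (a :+ (p :+ g)))
             refl α (ι s) β N φ (f′ m) ⟩
      α ℚ.* ι s ℚ.+ (β ℚ.* N) ℚ.* (α ℚ.+ (φ ℚ.+ f′ m))
        ≡⟨ cong (λ x → α ℚ.* ι s ℚ.+ x ℚ.* (α ℚ.+ (φ ℚ.+ f′ m))) β-block ⟩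
      α ℚ.* ι s ℚ.+ ι s ℚ.* (α ℚ.+ (φ ℚ.+ f′ m))
        ≡⟨ solve 4 (λ a s p g → a :* s :+ s :* (a :+ (p :+ g)) := s :* ((p :+ (a :+ a)) :+ g))
            refl α (ι s) φ (f′ m) ⟩
      ι s ℚ.* ((φ ℚ.+ (α ℚ.+ α)) ℚ.+ f′ m)
        ≤⟨ *-mono (ι-nonNeg s) (ℚ.+-mono-≤ grow-left (f′≤f m)) ⟩
      ι s ℚ.* (fˡ ℚ.+ f m)
        ≡⟨ ℚ.+-identityʳ (ι s ℚ.* (fˡ ℚ.+ f m)) ⟨
      ι s ℚ.* (fˡ ℚ.+ f m) ℚ.+ 0ℚ
        ≡⟨ cong₂ ℚ._+_
             (∑-const L (λ i → trans (K⟨⟩-descending f (m<u (∈-++⁺ˡ i)))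
                 (cong (ℚ._+ f m) (f-left i))))
             (∑-zero R (λ i → K⟨⟩-ascending f (m<u (∈-++⁺ʳ L i)))) ⟨
      ∑ (flip K⟨ f ⟩ m) L ℚ.+ ∑ (K⟨ f ⟩ m) R ∎
      where
      open ℚ.≤-Reasoning
      N = ι (length (L ++ R))
    ... | inj₂ u<m = begin
      α ℚ.* (ι s ℚ.+ ∑ (K⟨ f′ ⟩ m) (L ++ R)) ℚ.+ β ℚ.* (ι t ℚ.+ ∑ (flip K⟨ f′ ⟩ m) (L ++ R))
        ≡⟨ cong₂ (λ x y → α ℚ.* (ι s ℚ.+ x) ℚ.+ β ℚ.* (ι t ℚ.+ y))
             (∑-const (L ++ R) (λ i → trans (K⟨⟩-descending f′ (u<m i))
                 (cong (f′ m ℚ.+_) (f′-block i))))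
             (∑-zero (L ++ R) (λ i → K⟨⟩-ascending f′ (u<m i))) ⟩
      α ℚ.* (ι s ℚ.+ N ℚ.* (f′ m ℚ.+ φ)) ℚ.+ β ℚ.* (ι t ℚ.+ 0ℚ)
        ≡⟨ cong₂ (λ x y → α ℚ.* (x ℚ.+ N ℚ.* (f′ m ℚ.+ φ)) ℚ.+ β ℚ.* y) (sym β-block)
            (ℚ.+-identityʳ (ι t)) ⟩
      α ℚ.* (β ℚ.* N ℚ.+ N ℚ.* (f′ m ℚ.+ φ)) ℚ.+ β ℚ.* ι t
        ≡⟨ solve 6 (λ a b k g p t → a :* (b :* k :+ k :* (g :+ p)) :+ b :* t
            := (a :* k) :* (b :+ (g :+ p)) :+ b :* t)
             refl α β N (f′ m) φ (ι t) ⟩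
      (α ℚ.* N) ℚ.* (β ℚ.+ (f′ m ℚ.+ φ)) ℚ.+ β ℚ.* ι t
        ≡⟨ cong (λ x → x ℚ.* (β ℚ.+ (f′ m ℚ.+ φ)) ℚ.+ β ℚ.* ι t) α-block ⟩
      ι t ℚ.* (β ℚ.+ (f′ m ℚ.+ φ)) ℚ.+ β ℚ.* ι t
        ≡⟨ solve 4 (λ b t p g → t :* (b :+ (g :+ p)) :+ b :* t := t :* (g :+ (p :+ (b :+ b))))
            refl β (ι t) φ (f′ m) ⟩
      ι t ℚ.* (f′ m ℚ.+ (φ ℚ.+ (β ℚ.+ β)))
        ≤⟨ *-mono (ι-nonNeg t) (ℚ.+-mono-≤ (f′≤f m) grow-right) ⟩
      ι t ℚ.* (f m ℚ.+ fʳ)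
        ≡⟨ ℚ.+-identityˡ (ι t ℚ.* (f m ℚ.+ fʳ)) ⟨
      0ℚ ℚ.+ ι t ℚ.* (f m ℚ.+ fʳ)
        ≡⟨ cong₂ ℚ._+_
             (∑-zero L (λ i → K⟨⟩-ascending f (u<m (∈-++⁺ˡ i))))
             (∑-const R (λ i → trans (K⟨⟩-descending f (u<m (∈-++⁺ʳ L i)))
                 (cong (f m ℚ.+_) (f-right i)))) ⟨
      ∑ (flip K⟨ f ⟩ m) L ℚ.+ ∑ (K⟨ f ⟩ m) R ∎
      where
      open ℚ.≤-Reasoning
      N = ι (length (L ++ R))

    -- A block of size `k` pays `k` for every node it passes, so the moving cost can be charged node
    -- by node.
    spread : ∀ k (h : Fin n → ℚ) p → p ℚ.* (ι (k * length M) ℚ.+ ∑ h M)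
        ≡ ∑ (λ m → p ℚ.* (ι k ℚ.+ h m)) M
    spread k h p = sym (begin
      ∑ (λ m → p ℚ.* (ι k ℚ.+ h m)) M     ≡⟨ ∑-* p (λ m → ι k ℚ.+ h m) M ⟩
      p ℚ.* ∑ (λ m → ι k ℚ.+ h m) M       ≡⟨ cong (p ℚ.*_) (∑-+ (λ _ → ι k) h M) ⟩
      p ℚ.* (∑ (λ _ → ι k) M ℚ.+ ∑ h M)   ≡⟨ cong (λ x → p ℚ.* (x ℚ.+ ∑ h M)) (begin
        ∑ (λ _ → ι k) M         ≡⟨ ∑-const M (λ _ → refl) ⟩
        ι (length M) ℚ.* ι k    ≡⟨ ι-* (length M) k ⟨
        ι (length M * k)        ≡⟨ cong ι (ℕ.*-comm (length M) k) ⟩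
        ι (k * length M)        ∎) ⟩
      p ℚ.* (ι (k * length M) ℚ.+ ∑ h M)  ∎)
      where open ≡-Reasoning

    between-bound : α ℚ.* (ι (s * length M) ℚ.+ cross K⟨ f′ ⟩ M (L ++ R))
                    ℚ.+ β ℚ.* (ι (t * length M) ℚ.+ cross K⟨ f′ ⟩ (L ++ R) M)
                    ℚ.≤ cross K⟨ f ⟩ L M ℚ.+ cross K⟨ f ⟩ M R
    between-bound = begin
      α ℚ.* (ι (s * length M) ℚ.+ cross K⟨ f′ ⟩ M (L ++ R))
          ℚ.+ β ℚ.* (ι (t * length M) ℚ.+ cross K⟨ f′ ⟩ (L ++ R) M)
        ≡⟨ cong (λ x → α ℚ.* (ι (s * length M) ℚ.+ cross K⟨ f′ ⟩ M (L ++ R))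
            ℚ.+ β ℚ.* (ι (t * length M) ℚ.+ x))
             (cross-flip K⟨ f′ ⟩ (L ++ R) M) ⟩
      α ℚ.* (ι (s * length M) ℚ.+ cross K⟨ f′ ⟩ M (L ++ R))
          ℚ.+ β ℚ.* (ι (t * length M) ℚ.+ cross (flip K⟨ f′ ⟩) M (L ++ R))
        ≡⟨ cong₂ ℚ._+_ (spread s (λ m → ∑ (K⟨ f′ ⟩ m) (L ++ R)) α)
            (spread t (λ m → ∑ (flip K⟨ f′ ⟩ m) (L ++ R)) β) ⟩
      ∑ toRight M ℚ.+ ∑ toLeft M
        ≡⟨ ∑-+ toRight toLeft M ⟨
      ∑ (λ m → toRight m ℚ.+ toLeft m) M
        ≤⟨ ∑-mono M node-bound ⟩
      ∑ (λ m → ∑ (flip K⟨ f ⟩ m) L ℚ.+ ∑ (K⟨ f ⟩ m) R) M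
        ≡⟨ ∑-+ (λ m → ∑ (flip K⟨ f ⟩ m) L) (λ m → ∑ (K⟨ f ⟩ m) R) M ⟩
      cross (flip K⟨ f ⟩) M L ℚ.+ cross K⟨ f ⟩ M R
        ≡⟨ cong (ℚ._+ cross K⟨ f ⟩ M R) (cross-flip K⟨ f ⟩ L M) ⟨
      cross K⟨ f ⟩ L M ℚ.+ cross K⟨ f ⟩ M R ∎
      where
      open ℚ.≤-Reasoning
      toRight toLeft : Fin n → ℚ
      toRight m = α ℚ.* (ι s ℚ.+ ∑ (K⟨ f′ ⟩ m) (L ++ R))
      toLeft  m = β ℚ.* (ι t ℚ.+ ∑ (flip K⟨ f′ ⟩ m) (L ++ R))

-- Two independent coins, with `a₁` and `a₂` depending only on the first, `b₁` and `b₂` only on the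
-- second, and `κ` on neither: the expectation separates because each coin has total mass 1. The
-- summands `0ℚ` are those left by `expect` on two-point distributions.
mix : ∀ {α β γ δ κ x₁₁ x₁₂ x₂₁ x₂₂ a₁ a₂ b₁ b₂} →
      0ℚ ℚ.≤ α → 0ℚ ℚ.≤ β → 0ℚ ℚ.≤ γ → 0ℚ ℚ.≤ δ → α ℚ.+ β ≡ 1ℚ → γ ℚ.+ δ ≡ 1ℚ →
      x₁₁ ℚ.≤ κ ℚ.+ (a₁ ℚ.+ b₁) → x₁₂ ℚ.≤ κ ℚ.+ (a₁ ℚ.+ b₂) →
      x₂₁ ℚ.≤ κ ℚ.+ (a₂ ℚ.+ b₁) → x₂₂ ℚ.≤ κ ℚ.+ (a₂ ℚ.+ b₂) →
      α ℚ.* (γ ℚ.* x₁₁ ℚ.+ (δ ℚ.* x₁₂ ℚ.+ 0ℚ)) ℚ.+ (β ℚ.* (γ ℚ.* x₂₁ ℚ.+ (δ ℚ.* x₂₂ ℚ.+ 0ℚ))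
          ℚ.+ 0ℚ)
      ℚ.≤ κ ℚ.+ ((α ℚ.* a₁ ℚ.+ β ℚ.* a₂) ℚ.+ (γ ℚ.* b₁ ℚ.+ δ ℚ.* b₂))
mix {α} {β} {γ} {δ} {κ} {x₁₁} {x₁₂} {x₂₁} {x₂₂} {a₁} {a₂} {b₁} {b₂}
    α≥0 β≥0 γ≥0 δ≥0 α+β γ+δ h₁₁ h₁₂ h₂₁ h₂₂ = begin
  α ℚ.* (γ ℚ.* x₁₁ ℚ.+ (δ ℚ.* x₁₂ ℚ.+ 0ℚ)) ℚ.+ (β ℚ.* (γ ℚ.* x₂₁ ℚ.+ (δ ℚ.* x₂₂ ℚ.+ 0ℚ)) ℚ.+ 0ℚ)
    ≤⟨ average α≥0 β≥0 (average γ≥0 δ≥0 h₁₁ h₁₂) (average γ≥0 δ≥0 h₂₁ h₂₂) ⟩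
  α ℚ.* (γ ℚ.* (κ ℚ.+ (a₁ ℚ.+ b₁)) ℚ.+ (δ ℚ.* (κ ℚ.+ (a₁ ℚ.+ b₂)) ℚ.+ 0ℚ))
    ℚ.+ (β ℚ.* (γ ℚ.* (κ ℚ.+ (a₂ ℚ.+ b₁)) ℚ.+ (δ ℚ.* (κ ℚ.+ (a₂ ℚ.+ b₂)) ℚ.+ 0ℚ)) ℚ.+ 0ℚ)
    ≡⟨ solve 9 (λ α β γ δ κ a₁ a₂ b₁ b₂ →
         α :* (γ :* (κ :+ (a₁ :+ b₁)) :+ (δ :* (κ :+ (a₁ :+ b₂)) :+ con 0ℚ))
           :+ (β :* (γ :* (κ :+ (a₂ :+ b₁)) :+ (δ :* (κ :+ (a₂ :+ b₂)) :+ con 0ℚ)) :+ con 0ℚ)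
         := ((α :+ β) :* (γ :+ δ)) :* κ :+ ((γ :+ δ) :* (α :* a₁ :+ β :* a₂)
             :+ (α :+ β) :* (γ :* b₁ :+ δ :* b₂)))
         refl α β γ δ κ a₁ a₂ b₁ b₂ ⟩
  ((α ℚ.+ β) ℚ.* (γ ℚ.+ δ)) ℚ.* κ ℚ.+ ((γ ℚ.+ δ) ℚ.* (α ℚ.* a₁ ℚ.+ β ℚ.* a₂)
      ℚ.+ (α ℚ.+ β) ℚ.* (γ ℚ.* b₁ ℚ.+ δ ℚ.* b₂))
    ≡⟨ cong₂ (λ x y → (x ℚ.* y) ℚ.* κ ℚ.+ (y ℚ.* (α ℚ.* a₁ ℚ.+ β ℚ.* a₂)
        ℚ.+ x ℚ.* (γ ℚ.* b₁ ℚ.+ δ ℚ.* b₂))) α+β γ+δ ⟩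
  (1ℚ ℚ.* 1ℚ) ℚ.* κ ℚ.+ (1ℚ ℚ.* (α ℚ.* a₁ ℚ.+ β ℚ.* a₂) ℚ.+ 1ℚ ℚ.* (γ ℚ.* b₁ ℚ.+ δ ℚ.* b₂))
    ≡⟨ cong₂ ℚ._+_ (ℚ.*-identityˡ κ) (cong₂ ℚ._+_ (ℚ.*-identityˡ (α ℚ.* a₁ ℚ.+ β ℚ.* a₂))
        (ℚ.*-identityˡ (γ ℚ.* b₁ ℚ.+ δ ℚ.* b₂))) ⟩
  κ ℚ.+ ((α ℚ.* a₁ ℚ.+ β ℚ.* a₂) ℚ.+ (γ ℚ.* b₁ ℚ.+ δ ℚ.* b₂)) ∎
  where
  open ℚ.≤-Reasoning
  average : ∀ {p q x x′ y y′} → 0ℚ ℚ.≤ p → 0ℚ ℚ.≤ q → x ℚ.≤ x′ → y ℚ.≤ y′ →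
            p ℚ.* x ℚ.+ (q ℚ.* y ℚ.+ 0ℚ) ℚ.≤ p ℚ.* x′ ℚ.+ (q ℚ.* y′ ℚ.+ 0ℚ)
  average p≥0 q≥0 hx hy = ℚ.+-mono-≤ (*-mono p≥0 hx) (ℚ.+-monoˡ-≤ 0ℚ (*-mono q≥0 hy))

module Step {G : Graph n} {e path π l r} (merge : Merge G e path π l r) (ω : Arrangement n)
            (f f′ : Fin n → ℚ) {φ fˡ fʳ : ℚ} (f′≤f : ∀ u → f′ u ℚ.≤ f u)
            (f-left : ∀ {u} → u ∈ Merge.left merge → f u ≡ fˡ)
            (f-right : ∀ {u} → u ∈ Merge.right merge → f u ≡ fʳ)
            (f′-block : ∀ {u} → u ∈ IsPath.nodes path → f′ u ≡ φ)
            (ordered : Infix (IsPath.nodes path) (word ω) ⊎ Infix (reverse (IsPath.nodes path))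
                (word ω))
            where
  open Merge merge
  open Kernel ω

  unique-split : Unique (before ++ left ++ between ++ right ++ after)
  unique-split = subst Unique split (word-unique π)

  unique-rest : Unique (left ++ between ++ right ++ after)
  unique-rest = allPairs-++⁻ʳ before unique-split

  shuffle : left ++ between ++ right ++ after ↭ (left ++ right) ++ between ++ after
  shuffle = ↭-trans (++⁺ˡ left (shifts between right))
      (↭-sym (↭-reflexive (List.++-assoc left right (between ++ after))))

  unique-shuffled : Unique ((left ++ right) ++ between ++ after)
  unique-shuffled = unique-↭ shuffle unique-rest

  unique-block : Unique (left ++ right)
  unique-block = allPairs-++⁻ˡ (left ++ right) unique-shuffled

  block⊆nodes : ∀ {u} → u ∈ left ++ right → u ∈ nodes
  block⊆nodes i = [ left⊆nodes , right⊆nodes ]′ (∈-++⁻ left i)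

  nodes⊆block : ∀ {u} → u ∈ nodes → u ∈ left ++ right
  nodes⊆block i = ∈-resp-↭ (perform-↭ c₁ left right) (subst (_ ∈_) (sym perform-c₁) i)

  between∉nodes : ∀ {m} → m ∈ between → m ∉ nodes
  between∉nodes m∈ m∈nodes = unique-disjoint (left ++ right) unique-shuffled (nodes⊆block m∈nodes)
      (∈-++⁺ˡ m∈)

  side : ∀ {m} → m ∈ between → (∀ {u} → u ∈ left ++ right → Before m u)
      ⊎ (∀ {u} → u ∈ left ++ right → Before u m)
  side {m} m∈ = Sum.map (λ h i → h (block⊆nodes i)) (λ h i → h (block⊆nodes i))
      (nodes-side ordered)
    where
    nodes-side : Infix nodes (word ω) ⊎ Infix (reverse nodes) (word ω) →
                 (∀ {u} → u ∈ nodes → Before m u) ⊎ (∀ {u} → u ∈ nodes → Before u m)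
    nodes-side (inj₁ i) = before-outside i (between∉nodes m∈)
    nodes-side (inj₂ i) = Sum.map (λ h j → h (∈-resp-↭ (↭-sym (↭-reverse nodes)) j))
                                  (λ h j → h (∈-resp-↭ (↭-sym (↭-reverse nodes)) j))
      (before-outside i (between∉nodes m∈ ∘ ∈-resp-↭ (↭-reverse nodes)))

  module B = Blocks ω f f′ left right {φ} {fˡ} {fʳ} (∈⇒0<length l∈left) (∈⇒0<length r∈right)
                   unique-block f-left f-right (f′-block ∘ block⊆nodes)
  open B using (α; β; T)

  module _ (grow-left : φ ℚ.+ (α ℚ.+ α) ℚ.≤ fˡ) (grow-right : φ ℚ.+ (β ℚ.+ β) ℚ.≤ fʳ) where

    γ δ : ℚ
    γ = cost c₂ ÷ T
    δ = cost c₁ ÷ T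

    block-after : Combination → ℚ
    block-after c = ι (cost c) ℚ.+ pairs K⟨ f′ ⟩ (perform c left right)

    -- Whichever of `c₁` and `c₂` agrees with `ω` takes the part of `c` in `Blocks`; the expectation
    -- is symmetric in the two.
    rearranging-bound : (γ ℚ.+ δ ≡ 1ℚ) ×
      (γ ℚ.* block-after c₁ ℚ.+ δ ℚ.* block-after c₂ ℚ.≤ pairs K⟨ f ⟩ (left ++ right))
    rearranging-bound = [ ascending , descending ]′ ordered
      where
      Bounds = (γ ℚ.+ δ ≡ 1ℚ) ×
        (γ ℚ.* block-after c₁ ℚ.+ δ ℚ.* block-after c₂ ℚ.≤ pairs K⟨ f ⟩ (left ++ right))
      ascending : Infix nodes (word ω) → Bounds
      ascending i = B.γ+δ c₁ c₂ asc rev , B.inner c₁ c₂ asc rev grow-left grow-right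
        where
        asc : AllPairs Before (perform c₁ left right)
        asc = subst (AllPairs Before) (sym perform-c₁) (before-infix i)
        rev : perform c₂ left right ≡ reverse (perform c₁ left right)
        rev = trans perform-c₂ (cong reverse (sym perform-c₁))
      descending : Infix (reverse nodes) (word ω) → Bounds
      descending i = trans (ℚ.+-comm γ δ) (B.γ+δ c₂ c₁ asc rev) ,
                   ℚ.≤-trans (ℚ.≤-reflexive (ℚ.+-comm (γ ℚ.* block-after c₁)
                       (δ ℚ.* block-after c₂)))
                     (B.inner c₂ c₁ asc rev grow-left grow-right)
        where
        asc : AllPairs Before (perform c₂ left right)
        asc = subst (AllPairs Before) (sym perform-c₂) (before-infix i)
        rev : perform c₁ left right ≡ reverse (perform c₂ left right)
        rev = trans perform-c₁
          (sym (trans (cong reverse perform-c₂) (List.reverse-involutive nodes)))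

    -- What depends on the first coin only, as `block-after` does on the second: `cross` ignores the
    -- order inside the merged block.
    moving-after : Moved → ℚ
    moving-after leftBlock  = ι (movingCost leftBlock)  ℚ.+ cross K⟨ f′ ⟩ between (left ++ right)
    moving-after rightBlock = ι (movingCost rightBlock) ℚ.+ cross K⟨ f′ ⟩ (left ++ right) between

    -- The pairs whose order is the same before the update and in all four outcomes; their potential
    -- can only fall with the credits.
    rest : (Fin n → ℚ) → ℚ
    rest g = outer K⟨ g ⟩ before (left ++ between ++ right) after ℚ.+ pairs K⟨ g ⟩ between

    rest-mono : rest f′ ℚ.≤ rest f
    rest-mono = ℚ.+-mono-≤ (outer-mono (K⟨⟩-mono f′≤f) before (left ++ between ++ right) after)
                           (pairs-mono (K⟨⟩-mono f′≤f) between)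

    middle : Moved → Combination → List (Fin n)
    middle leftBlock  c = between ++ perform c left right
    middle rightBlock c = perform c left right ++ between

    resultWord-middle : ∀ m c → resultWord m c ≡ before ++ middle m c ++ after
    resultWord-middle leftBlock  c =
        cong (before ++_) (sym (List.++-assoc between (perform c left right) after))
    resultWord-middle rightBlock c =
        cong (before ++_) (sym (List.++-assoc (perform c left right) between after))

    middle-↭ : ∀ m c → middle m c ↭ left ++ between ++ right
    middle-↭ leftBlock  c = ↭-trans (++⁺ˡ between (perform-↭ c left right)) (shifts between left)
    middle-↭ rightBlock c = ↭-trans (++-comm (perform c left right) between)
        (middle-↭ leftBlock c)

    pairs-middle : ∀ m c → ι (movingCost m + cost c) ℚ.+ pairs K⟨ f′ ⟩ (middle m c)
                           ≡ pairs K⟨ f′ ⟩ between ℚ.+ (moving-after m ℚ.+ block-after c)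
    pairs-middle leftBlock c = trans (cong₂ ℚ._+_ (ι-+ (movingCost leftBlock) (cost c))
        (trans (pairs-++ K⟨ f′ ⟩ between (perform c left right))
          (cong (λ x → pairs K⟨ f′ ⟩ between ℚ.+ x ℚ.+ pairs K⟨ f′ ⟩ (perform c left right))
            (cross-↭ʳ K⟨ f′ ⟩ between (perform-↭ c left right)))))
      (solve 5 (λ i j b x p → (i :+ j) :+ ((b :+ x) :+ p) := b :+ ((i :+ x) :+ (j :+ p))) refl
        (ι (movingCost leftBlock)) (ι (cost c)) (pairs K⟨ f′ ⟩ between)
        (cross K⟨ f′ ⟩ between (left ++ right)) (pairs K⟨ f′ ⟩ (perform c left right)))
    pairs-middle rightBlock c = trans (cong₂ ℚ._+_ (ι-+ (movingCost rightBlock) (cost c))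
        (trans (pairs-++ K⟨ f′ ⟩ (perform c left right) between)
          (cong (λ x → pairs K⟨ f′ ⟩ (perform c left right) ℚ.+ x ℚ.+ pairs K⟨ f′ ⟩ between)
            (cross-↭ˡ K⟨ f′ ⟩ between (perform-↭ c left right)))))
      (solve 5 (λ i j b x p → (i :+ j) :+ ((p :+ x) :+ b) := b :+ ((i :+ x) :+ (j :+ p))) refl
        (ι (movingCost rightBlock)) (ι (cost c)) (pairs K⟨ f′ ⟩ between)
        (cross K⟨ f′ ⟩ (left ++ right) between) (pairs K⟨ f′ ⟩ (perform c left right)))

    outcome : ∀ m c → ι (movingCost m + cost c) ℚ.+ pairs K⟨ f′ ⟩ (resultWord m c)
                      ≡ rest f′ ℚ.+ (moving-after m ℚ.+ block-after c)
    outcome m c = begin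
      ι k ℚ.+ pairs K⟨ f′ ⟩ (resultWord m c)
        ≡⟨ cong (λ w → ι k ℚ.+ pairs K⟨ f′ ⟩ w) (resultWord-middle m c) ⟩
      ι k ℚ.+ pairs K⟨ f′ ⟩ (before ++ middle m c ++ after)
        ≡⟨ cong (ι k ℚ.+_) (pairs-outer K⟨ f′ ⟩ before (middle m c) after) ⟩
      ι k ℚ.+ (outer K⟨ f′ ⟩ before (middle m c) after ℚ.+ pairs K⟨ f′ ⟩ (middle m c))
        ≡⟨ cong (λ x → ι k ℚ.+ (x ℚ.+ pairs K⟨ f′ ⟩ (middle m c)))
            (outer-↭ K⟨ f′ ⟩ before after (middle-↭ m c)) ⟩
      ι k ℚ.+ (o ℚ.+ pairs K⟨ f′ ⟩ (middle m c))
        ≡⟨ solve 3 (λ k o p → k :+ (o :+ p) := o :+ (k :+ p)) refl (ι k) o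
            (pairs K⟨ f′ ⟩ (middle m c)) ⟩
      o ℚ.+ (ι k ℚ.+ pairs K⟨ f′ ⟩ (middle m c))
        ≡⟨ cong (o ℚ.+_) (pairs-middle m c) ⟩
      o ℚ.+ (pairs K⟨ f′ ⟩ between ℚ.+ (moving-after m ℚ.+ block-after c))
        ≡⟨ ℚ.+-assoc o (pairs K⟨ f′ ⟩ between) (moving-after m ℚ.+ block-after c) ⟨
      rest f′ ℚ.+ (moving-after m ℚ.+ block-after c) ∎
      where
      open ≡-Reasoning
      k = movingCost m + cost c
      o = outer K⟨ f′ ⟩ before (left ++ between ++ right) after

    potential : pairs K⟨ f ⟩ (word π) ≡
      rest f ℚ.+ ((cross K⟨ f ⟩ left between ℚ.+ cross K⟨ f ⟩ between right) ℚ.+ pairs K⟨ f ⟩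
          (left ++ right))
    potential = begin
      pairs V (word π)
        ≡⟨ cong (pairs V) (trans split (cong (before ++_) (sym regroup))) ⟩
      pairs V (before ++ (left ++ between ++ right) ++ after)
        ≡⟨ pairs-outer V before (left ++ between ++ right) after ⟩
      o ℚ.+ pairs V (left ++ between ++ right)
        ≡⟨ cong (o ℚ.+_) (pairs-++ V left (between ++ right)) ⟩
      o ℚ.+ (pairs V left ℚ.+ cross V left (between ++ right) ℚ.+ pairs V (between ++ right))
        ≡⟨ cong₂ (λ x y → o ℚ.+ (pairs V left ℚ.+ x ℚ.+ y)) (cross-++ʳ V left between right)
            (pairs-++ V between right) ⟩
      o ℚ.+ (pairs V left ℚ.+ (cross V left between ℚ.+ cross V left right)
          ℚ.+ (pairs V between ℚ.+ cross V between right ℚ.+ pairs V right))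
        ≡⟨ solve 7 (λ o l x y b z r → o :+ ((l :+ (x :+ y)) :+ ((b :+ z) :+ r))
            := (o :+ b) :+ ((x :+ z) :+ ((l :+ y) :+ r)))
             refl o (pairs V left) (cross V left between) (cross V left right) (pairs V between)
                 (cross V between right) (pairs V right) ⟩
      rest f ℚ.+ ((cross V left between ℚ.+ cross V between right)
          ℚ.+ (pairs V left ℚ.+ cross V left right ℚ.+ pairs V right))
        ≡⟨ cong (λ x → rest f ℚ.+ ((cross V left between ℚ.+ cross V between right) ℚ.+ x))
            (pairs-++ V left right) ⟨
      rest f ℚ.+ ((cross V left between ℚ.+ cross V between right) ℚ.+ pairs V (left ++ right)) ∎
      where
      open ≡-Reasoning
      V = K⟨ f ⟩
      o = outer V before (left ++ between ++ right) after
      regroup : (left ++ between ++ right) ++ after ≡ left ++ between ++ right ++ after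
      regroup = trans (List.++-assoc left (between ++ right) after)
          (cong (left ++_) (List.++-assoc between right after))

    expect-update : (g : Arrangement n × ℕ → ℚ) → expect g (update nodes) ≡
      α ℚ.* (γ ℚ.* g (result leftBlock c₁ , movingCost leftBlock + cost c₁)
             ℚ.+ (δ ℚ.* g (result leftBlock c₂ , movingCost leftBlock + cost c₂) ℚ.+ 0ℚ))
      ℚ.+ (β ℚ.* (γ ℚ.* g (result rightBlock c₁ , movingCost rightBlock + cost c₁)
                  ℚ.+ (δ ℚ.* g (result rightBlock c₂ , movingCost rightBlock + cost c₂) ℚ.+ 0ℚ))
                      ℚ.+ 0ℚ)
    expect-update g = trans (expect->>= g moving afterMoving) (expect-cong moving λ m →
      trans (expect->>= g (rearranging nodes) (afterBoth m))
          (expect-cong (rearranging nodes) λ c →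
        expect-return g (result m c , movingCost m + cost c)))
      where
      afterBoth : Moved → Combination → Dist (Arrangement n × ℕ)
      afterBoth m c = return (result m c , movingCost m + cost c)
      afterMoving : Moved → Dist (Arrangement n × ℕ)
      afterMoving m = rearranging nodes >>= afterBoth m

    -- In the induction over the revealed graphs, `g` is the expected total cost given the outcome
    -- of this update and `κ` is the cost paid before it. The bound on `g` is asked only for
    -- outcomes that reach a target, since these are tight again.
    step : (g : Arrangement n × ℕ → ℚ) (κ : ℚ) →
           (∀ m c → Reached c → g (result m c , movingCost m + cost c)
              ℚ.≤ κ ℚ.+ (ι (movingCost m + cost c) ℚ.+ pairs K⟨ f′ ⟩ (resultWord m c))) →
           expect g (update nodes) ℚ.≤ κ ℚ.+ pairs K⟨ f ⟩ (word π)
    step g κ bound = begin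
      expect g (update nodes)
        ≡⟨ expect-update g ⟩
      _ ≤⟨ mix {α} {β} {γ} {δ} {κ ℚ.+ rest f′}
             {a₁ = moving-after leftBlock} {moving-after rightBlock} {block-after c₁}
                 {block-after c₂}
             (÷-nonNeg (length right) (length left + length right))
                 (÷-nonNeg (length left) (length left + length right)) (÷-nonNeg (cost c₂) T)
                 (÷-nonNeg (cost c₁) T)
             B.α+β (proj₁ rearranging-bound)
             (bound′ leftBlock c₁ (inj₁ perform-c₁)) (bound′ leftBlock c₂ (inj₂ perform-c₂))
             (bound′ rightBlock c₁ (inj₁ perform-c₁)) (bound′ rightBlock c₂ (inj₂ perform-c₂)) ⟩
      (κ ℚ.+ rest f′) ℚ.+ ((α ℚ.* moving-after leftBlock ℚ.+ β ℚ.* moving-after rightBlock)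
                           ℚ.+ (γ ℚ.* block-after c₁ ℚ.+ δ ℚ.* block-after c₂))
        ≤⟨ ℚ.+-mono-≤ (ℚ.+-monoʳ-≤ κ rest-mono) (ℚ.+-mono-≤
             (B.between-bound between f′≤f side grow-left grow-right) (proj₂ rearranging-bound)) ⟩
      (κ ℚ.+ rest f) ℚ.+ total
        ≡⟨ ℚ.+-assoc κ (rest f) total ⟩
      κ ℚ.+ (rest f ℚ.+ total)
        ≡⟨ cong (κ ℚ.+_) potential ⟨
      κ ℚ.+ pairs K⟨ f ⟩ (word π) ∎
      where
      open ℚ.≤-Reasoning
      total = (cross K⟨ f ⟩ left between ℚ.+ cross K⟨ f ⟩ between right) ℚ.+ pairs K⟨ f ⟩
          (left ++ right)
      bound′ : ∀ m c → Reached c → g (result m c , movingCost m + cost c)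
               ℚ.≤ (κ ℚ.+ rest f′) ℚ.+ (moving-after m ℚ.+ block-after c)
      bound′ m c reached = ℚ.≤-trans (bound m c reached) (ℚ.≤-reflexive
        (trans (cong (κ ℚ.+_) (outcome m c))
            (sym (ℚ.+-assoc κ (rest f′) (moving-after m ℚ.+ block-after c)))))

-- The potential

size : Graph n → Fin n → ℕ
size {n} G u = length (filter (connected? G u) (allFin n))

-- Two lists without repetitions that have the same members are permutations of each other.
size-nodes : ∀ {G : Graph n} {u p} → Unique p → (∀ {y} → y ∈ p → Connected G u y) →
             (∀ {y} → Connected G u y → y ∈ p) → size G u ≡ length p
size-nodes {n} {G} {u} uq sound full = ↭-length (∼bag⇒↭ (unique∧set⇒bag
  (Unique.filter⁺ (connected? G u) (Unique.allFin⁺ n)) uq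
  (mk⇔ (full ∘ proj₂ ∘ ∈-filter⁻ (connected? G u) {xs = allFin n})
       (∈-filter⁺ (connected? G u) (∈-allFin _) ∘ sound))))

size-≤ : ∀ (G : Graph n) u → size G u ≤ n
size-≤ {n} G u = ℕ.≤-trans (List.length-filter (connected? G u) (allFin n))
  (ℕ.≤-reflexive (List.length-tabulate (λ i → i)))

size-positive : ∀ (G : Graph n) u → 0 < size G u
size-positive {n} G u = ∈⇒0<length (∈-filter⁺ (connected? G u) (∈-allFin u) ε)

length-filter-mono : ∀ {P Q : A → Set} (P? : Decidable P) (Q? : Decidable Q) →
                     (∀ {x} → P x → Q x) → ∀ xs → length (filter P? xs) ≤ length (filter Q? xs)
length-filter-mono P? Q? P⊆Q []       = z≤n
length-filter-mono P? Q? P⊆Q (x ∷ xs) with P? x | Q? x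
... | yes _  | yes _  = s≤s (length-filter-mono P? Q? P⊆Q xs)
... | yes px | no ¬qx = ⊥-elim (¬qx (P⊆Q px))
... | no _   | yes _  = ℕ.m≤n⇒m≤1+n (length-filter-mono P? Q? P⊆Q xs)
... | no _   | no _   = length-filter-mono P? Q? P⊆Q xs

size-grows : ∀ (G : Graph n) e u → size G u ≤ size (e ∷ G) u
size-grows {n} G e u = length-filter-mono (connected? G u) (connected? (e ∷ G) u) weaken
    (allFin n)

recipSum-nonNeg : ∀ a k → 0ℚ ℚ.≤ recipSum a k
recipSum-nonNeg a zero    = ℚ.≤-refl
recipSum-nonNeg a (suc k) = ℚ.+-mono-≤ (recipSum-nonNeg a k) (recip-nonNeg (a + k))

-- 2 (Hₙ − Hₐ), with harmonic numbers H.
credit : ℕ → ℕ → ℚ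
credit n a = recipSum a (n ∸ a) ℚ.+ recipSum a (n ∸ a)

credit-nonNeg : ∀ n a → 0ℚ ℚ.≤ credit n a
credit-nonNeg n a = ℚ.+-mono-≤ (recipSum-nonNeg a (n ∸ a)) (recipSum-nonNeg a (n ∸ a))

-- The sum has `b` terms, the smallest of which is 1/(a+b).
÷-≤-recipSum : ∀ a {b} → 0 < b → b ÷ (a + b) ℚ.≤ recipSum a b
÷-≤-recipSum a {b@(suc k)} _ = begin
  b ÷ (a + suc k)          ≡⟨ cong (b ÷_) (ℕ.+-suc a k) ⟩
  b ÷ suc (a + k)          ≡⟨ times-recip b (a + k) ⟨
  b times 1/suc (a + k)    ≤⟨ sum-≥ a k b ℕ.≤-refl ⟩
  recipSum a b             ∎
  where open ℚ.≤-Reasoning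

-- With the sizes of the two blocks as `a` and `b`, in either order, this is the drop in credit
-- required by `grow-left` and `grow-right`. The difference of the credits is twice the harmonic sum
-- from 1/(a+1) to 1/(a+b).
grow : ∀ {n} a {b} → 0 < b → a + b ≤ n →
       credit n (a + b) ℚ.+ ((b ÷ (a + b)) ℚ.+ (b ÷ (a + b))) ℚ.≤ credit n a
grow {n} a {b} b>0 le = begin
  (h ℚ.+ h) ℚ.+ (x ℚ.+ x)          ≡⟨ interchange h h x x ⟩
  (h ℚ.+ x) ℚ.+ (h ℚ.+ x)          ≤⟨ ℚ.+-mono-≤ half half ⟩
  credit n a                       ∎
  where
  open ℚ.≤-Reasoning
  h x : ℚ
  h = recipSum (a + b) (n ∸ (a + b))
  x = b ÷ (a + b)
  eq : b + (n ∸ (a + b)) ≡ n ∸ a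
  eq = trans (cong (λ t → b + t) (sym (ℕ.∸-+-assoc n a b)))
    (ℕ.m+[n∸m]≡n (ℕ.m+n≤o⇒m≤o∸n b (subst (_≤ n) (ℕ.+-comm a b) le)))
  half : h ℚ.+ x ℚ.≤ recipSum a (n ∸ a)
  half = begin
    h ℚ.+ x                            ≤⟨ ℚ.+-monoʳ-≤ h (÷-≤-recipSum a b>0) ⟩
    h ℚ.+ recipSum a b                 ≡⟨ ℚ.+-comm h (recipSum a b) ⟩
    recipSum a b ℚ.+ h                 ≡⟨ sum-+ a b (n ∸ (a + b)) ⟨
    recipSum a (b + (n ∸ (a + b)))     ≡⟨ cong (recipSum a) eq ⟩
    recipSum a (n ∸ a)                 ∎

credit-anti : ∀ {n a a′} → a ≤ a′ → a′ ≤ n → credit n a′ ℚ.≤ credit n a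
credit-anti {n} {a} {a′} a≤a′ a′≤n with ℕ.m≤n⇒m<n∨m≡n a≤a′
... | inj₂ refl = ℚ.≤-refl
... | inj₁ a<a′ = begin
  credit n a′                       ≡⟨ cong (credit n) eq ⟨
  credit n (a + b)                  ≡⟨ ℚ.+-identityʳ (credit n (a + b)) ⟨
  credit n (a + b) ℚ.+ 0ℚ
    ≤⟨ ℚ.+-monoʳ-≤ (credit n (a + b)) (ℚ.+-mono-≤ (÷-nonNeg b (a + b)) (÷-nonNeg b (a + b))) ⟩
  credit n (a + b) ℚ.+ ((b ÷ (a + b)) ℚ.+ (b ÷ (a + b)))
                                    ≤⟨ grow a (ℕ.m<n⇒0<n∸m a<a′) (subst (_≤ n) (sym eq) a′≤n) ⟩
  credit n a                        ∎
  where
  open ℚ.≤-Reasoning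
  b = a′ ∸ a
  eq : a + b ≡ a′
  eq = ℕ.m+[n∸m]≡n a≤a′

weight : Graph n → Fin n → ℚ
weight {n} G u = credit n (size G u)

weight-grows : ∀ (G : Graph n) e u → weight (e ∷ G) u ℚ.≤ weight G u
weight-grows G e u = credit-anti (size-grows G e u) (size-≤ (e ∷ G) u)

module MergeStep {G : Graph n} {e path π l r} (merge : Merge G e path π l r) (ω : Arrangement n)
                 (tight-ω : Tight (e ∷ G) ω) where
  open Merge merge
  open Kernel ω

  unique-oriented : ∀ {L p : List (Fin n)} → Oriented L p → Unique p → Unique L
  unique-oriented (inj₁ refl) uq = uq
  unique-oriented (inj₂ refl) uq = unique-reverse uq

  size-oriented : ∀ {L u v p} → Block G v p → Oriented L p → u ∈ L → size G u ≡ length L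
  size-oriented b o u∈L = size-nodes (unique-oriented o (unique b))
    (λ y∈L → connected-sym v~u ◅◅ connected b (oriented-∈⁻ o y∈L))
    (λ u~y → oriented-∈ o (member b (v~u ◅◅ u~y)))
    where v~u = connected b (oriented-∈⁻ o u∈L)

  size-merged : ∀ {u} → u ∈ nodes → size (e ∷ G) u ≡ length nodes
  size-merged u∈ = size-nodes distinct
    (λ {y} y∈ → connected-sym x~u ◅◅ Equivalence.to (component y) y∈)
    (λ {y} u~y → Equivalence.from (component y) (x~u ◅◅ u~y))
    where x~u = Equivalence.to (component _) u∈

  length-nodes : length nodes ≡ length left + length right
  length-nodes = trans (cong length (sym perform-c₁))
    (trans (↭-length (perform-↭ c₁ left right)) (List.length-++ left))

  sizes-≤ : length left + length right ≤ n
  sizes-≤ = subst (_≤ n) (trans (size-merged (left⊆nodes l∈left)) length-nodes) (size-≤ (e ∷ G) l)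

  -- Already at this update `ω` keeps all edges of the new path between neighbours, although it is
  -- the arrangement of a later graph.
  ordered : Infix nodes (word ω) ⊎ Infix (reverse nodes) (word ω)
  ordered = contiguous (word-unique ω) distinct (left⊆nodes l∈left) (∈-word ω)
    (λ c → tight-adjacent {π = ω} tight-ω
      (Equivalence.from (edges _ _ (consecutive-∈ˡ c) (consecutive-∈ʳ c)) (fwd c)))

  merge-step : (g : Arrangement n × ℕ → ℚ) (κ : ℚ) →
    (∀ m c → Reached c → g (result m c , movingCost m + cost c)
       ℚ.≤ κ ℚ.+ (ι (movingCost m + cost c) ℚ.+ pairs K⟨ weight (e ∷ G) ⟩ (resultWord m c))) →
    expect g (update nodes) ℚ.≤ κ ℚ.+ pairs K⟨ weight G ⟩ (word π)
  merge-step = Step.step merge ω (weight G) (weight (e ∷ G))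
    {credit n (length left + length right)} {credit n (length left)} {credit n (length right)}
    (weight-grows G e)
    (λ u∈ → cong (credit n) (size-oriented blockˡ orientedˡ u∈))
    (λ u∈ → cong (credit n) (size-oriented blockʳ orientedʳ u∈))
    (λ u∈ → cong (credit n) (trans (size-merged u∈) length-nodes))
    ordered
    (grow (length left) (∈⇒0<length r∈right) sizes-≤)
    (subst (λ m → credit n m ℚ.+ ((length left ÷ m) ℚ.+ (length left ÷ m))
               ℚ.≤ credit n (length right))
      (ℕ.+-comm (length right) (length left))
      (grow (length right) (∈⇒0<length l∈left)
          (subst (_≤ n) (ℕ.+-comm (length left) (length right)) sizes-≤)))

-- The expected cost of Rand

pairs-nonNeg : ∀ {W : A → A → ℚ} → (∀ x y → 0ℚ ℚ.≤ W x y) → ∀ xs → 0ℚ ℚ.≤ pairs W xs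
pairs-nonNeg nn []       = ℚ.≤-refl
pairs-nonNeg {W = W} nn (x ∷ xs) = ℚ.+-mono-≤ (sum-nonNeg xs) (pairs-nonNeg nn xs)
  where
  sum-nonNeg : ∀ ys → 0ℚ ℚ.≤ ∑ (W x) ys
  sum-nonNeg []       = ℚ.≤-refl
  sum-nonNeg (y ∷ ys) = ℚ.+-mono-≤ (nn x y) (sum-nonNeg ys)

pairs-* : ∀ (W : A → A → ℚ) k xs → pairs (λ x y → W x y ℚ.* k) xs ≡ k ℚ.* pairs W xs
pairs-* W k []       = sym (ℚ.*-zeroʳ k)
pairs-* W k (x ∷ xs) = trans
  (cong₂ ℚ._+_ (trans (∑-cong xs (λ {y} _ → ℚ.*-comm (W x y) k)) (∑-* k (W x) xs))
      (pairs-* W k xs))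
  (sym (ℚ.*-distribˡ-+ k (∑ (W x) xs) (pairs W xs)))

module _ (ω : Arrangement n) where
  open Kernel ω

  continue : ∀ {G : Graph n} (rs : Reveals G) → Arrangement n × ℕ → Dist ℕ
  continue rs (π , c) = randFrom π rs >>= λ c′ → return (c + c′)

  -- The cost k paid so far is part of the statement, since the expectation of k + c
  -- splits into k and the expectation of c only for distributions of mass 1.
  expected-cost : ∀ {G : Graph n} (rs : Reveals G) π → Tight G π → Tight (finalGraph rs) ω → ∀ k →
                  expect (λ c → ι (k + c)) (randFrom π rs)
                    ℚ.≤ ι k ℚ.+ pairs K⟨ weight G ⟩ (word π)
  expected-cost {G} [] π tight tight-ω k = begin
    expect (λ c → ι (k + c)) (return 0)      ≡⟨ expect-return (λ c → ι (k + c)) 0 ⟩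
    ι (k + 0)                                ≡⟨ cong ι (ℕ.+-identityʳ k) ⟩
    ι k                                      ≡⟨ ℚ.+-identityʳ (ι k) ⟨
    ι k ℚ.+ 0ℚ                               ≤⟨ ℚ.+-monoʳ-≤ (ι k) (pairs-nonNeg
      (λ u v → *-nonNeg (K-nonNeg u v) (ℚ.+-mono-≤ (credit-nonNeg n (size G u))
          (credit-nonNeg n (size G v)))) (word π)) ⟩
    ι k ℚ.+ pairs K⟨ weight G ⟩ (word π)     ∎
    where open ℚ.≤-Reasoning
  expected-cost {G} (reveal x z x≁z lines rs) π tight tight-ω k =
    ℚ.≤-trans (ℚ.≤-reflexive (expect->>= (λ c → ι (k + c)) (randUpdate π G x z (lines x))
        (continue rs))) updated
    where
    g : Arrangement n × ℕ → ℚ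
    g (π′ , c) = expect (λ c′ → ι (k + c′)) (continue rs (π′ , c))
    g-bound : ∀ π′ c → Tight ((x , z) ∷ G) π′ → g (π′ , c)
              ℚ.≤ ι k ℚ.+ (ι c ℚ.+ pairs K⟨ weight ((x , z) ∷ G) ⟩ (word π′))
    g-bound π′ c tight′ = begin
      g (π′ , c)
        ≡⟨ expect->>= (λ c′ → ι (k + c′)) (randFrom π′ rs) (λ c′ → return (c + c′)) ⟩
      expect (λ c′ → expect (λ c″ → ι (k + c″)) (return (c + c′))) (randFrom π′ rs)
        ≡⟨ expect-cong (randFrom π′ rs) (λ c′ → trans (expect-return (λ c″ → ι (k + c″)) (c + c′))
            (cong ι (sym (ℕ.+-assoc k c c′)))) ⟩
      expect (λ c′ → ι (k + c + c′)) (randFrom π′ rs)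
        ≤⟨ expected-cost rs π′ tight′ tight-ω (k + c) ⟩
      ι (k + c) ℚ.+ Φ
        ≡⟨ cong (ℚ._+ Φ) (ι-+ k c) ⟩
      ι k ℚ.+ ι c ℚ.+ Φ
        ≡⟨ ℚ.+-assoc (ι k) (ι c) Φ ⟩
      ι k ℚ.+ (ι c ℚ.+ Φ) ∎
      where
      open ℚ.≤-Reasoning
      Φ = pairs K⟨ weight ((x , z) ∷ G) ⟩ (word π′)
    tight-ω′ : Tight ((x , z) ∷ G) ω
    tight-ω′ i = tight-ω (⊆-finalGraph rs i)
    Bound : Dist (Arrangement n × ℕ) → Set
    Bound μ = expect g μ ℚ.≤ ι k ℚ.+ pairs K⟨ weight G ⟩ (word π)
    via : ∀ {l r} (merge : Merge G (x , z) (lines x) π l r) →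
        Bound (Update.update π G l r (IsPath.nodes (lines x)))
    via merge = MergeStep.merge-step merge ω tight-ω′ g (ι k) λ m c reached →
      g-bound (Merge.result merge m c) (Merge.movingCost merge m + Merge.cost merge c)
        (Merge.result-tight merge m c reached)
    updated : Bound (randUpdate π G x z (lines x))
    updated = by-cases (position π x ℕ.<? position π z)
      (λ x<z → via (mergeˡ π tight x≁z (lines x) x<z))
          (λ x≮z → via (mergeʳ π tight x≁z (lines x) x≮z))
      where
      by-cases : ∀ {P : Set} (P? : Dec P) {μ ν} → (P → Bound μ) → (¬ P → Bound ν) →
          Bound (if does P? then μ else ν)
      by-cases (yes p) t _ = t p
      by-cases (no ¬p) _ f = f ¬p

  -- Inversions and the cost of a solution

  adjacentSwap-↭ : ∀ {xs ys : List (Fin n)} → AdjacentSwap xs ys → xs ↭ ys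
  adjacentSwap-↭ here      = swap _ _ ↭refl
  adjacentSwap-↭ (there s) = prep _ (adjacentSwap-↭ s)

  -- Only the swapped pair changes its order, and it counts at most 1.
  adjacentSwap-pairs : ∀ {xs ys} → AdjacentSwap xs ys → pairs K xs ℚ.≤ 1ℚ ℚ.+ pairs K ys
  adjacentSwap-pairs (here {x} {y} {xs}) = begin
    (K x y ℚ.+ sx) ℚ.+ (sy ℚ.+ p)
      ≤⟨ ℚ.+-monoˡ-≤ (sy ℚ.+ p) (ℚ.+-monoˡ-≤ sx (ℚ.≤-trans (K-≤1 x y) one)) ⟩
    ((1ℚ ℚ.+ K y x) ℚ.+ sx) ℚ.+ (sy ℚ.+ p)
      ≡⟨ solve 5 (λ i k a b p → ((i :+ k) :+ a) :+ (b :+ p) := i :+ ((k :+ b) :+ (a :+ p))) refl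
          1ℚ (K y x) sx sy p ⟩
    1ℚ ℚ.+ ((K y x ℚ.+ sy) ℚ.+ (sx ℚ.+ p))    ∎
    where
    open ℚ.≤-Reasoning
    sx = ∑ (K x) xs
    sy = ∑ (K y) xs
    p = pairs K xs
    one : 1ℚ ℚ.≤ 1ℚ ℚ.+ K y x
    one = ℚ.≤-trans (ℚ.≤-reflexive (sym (ℚ.+-identityʳ 1ℚ))) (ℚ.+-monoʳ-≤ 1ℚ (K-nonNeg y x))
  adjacentSwap-pairs (there {x} {xs} {ys} s) = begin
    ∑ (K x) xs ℚ.+ pairs K xs
      ≤⟨ ℚ.+-mono-≤ (ℚ.≤-reflexive (∑-↭ (K x) (adjacentSwap-↭ s))) (adjacentSwap-pairs s) ⟩
    ∑ (K x) ys ℚ.+ (1ℚ ℚ.+ pairs K ys)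
      ≡⟨ solve 3 (λ a i p → a :+ (i :+ p) := i :+ (a :+ p)) refl (∑ (K x) ys) 1ℚ (pairs K ys) ⟩
    1ℚ ℚ.+ (∑ (K x) ys ℚ.+ pairs K ys)   ∎
    where open ℚ.≤-Reasoning

  swaps-pairs : ∀ {m xs ys} → Swaps m xs ys → pairs K xs ℚ.≤ ι m ℚ.+ pairs K ys
  swaps-pairs {xs = xs} [] =
      ℚ.≤-reflexive (sym (trans (cong (ℚ._+ pairs K xs) ι-0) (ℚ.+-identityˡ (pairs K xs))))
  swaps-pairs {suc m} {xs} {ys} (_∷_ {ys = zs} s ss) = begin
    pairs K xs                         ≤⟨ adjacentSwap-pairs s ⟩
    1ℚ ℚ.+ pairs K zs                  ≤⟨ ℚ.+-monoʳ-≤ 1ℚ (swaps-pairs ss) ⟩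
    1ℚ ℚ.+ (ι m ℚ.+ pairs K ys)        ≡⟨ ℚ.+-assoc 1ℚ (ι m) (pairs K ys) ⟨
    1ℚ ℚ.+ ι m ℚ.+ pairs K ys          ≡⟨ cong (λ i → i ℚ.+ ι m ℚ.+ pairs K ys) ι-1 ⟨
    ι 1 ℚ.+ ι m ℚ.+ pairs K ys         ≡⟨ cong (ℚ._+ pairs K ys) (ι-+ 1 m) ⟨
    ι (suc m) ℚ.+ pairs K ys           ∎
    where open ℚ.≤-Reasoning

  -- `swaps-pairs` telescopes along the solution. When `ω` is its final arrangement, the last term
  -- is 0.
  solution-pairs : ∀ {G : Graph n} {rs : Reveals G} π (s : Solution rs) →
                   pairs K (word π) ℚ.≤ ι (solutionCost π s) ℚ.+ pairs K (word (final π s))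
  solution-pairs π [] = swaps-pairs {xs = word π} []
  solution-pairs π (choose π′ _ s) = begin
    pairs K (word π)
      ≤⟨ swaps-pairs (proj₁ (proj₂ (kendallTau π π′))) ⟩
    ι (d π π′) ℚ.+ pairs K (word π′)
      ≤⟨ ℚ.+-monoʳ-≤ (ι (d π π′)) (solution-pairs π′ s) ⟩
    ι (d π π′) ℚ.+ (ι (solutionCost π′ s) ℚ.+ p)
      ≡⟨ ℚ.+-assoc (ι (d π π′)) (ι (solutionCost π′ s)) p ⟨
    ι (d π π′) ℚ.+ ι (solutionCost π′ s) ℚ.+ p
      ≡⟨ cong (ℚ._+ p) (ι-+ (d π π′) (solutionCost π′ s)) ⟨
    ι (d π π′ + solutionCost π′ s) ℚ.+ p                  ∎
    where
    open ℚ.≤-Reasoning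
    p = pairs K (word (final π′ s))

-- All components have at least one node, so each of the at most `Opt σ` pairs inverted in `π₀`
-- holds at most `credit n 1` for either node. For positive n the factor is 4 (Hₙ - 1).
rand-bound : ∀ (σ : LineInstance n) →
             𝔼 (Rand σ) ℚ.≤ ι (Opt σ) ℚ.* (credit n 1 ℚ.+ credit n 1)
rand-bound {n} σ = begin
  𝔼 (Rand σ)                               ≡⟨ 𝔼≡expect (Rand σ) ⟩
  expect ι (Rand σ)                        ≤⟨ expected-cost ω reveals π₀ (λ ()) tight-ω 0 ⟩
  ι 0 ℚ.+ pairs K⟨ weight [] ⟩ (word π₀)
    ≡⟨ trans (cong (ℚ._+ pairs K⟨ weight [] ⟩ (word π₀)) ι-0)
        (ℚ.+-identityˡ (pairs K⟨ weight [] ⟩ (word π₀))) ⟩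
  pairs K⟨ weight [] ⟩ (word π₀)
    ≤⟨ pairs-mono (K⟨⟩-mono (λ u → credit-anti (size-positive [] u) (size-≤ [] u))) (word π₀) ⟩
  pairs K⟨ (λ _ → credit n 1) ⟩ (word π₀)  ≡⟨ pairs-* K k (word π₀) ⟩
  k ℚ.* pairs K (word π₀)
    ≤⟨ *-mono (ℚ.+-mono-≤ (credit-nonNeg n 1) (credit-nonNeg n 1)) inversions ⟩
  k ℚ.* ι (Opt σ)                          ≡⟨ ℚ.*-comm k (ι (Opt σ)) ⟩
  ι (Opt σ) ℚ.* k                          ∎
  where
  open ℚ.≤-Reasoning
  open LineInstance σ
  k = credit n 1 ℚ.+ credit n 1
  best : FeasibleCost σ (Opt σ)
  best = proj₁ (proj₂ (optimum σ))
  ω : Arrangement n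
  ω = final π₀ (proj₁ best)
  tight-ω : Tight (finalGraph reveals) ω
  tight-ω = final-tight π₀ [] (λ ()) (proj₁ best)
  open Kernel ω
  inversions : pairs K (word π₀) ℚ.≤ ι (Opt σ)
  inversions = begin
    pairs K (word π₀)
      ≤⟨ solution-pairs ω π₀ (proj₁ best) ⟩
    ι (solutionCost π₀ (proj₁ best)) ℚ.+ pairs K (word ω)
      ≡⟨ cong₂ (λ c p → ι c ℚ.+ p) (proj₂ best) (pairs-ascending K-ascending (word ω) before-word)
          ⟩
    ι (Opt σ) ℚ.+ 0ℚ                                               ≡⟨ ℚ.+-identityʳ (ι (Opt σ)) ⟩
    ι (Opt σ)                                                      ∎

-- From harmonic numbers to the logarithm

theorem8 : (n : ℕ) .{{_ : NonZero n}} (σ : LineInstance n) →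
    fromℚ (𝔼 (Rand σ)) ≤ℝ Opt σ · 8 · ln n
theorem8 (suc k) σ m = begin
  𝔼 (Rand σ)                                     ≤⟨ rand-bound σ ⟩
  ι (Opt σ) ℚ.* ((h ℚ.+ h) ℚ.+ (h ℚ.+ h))        ≤⟨ *-mono (ι-nonNeg (Opt σ)) h≤ ⟩
  ι (Opt σ) ℚ.* ((8 ÷ 1) ℚ.* l)                  ≡⟨ cong (ℚ._* ((8 ÷ 1) ℚ.* l)) (ι≡ (Opt σ)) ⟩
  (Opt σ ÷ 1) ℚ.* ((8 ÷ 1) ℚ.* l)
    ≡⟨ ℚ.+-identityʳ ((Opt σ ÷ 1) ℚ.* ((8 ÷ 1) ℚ.* l)) ⟨
  (Opt σ ÷ 1) ℚ.* ((8 ÷ 1) ℚ.* l) ℚ.+ 0ℚ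
    ≤⟨ ℚ.+-monoʳ-≤ ((Opt σ ÷ 1) ℚ.* ((8 ÷ 1) ℚ.* l))
        (ℚ.+-mono-≤ (recip-nonNeg m) (recip-nonNeg m)) ⟩
  (Opt σ ÷ 1) ℚ.* ((8 ÷ 1) ℚ.* l) ℚ.+ (1/suc m ℚ.+ 1/suc m) ∎
  where
  open ℚ.≤-Reasoning
  h l : ℚ
  h = recipSum 1 k
  -- The index is the one at which the two nested `_·_`, by `Opt σ` and by 8, evaluate `ln` in their
  -- approximation number `m`.
  l = seq (ln (suc k)) (8 * suc (Opt σ * suc m))
  -- `h` is the lower Riemann sum of 1/t from 1 to k + 1 for unit intervals, and `l` is the one for
  -- a refinement of them.
  h≤l : h ℚ.≤ l
  h≤l = ℚ.≤-trans (refine-lower (8 * suc (Opt σ * suc m)) 1 k)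
    (ℚ.≤-reflexive (cong (λ a → recipSum a (suc (8 * suc (Opt σ * suc m)) * k))
        (ℕ.*-identityʳ (suc (8 * suc (Opt σ * suc m))))))
  h≤ : (h ℚ.+ h) ℚ.+ (h ℚ.+ h) ℚ.≤ (8 ÷ 1) ℚ.* l
  h≤ = begin
    (h ℚ.+ h) ℚ.+ (h ℚ.+ h)
      ≡⟨ solve 1 (λ h → (h :+ h) :+ (h :+ h) := con (4 ÷ 1) :* h) refl h ⟩
    (4 ÷ 1) ℚ.* h              ≤⟨ *-mono (÷-nonNeg 4 1) h≤l ⟩
    (4 ÷ 1) ℚ.* l              ≡⟨ ℚ.+-identityʳ ((4 ÷ 1) ℚ.* l) ⟨
    -- The potential argument yields the factor 4; since `l` is nonnegative, it may be doubled to 8.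
    (4 ÷ 1) ℚ.* l ℚ.+ 0ℚ
      ≤⟨ ℚ.+-monoʳ-≤ ((4 ÷ 1) ℚ.* l)
          (*-nonNeg (÷-nonNeg 4 1) (ℚ.≤-trans (recipSum-nonNeg 1 k) h≤l)) ⟩
    (4 ÷ 1) ℚ.* l ℚ.+ (4 ÷ 1) ℚ.* l
      ≡⟨ solve 1 (λ l → con (4 ÷ 1) :* l :+ con (4 ÷ 1) :* l := con (8 ÷ 1) :* l) refl l ⟩
    (8 ÷ 1) ℚ.* l              ∎
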